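{- Let $t$ be a positive integer and $g=2t+2$. Let $\omega\in\mathcal{DD}_{(2t+2)}$, let $\mathbf{v}=(v_1,\dots,v_t)\in\mathbb{Z}^t$ be its $V_{g,t}$-coding, and set $r_i=v_i-t-1$ for $1\leq i\leq t$. Then $$\lvert\omega\rvert=\frac{1}{g}\sum_{i=1}^{t}r_i^2-\frac{(g/2-1)(g-1)}{12}.$$ Moreover, setting $\alpha_i(\omega)=\#\{u\in\omega: h_u=g-i,\ \varepsilon_u=1\}$ for $1\leq i\leq g-1$, for every field $F$ and every function $\tau:\mathbb{Z}\to F^{\times}$, $$\prod_{s\in\omega}\frac{\tau(h_s-\varepsilon_s g)}{\tau(h_s)}=\prod_{i=1}^{g-1}\left(\frac{\tau(-i)}{\tau(i)}\right)^{\alpha_i(\omega)}\prod_{i=1}^{t}\frac{\tau(r_i)}{\tau(i)}\prod_{1\leq i<j\leq t}\frac{\tau(r_i-r_j)}{\tau(j-i)}\,\frac{\tau(r_i+r_j)}{\tau(g-i-j)}.$$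
   Context: A partition $\lambda=(\lambda_1\geq\lambda_2\geq\dots)$ (with $\lambda_i=0$ for $i>\ell(\lambda)$) has Ferrers diagram consisting of boxes $(i,j)$ with $1\leq j\leq\lambda_i$; products/counts "over $s\in\omega$" range over these boxes. $\lambda'$ is the conjugate partition, $|\lambda|=\sum\lambda_i$. The hook length of a box $s=(i,j)$ is $h_s=\lambda_i-j+\lambda'_j-i+1$. The Durfee size is $d_\lambda=\max\{s:\lambda_s\geq s\}$. For a box $s=(i,j)$, $\varepsilon_s=-1$ if $i>j$ and $\varepsilon_s=1$ otherwise. A partition is a $k$-core if none of its hook lengths is divisible by $k$. $\mathcal{DD}$ is the set of partitions $\lambda$ with $\lambda_i=\lambda'_i+1$ for all $1\leq i\leq d_\lambda$; $\mathcal{DD}_{(k)}$ is the set of its elements that are $k$-cores. $V_{g,t}$-coding: for a partition $\lambda$ and each residue $r\in\{0,\dots,g-1\}$, let $\beta_r=g+\max\{\lambda_j-j: j\geq 1,\ \lambda_j-j\equiv r \pmod g\}$ ($j$ ranging over all positive integers, $\lambda_j=0$ for $j>\ell(\lambda)$). These are distinct; list them decreasingly $\beta_{\sigma(1)}>\dots>\beta_{\sigma(g)}$. The $V_{g,t}$-coding of $\lambda$ is $(v_1,\dots,v_t)=(\beta_{\sigma(1)},\dots,\beta_{\sigma(t)})$. -}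

module Defs where

open import Algebra.Apartness.Bundles using (HeytingField; HeytingCommutativeRing)
open import Algebra.Bundles using (CommutativeRing)
open import Algebra.Definitions using (Invertible)
import Algebra.Properties.Semiring.Exp as Exp
open import Data.Bool.Base using (if_then_else_)
open import Data.Fin.Base as Fin using (Fin; toℕ; inject≤)
open import Data.Fin.Permutation using (Permutation′; _⟨$⟩ʳ_)
open import Data.Integer.Base as ℤ using (ℤ; +_; 0ℤ; 1ℤ; -1ℤ)
open import Data.Integer.Divisibility using (_∣_)
import Data.Integer.Properties as ℤ
open import Data.List.Base using (List; []; _∷_; map; foldr; filter; length; concatMap; applyUpTo)
open import Data.List.Extrema.Nat using (max)
open import Data.List.Membership.Propositional using (_∈_)
open import Data.List.Relation.Unary.All using (All)
open import Data.List.Relation.Unary.Linked using (Linked)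
open import Data.Nat.Base using (ℕ; zero; suc; _≤_; _<_; _≥_)
open import Data.Nat.ListAction using (sum)
open import Data.Nat.Properties using (_≤?_; _<?_)
open import Data.Product.Base using (_×_; _,_; ∃; ∃-syntax)
open import Level using (Level; _⊔_)
open import Relation.Binary.PropositionalEquality.Core using (_≡_)
open import Relation.Nullary.Decidable.Core using (does; _×-dec_)
open import Relation.Nullary.Negation.Core using (¬_)

[1⋯_] : ℕ → List ℕ
[1⋯ n ] = applyUpTo suc n

record Partition : Set where
  field
    parts    : List ℕ
    sorted   : Linked _≥_ parts
    positive : All (0 <_) parts

open Partition public

nth : List ℕ → ℕ → ℕ
nth []       _       = 0
nth (x ∷ _)  zero    = x
nth (_ ∷ xs) (suc i) = nth xs i

-- λᵢ is indexed from 1; the value at 0 is junk.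
part : Partition → ℕ → ℕ
part p zero    = 0
part p (suc i) = nth (parts p) i

ℓ : Partition → ℕ
ℓ p = length (parts p)

-- λ′ⱼ, the length of the j-th column of the Ferrers diagram (j ≥ 1).
conj : Partition → ℕ → ℕ
conj p j = length (filter (j ≤?_) (parts p))

size : Partition → ℕ
size p = sum (parts p)

Box : Set
Box = ℕ × ℕ

boxes : Partition → List Box
boxes p = concatMap (λ i → map (i ,_) [1⋯ part p i ]) [1⋯ ℓ p ]

hook : Partition → Box → ℤ
hook p (i , j) = + part p i ℤ.- + j ℤ.+ + conj p j ℤ.- + i ℤ.+ 1ℤ

ε : Box → ℤ
ε (i , j) = if does (j <? i) then -1ℤ else 1ℤ

-- The maximum is 0 for the empty partition; λₛ ≥ s ≥ 1 forces s ≤ ℓ(λ).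
durfee : Partition → ℕ
durfee p = max 0 (filter (λ s → s ≤? part p s) [1⋯ ℓ p ])

IsCore : ℕ → Partition → Set
IsCore k p = ∀ s → s ∈ boxes p → ¬ (+ k ∣ hook p s)

DD : Partition → Set
DD p = ∀ i → 1 ≤ i → i ≤ durfee p → part p i ≡ suc (conj p i)

DD₍_₎ : ℕ → Partition → Set
DD₍ k ₎ p = DD p × IsCore k p

α : (g : ℕ) → Partition → ℕ → ℕ
α g p i = length (filter (λ u → (hook p u ℤ.≟ + g ℤ.- + i) ×-dec (ε u ℤ.≟ 1ℤ)) (boxes p))

IsMaximum : (ℤ → Set) → ℤ → Set
IsMaximum P m = P m × (∀ x → P x → x ℤ.≤ m)

-- The set { λⱼ − j : j ≥ 1, λⱼ − j ≡ r (mod g) }.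
Residual : (g : ℕ) → Partition → Fin g → ℤ → Set
Residual g p r x = ∃[ j ] 1 ≤ j × x ≡ + part p j ℤ.- + j × + g ∣ (x ℤ.- + toℕ r)

-- v is the V_{g,t}-coding of p.  The β r and σ below are determined by p, so
-- there is exactly one such v (up to pointwise equality) when 1 ≤ g and t ≤ g.
-- The index i : Fin t stands for i + 1 in the 1-based numbering v₁, …, vₜ.
record IsVCoding (g t : ℕ) (p : Partition) (v : Fin t → ℤ) : Set where
  field
    t≤g        : t ≤ g
    β          : Fin g → ℤ
    β-max      : ∀ r → ∃[ m ] IsMaximum (Residual g p r) m × β r ≡ + g ℤ.+ m
    σ          : Permutation′ g
    decreasing : ∀ a b → a Fin.< b → β (σ ⟨$⟩ʳ a) ℤ.> β (σ ⟨$⟩ʳ b)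
    coding     : ∀ i → v i ≡ β (σ ⟨$⟩ʳ inject≤ i t≤g)

module FieldNotation {c ℓ₁ ℓ₂ : Level} (F : HeytingField c ℓ₁ ℓ₂) where
  open HeytingField F public using (Carrier; _≈_; _*_; 1#)

  open Exp
    (CommutativeRing.semiring
      (HeytingCommutativeRing.commutativeRing (HeytingField.heytingCommutativeRing F)))
    public using (_^_)

  -- In a Heyting field the units are exactly the elements apart from 0.
  Fˣ : Set (c ⊔ ℓ₁)
  Fˣ = ∃ (Invertible _≈_ 1# _*_)

  infixl 7 _÷_
  _÷_ : Fˣ → Fˣ → Carrier
  (x , _) ÷ (y , y⁻¹ , _) = x * y⁻¹

  ∏ : {a : Level} {A : Set a} → List A → (A → Carrier) → Carrier
  ∏ xs f = foldr (λ x y → f x * y) 1# xs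

  infix 8 ∏
  syntax ∏ xs (λ x → e) = ∏[ x ← xs ] e

∑ : {a : Level} {A : Set a} → List A → (A → ℤ) → ℤ
∑ xs f = foldr (λ x y → f x ℤ.+ y) 0ℤ xs

infix 8 ∑
syntax ∑ xs (λ x → e) = ∑[ x ← xs ] e

index : ∀ {n} → Fin n → ℤ
index i = + suc (toℕ i)

{-# OPTIONS --safe #-}

-- Encode ω by its beads X = { λⱼ − j : j ≥ 1 }, with indicator function c.  Boxes correspond to pairs x > y with
-- x ∈ X and y ∉ X, and the hook length is x − y.  For a doubled distinct partition X is antisymmetric: 0 ∉ X, and
-- exactly one of x, −x lies in X when x ≠ 0.  Writing y = −z, a box becomes a pair (x , z) of beads (or z = 0)
-- with hook x + z, and ε = 1 exactly when x ≥ z.  Hence the exponent of τ(n) in the left-hand product is a second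
-- difference with step g of Q(n) = #{ (x , z) ∈ X² : x + z = n }, up to explicit corrections.
--
-- In a g-core every runner of the g-abacus is filled from below, so c(x − g) − c(x) is the indicator function of
-- the g first gaps, which are 0, g/2 and g/2 ± rᵢ; the second difference of Q therefore counts the sums of two
-- first gaps, i.e. the rᵢ and rᵢ ± rⱼ.  The remaining correction does not depend on ω, so it is read off from the
-- empty partition, where the rᵢ are t, …, 1.  The size formula is the second moment of the same first gaps.
module Submission where

open import Defs
open import Algebra.Apartness.Bundles using (HeytingField; HeytingCommutativeRing)
open import Algebra.Bundles using (CommutativeRing)
import Algebra.Properties.CommutativeSemigroup as CommutativeSemigroupProperties
open import Data.Bool.Base using (true; false; if_then_else_)
open import Data.Empty using (⊥; ⊥-elim)
open import Data.Fin.Base as Fin using (Fin; toℕ; fromℕ<; inject≤)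
open import Data.Fin.Permutation using (_⟨$⟩ʳ_; _⟨$⟩ˡ_; inverseˡ; inverseʳ)
open import Data.Fin.Properties using (_<?_)
import Data.Fin.Properties as Fin
open import Data.Integer.Base using (ℤ; +_; -[1+_]; 0ℤ; 1ℤ; -1ℤ; -_; _+_; _-_; _*_; _≤_; _<_; ∣_∣; +≤+; +<+; -≤+)
import Data.Integer.Base as ℤ
import Data.Integer.Divisibility as ℤ
open import Data.Integer.Divisibility.Signed using (divides; ∣ᵤ⇒∣; ∣⇒∣ᵤ)
open import Data.Integer.DivMod using (_%ℕ_; _/ℕ_; a≡a%ℕn+[a/ℕn]*n; n%ℕd<d)
import Data.Integer.Properties as ℤ
open import Data.Integer.Tactic.RingSolver using (solve-∀)
open import Data.List.Base using (List; []; _∷_; _++_; map; concatMap; applyUpTo; replicate; filter; length; allFin)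
import Data.List.Extrema.Nat as Extrema
open import Data.List.Membership.DecPropositional ℤ._≟_ using (_∈?_)
open import Data.List.Membership.Propositional using (_∈_; find; lose)
import Data.List.Membership.Propositional.Properties as ∈
import Data.List.Properties as List
open import Data.List.Relation.Binary.Permutation.Propositional using (_↭_; ↭-sym) renaming (refl to ↭-refl; prep to ↭-prep; swap to ↭-swap; trans to ↭-trans)
open import Data.List.Relation.Binary.Permutation.Propositional.Properties using (shift)
import Data.List.Relation.Unary.All as All
open import Data.List.Relation.Unary.AllPairs using ([]; _∷_)
open import Data.List.Relation.Unary.Any using (here; there; any?)
open import Data.List.Relation.Unary.Linked using (Linked; []; [-]; _∷_)
open import Data.List.Relation.Unary.Unique.Propositional using (Unique)
import Data.List.Relation.Unary.Unique.Propositional.Properties as Unique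
open import Data.Nat.Base using (ℕ; zero; suc; _∸_)
import Data.Nat.Base as ℕ
import Data.Nat.Divisibility as ℕ
open import Data.Nat.ListAction using (sum)
import Data.Nat.Properties as ℕ
import Data.Nat.Tactic.RingSolver as ℕ
open import Data.Product.Base using (_×_; _,_; proj₁; proj₂; ∃; ∃-syntax)
open import Data.Rational.Base using (_/_; 1ℚ)
import Data.Rational.Base as ℚ
import Data.Rational.Properties as ℚ
import Data.Rational.Unnormalised.Base as ℚᵘ
import Data.Rational.Unnormalised.Properties as ℚᵘ
open import Data.Sum.Base using (_⊎_; inj₁; inj₂)
open import Algebra.Properties.AbelianGroup ℤ.+-0-abelianGroup using () renaming (∙-cancelʳ to ℤ-cancelʳ)
open import Function.Base using (_∘_; id)
open import Level using (Level)
open import Relation.Binary.Definitions using (Tri; tri<; tri≈; tri>)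
open import Relation.Binary.PropositionalEquality
import Relation.Binary.Reasoning.Setoid as SetoidReasoning
open import Relation.Nullary using (¬_; Dec; yes; no; contradiction; does)
open import Relation.Nullary.Decidable using (decidable-stable; dec-true; dec-false; _×-dec_)

-- The α-product is what lets one formula hold for every n > 0. The exponent of τ(n) on the left
-- contains the number of boxes with hook length n - g and ε = -1, which fits the second difference
-- only for n ≥ g. For n < g the α-product supplies the number of boxes with hook length g - n and ε
-- = 1 in its place, and the obstacle is to express this number by Q at the negative argument n - g.
-- Here antisymmetry is used a second time: `A⁺ m - A⁺ (- m)` is linear in the beads, and averaging
-- over x and -x removes the beads up to the diagonal pairs 2x = -m. At n ≤ 0 the factors τ(-i)
-- match the factors τ(h - g) with h < g directly. Since τ is arbitrary, both sides are compared as
-- formal products, argument by argument. The bead set is infinite, so counts are sums of finitely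
-- supported functions on ℤ, and an identity between counts comes from evaluating one summand twice,
-- after a shift or a reflection. The counts stay doubled until the comparison with the empty
-- partition is complete.

private variable
  ℓᵃ ℓᵇ : Level
  A : Set ℓᵃ
  B : Set ℓᵇ

-- Linear arithmetic by certificates: 0 ≤ e is transported along an identity found by the ring solver.

nonneg : ∀ {x y} → x ≤ y → 0ℤ ≤ y - x
nonneg = ℤ.i≤j⇒0≤j-i

-- Over the integers a strict inequality is worth a whole unit. Keeping the `- 1ℤ` lets a sum of
-- certificates reach the constant -1, which `absurd` refutes.
pos : ∀ {x y} → x < y → 0ℤ ≤ y - x - 1ℤ
pos {x} {y} x<y = subst (0ℤ ≤_) (e x y) (nonneg (ℤ.i<j⇒suc[i]≤j x<y))
  where e : ∀ x y → y - (1ℤ + x) ≡ y - x - 1ℤ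
        e = solve-∀

≤-from : ∀ {x y z} → 0ℤ ≤ z → z ≡ y - x → x ≤ y
≤-from 0≤z eq = ℤ.0≤i-j⇒j≤i (subst (0ℤ ≤_) eq 0≤z)

<-from : ∀ {x y z} → 0ℤ ≤ z → z ≡ y - x - 1ℤ → x < y
<-from {x} {y} 0≤z eq = ℤ.suc[i]≤j⇒i<j (≤-from 0≤z (trans eq (e x y)))
  where e : ∀ x y → y - x - 1ℤ ≡ y - (1ℤ + x)
        e = solve-∀

absurd : ∀ {z} → 0ℤ ≤ z → z ≡ -1ℤ → ⊥
absurd 0≤z refl with () ← 0≤z

infixl 6 _⊕_
_⊕_ : ∀ {x y} → 0ℤ ≤ x → 0ℤ ≤ y → 0ℤ ≤ x + y
_⊕_ = ℤ.+-mono-≤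

-- Indicators and finite sums.

I : {P : Set ℓᵃ} → Dec P → ℤ
I (yes _) = 1ℤ
I (no _)  = 0ℤ

I-yes : {P : Set ℓᵃ} (d : Dec P) → P → I d ≡ 1ℤ
I-yes (yes _) _ = refl
I-yes (no ¬p) p = contradiction p ¬p

I-no : {P : Set ℓᵃ} (d : Dec P) → ¬ P → I d ≡ 0ℤ
I-no (yes p) ¬p = contradiction p ¬p
I-no (no _)  _  = refl

abstract
  -- Kept opaque, so that `δ x y` stays an atom in goals and never unfolds to a decision procedure;
  -- `δ-≡` and `δ-≢` are its whole interface.
  δ : ℤ → ℤ → ℤ
  δ x y = I (x ℤ.≟ y)

  δ-≡ : ∀ {x y} → x ≡ y → δ x y ≡ 1ℤ
  δ-≡ {x} {y} = I-yes (x ℤ.≟ y)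

  δ-≢ : ∀ {x y} → ¬ x ≡ y → δ x y ≡ 0ℤ
  δ-≢ {x} {y} = I-no (x ℤ.≟ y)

δ-cong : ∀ x y z w → (x ≡ y → z ≡ w) → (z ≡ w → x ≡ y) → δ x y ≡ δ z w
δ-cong x y z w f g with x ℤ.≟ y
... | yes p = trans (δ-≡ p) (sym (δ-≡ (f p)))
... | no ¬p = trans (δ-≢ ¬p) (sym (δ-≢ (¬p ∘ g)))

x-y≡0⇒x≡y : ∀ x y {z} → z ≡ 0ℤ → z ≡ x - y → x ≡ y
x-y≡0⇒x≡y x y p q = ℤ.i-j≡0⇒i≡j x y (trans (sym q) p)

δ-shift : ∀ x y z w → x - y ≡ z - w → δ x y ≡ δ z w
δ-shift x y z w eq = δ-cong x y z w
  (λ p → ℤ.i-j≡0⇒i≡j z w (trans (sym eq) (ℤ.i≡j⇒i-j≡0 p)))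
  (λ p → ℤ.i-j≡0⇒i≡j x y (trans eq (ℤ.i≡j⇒i-j≡0 p)))

δ-flip : ∀ x y z w → x - y ≡ w - z → δ x y ≡ δ z w
δ-flip x y z w eq = trans (δ-shift x y w z eq) (δ-cong w z z w sym sym)

δ-subst : ∀ (f : ℤ → ℤ) x y → δ x y * f x ≡ δ x y * f y
δ-subst f x y with x ℤ.≟ y
... | yes refl = refl
... | no x≢y   = trans (cong (_* f x) (δ-≢ x≢y)) (sym (cong (_* f y) (δ-≢ x≢y)))

δ-pos : ∀ {x y z} → 0ℤ ≤ z → z ≡ x - y - 1ℤ → δ x y ≡ 0ℤ
δ-pos {x} {y} p e = δ-≢ λ x≡y → absurd p (trans e (cong (_- 1ℤ) (ℤ.i≡j⇒i-j≡0 x≡y)))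

δ-neg : ∀ {x y z} → 0ℤ ≤ z → z ≡ y - x - 1ℤ → δ x y ≡ 0ℤ
δ-neg {x} {y} p e = δ-≢ λ x≡y → absurd p (trans e (cong (_- 1ℤ) (ℤ.i≡j⇒i-j≡0 (sym x≡y))))

∑-cong : (xs : List A) {f g : A → ℤ} → (∀ x → x ∈ xs → f x ≡ g x) → ∑ xs f ≡ ∑ xs g
∑-cong []       _ = refl
∑-cong (x ∷ xs) h = cong₂ _+_ (h x (here refl)) (∑-cong xs (λ y → h y ∘ there))

∑-ext : (xs : List A) {f g : A → ℤ} → (∀ x → f x ≡ g x) → ∑ xs f ≡ ∑ xs g
∑-ext xs h = ∑-cong xs (λ x _ → h x)

∑-zero : (xs : List A) {f : A → ℤ} → (∀ x → x ∈ xs → f x ≡ 0ℤ) → ∑ xs f ≡ 0ℤ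
∑-zero []       _ = refl
∑-zero (x ∷ xs) h = cong₂ _+_ (h x (here refl)) (∑-zero xs (λ y → h y ∘ there))

private
  plus-interchange : ∀ p q r s → (p + q) + (r + s) ≡ (p + r) + (q + s)
  plus-interchange = solve-∀

  minus-interchange : ∀ p q r s → (p - q) + (r - s) ≡ (p + r) - (q + s)
  minus-interchange = solve-∀

∑-+ : (xs : List A) (f g : A → ℤ) → ∑ xs (λ x → f x + g x) ≡ ∑ xs f + ∑ xs g
∑-+ []       f g = refl
∑-+ (x ∷ xs) f g = trans (cong (_+_ (f x + g x)) (∑-+ xs f g)) (plus-interchange (f x) (g x) (∑ xs f) (∑ xs g))

∑-- : (xs : List A) (f g : A → ℤ) → ∑ xs (λ x → f x - g x) ≡ ∑ xs f - ∑ xs g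
∑-- []       f g = refl
∑-- (x ∷ xs) f g = trans (cong (_+_ (f x - g x)) (∑-- xs f g)) (minus-interchange (f x) (g x) (∑ xs f) (∑ xs g))

∑-*ˡ : (xs : List A) (k : ℤ) (f : A → ℤ) → ∑ xs (λ x → k * f x) ≡ k * ∑ xs f
∑-*ˡ []       k f = sym (ℤ.*-zeroʳ k)
∑-*ˡ (x ∷ xs) k f = trans (cong (_+_ (k * f x)) (∑-*ˡ xs k f)) (sym (ℤ.*-distribˡ-+ k (f x) (∑ xs f)))

∑-++ : (xs ys : List A) (f : A → ℤ) → ∑ (xs ++ ys) f ≡ ∑ xs f + ∑ ys f
∑-++ []       ys f = sym (ℤ.+-identityˡ _)
∑-++ (x ∷ xs) ys f = trans (cong (_+_ (f x)) (∑-++ xs ys f)) (sym (ℤ.+-assoc (f x) _ _))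

∑-map : (h : A → B) (xs : List A) (f : B → ℤ) → ∑ (map h xs) f ≡ ∑ xs (f ∘ h)
∑-map h []       f = refl
∑-map h (x ∷ xs) f = cong (_+_ (f (h x))) (∑-map h xs f)

∑-concatMap : (h : A → List B) (xs : List A) (f : B → ℤ) →
              ∑ (concatMap h xs) f ≡ ∑ xs (λ x → ∑ (h x) f)
∑-concatMap h []       f = refl
∑-concatMap h (x ∷ xs) f = trans (∑-++ (h x) (concatMap h xs) f) (cong (_+_ (∑ (h x) f)) (∑-concatMap h xs f))

∑-swap : (xs : List A) (ys : List B) (f : A → B → ℤ) →
         ∑ xs (λ x → ∑ ys (f x)) ≡ ∑ ys (λ y → ∑ xs (λ x → f x y))
∑-swap []       ys f = sym (∑-zero ys (λ _ _ → refl))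
∑-swap (x ∷ xs) ys f = trans (cong (_+_ (∑ ys (f x))) (∑-swap xs ys f))
                             (sym (∑-+ ys (f x) (λ y → ∑ xs (λ x → f x y))))

∑-replicate : ∀ k (x : A) (f : A → ℤ) → ∑ (replicate k x) f ≡ + k * f x
∑-replicate zero    x f = refl
∑-replicate (suc k) x f = trans (cong (_+_ (f x)) (∑-replicate k x f)) (e (f x) (+ k))
  where e : ∀ f k → f + k * f ≡ (1ℤ + k) * f
        e = solve-∀

∑-nonneg : (xs : List A) {f : A → ℤ} → (∀ x → 0ℤ ≤ f x) → 0ℤ ≤ ∑ xs f
∑-nonneg []       h = ℤ.≤-refl
∑-nonneg (x ∷ xs) h = h x ⊕ ∑-nonneg xs h

∑-filter : {P : A → Set ℓᵇ} (P? : ∀ x → Dec (P x)) (xs : List A) (f : A → ℤ) →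
           ∑ (filter P? xs) f ≡ ∑ xs (λ x → I (P? x) * f x)
∑-filter P? []       f = refl
∑-filter P? (x ∷ xs) f with P? x
... | yes _ = cong₂ _+_ (sym (ℤ.*-identityˡ (f x))) (∑-filter P? xs f)
... | no _  = trans (∑-filter P? xs f) (sym (ℤ.+-identityˡ _))

length-filter : {P : A → Set ℓᵇ} (P? : ∀ x → Dec (P x)) (xs : List A) →
                + length (filter P? xs) ≡ ∑ xs (I ∘ P?)
length-filter P? []       = refl
length-filter P? (x ∷ xs) with P? x
... | yes _ = cong (_+_ 1ℤ) (length-filter P? xs)
... | no _  = trans (length-filter P? xs) (sym (ℤ.+-identityˡ _))

∑-single : {xs : List A} → Unique xs → (f : A → ℤ) → ∀ {k} → k ∈ xs →
           (∀ x → x ∈ xs → ¬ x ≡ k → f x ≡ 0ℤ) → ∑ xs f ≡ f k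
∑-single (x∉xs ∷ _) f (here refl) h =
  trans (cong (_+_ (f _)) (∑-zero _ (λ y y∈ → h y (there y∈) (λ y≡ → All.lookup x∉xs y∈ (sym y≡)))))
        (ℤ.+-identityʳ _)
∑-single (x∉xs ∷ u) f (there k∈) h =
  trans (cong₂ _+_ (h _ (here refl) (All.lookup x∉xs k∈)) (∑-single u f k∈ (λ y → h y ∘ there)))
        (ℤ.+-identityˡ _)

∈-[1⋯]⁺ : ∀ {i n} → 1 ℕ.≤ i → i ℕ.≤ n → i ∈ [1⋯ n ]
∈-[1⋯]⁺ {suc i} _ i<n = ∈.∈-applyUpTo⁺ suc i<n

∈-[1⋯]⁻ : ∀ {i n} → i ∈ [1⋯ n ] → 1 ℕ.≤ i × i ℕ.≤ n
∈-[1⋯]⁻ i∈ with _ , i<n , refl ← ∈.∈-applyUpTo⁻ suc i∈ = ℕ.s≤s ℕ.z≤n , i<n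

[1⋯]-unique : ∀ n → Unique [1⋯ n ]
[1⋯]-unique n = Unique.applyUpTo⁺₁ suc n (λ i<j _ → ℕ.<⇒≢ i<j ∘ ℕ.suc-injective)

-- Sums of finitely supported functions on ℤ

abstract
  window : ℕ → List ℤ
  window M = applyUpTo (λ k → + k - + M) (suc (M ℕ.+ M))

  window-unique : ∀ M → Unique (window M)
  window-unique M = Unique.applyUpTo⁺₁ _ _ λ {i} {j} i<j _ eq →
    ℕ.<⇒≢ i<j (ℤ.+-injective (ℤ-cancelʳ (- + M) (+ i) (+ j) eq))

  ∈-window⁺ : ∀ {M x} → - + M ≤ x → x ≤ + M → x ∈ window M
  ∈-window⁺ {M} {x} l u = subst (_∈ window M) k-M≡x (∈.∈-applyUpTo⁺ (λ k → + k - + M) k<)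
    where
    k : ℕ
    k = ∣ x + + M ∣
    +k : + k ≡ x + + M
    +k = ℤ.0≤i⇒+∣i∣≡i (subst (0ℤ ≤_) (e x (+ M)) (nonneg l))
      where e : ∀ x m → x - - m ≡ x + m
            e = solve-∀
    k-M≡x : + k - + M ≡ x
    k-M≡x = trans (cong (_- + M) +k) (e x (+ M))
      where e : ∀ x m → x + m - m ≡ x
            e = solve-∀
    k< : k ℕ.< suc (M ℕ.+ M)
    k< = ℕ.s≤s (ℤ.drop‿+≤+ (≤-from (nonneg u) (trans (e x (+ M)) (cong₂ _-_ (sym (ℤ.pos-+ M M)) (sym +k)))))
      where e : ∀ x m → m - x ≡ m + m - (x + m)
            e = solve-∀

  ∈-window⁻ : ∀ {M x} → x ∈ window M → - + M ≤ x × x ≤ + M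
  ∈-window⁻ {M} x∈ with k , k< , refl ← ∈.∈-applyUpTo⁻ (λ k → + k - + M) x∈ =
    ≤-from {z = + k} (+≤+ ℕ.z≤n) (e (+ k) (+ M)) ,
    ≤-from (nonneg (ℤ.≤-trans (+≤+ (ℕ.≤-pred k<)) (ℤ.≤-reflexive (ℤ.pos-+ M M)))) (e′ (+ k) (+ M))
    where
    e : ∀ k m → k ≡ k - m - - m
    e = solve-∀
    e′ : ∀ k m → m + m - k ≡ m - (k - m)
    e′ = solve-∀

-- A relation between f and its sum, with the bound on the support stored inside. Two derivations
-- for the same f, obtained in different ways and with different radii, then give an equation of
-- sums through `unique`.
record HasSum (f : ℤ → ℤ) (s : ℤ) : Set where
  constructor hasSum
  field
    radius     : ℕ
    zero-below : ∀ x → x < - + radius → f x ≡ 0ℤ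
    zero-above : ∀ x → + radius < x → f x ≡ 0ℤ
    windowSum  : ∑ (window radius) f ≡ s

open HasSum

-- Writing f as a finite combination of point masses turns every reindexing of its sum into an
-- exchange of two finite sums.
expand : ∀ {f s} (h : HasSum f s) x → f x ≡ ∑ (window (radius h)) (λ p → f p * δ x p)
expand {f} h x with x ℤ.<? - + radius h
... | yes l = trans (zero-below h x l) (sym (∑-zero (window (radius h)) (λ p _ → zero-term p)))
  where
  zero-term : ∀ p → f p * δ x p ≡ 0ℤ
  zero-term p with x ℤ.≟ p
  ... | yes refl = cong (_* δ x p) (zero-below h x l)
  ... | no x≢p = trans (cong (_*_ (f p)) (δ-≢ x≢p)) (ℤ.*-zeroʳ (f p))
... | no ¬l with + radius h ℤ.<? x
...   | yes u = trans (zero-above h x u) (sym (∑-zero (window (radius h)) (λ p _ → zero-term p)))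
  where
  zero-term : ∀ p → f p * δ x p ≡ 0ℤ
  zero-term p with x ℤ.≟ p
  ... | yes refl = cong (_* δ x p) (zero-above h x u)
  ... | no x≢p = trans (cong (_*_ (f p)) (δ-≢ x≢p)) (ℤ.*-zeroʳ (f p))
...   | no ¬u = sym (trans (∑-single (window-unique (radius h)) _ (∈-window⁺ (ℤ.≮⇒≥ ¬l) (ℤ.≮⇒≥ ¬u)) other)
                     (trans (cong (_*_ (f x)) (δ-≡ refl)) (ℤ.*-identityʳ (f x))))
  where
  other : ∀ p → p ∈ window (radius h) → ¬ p ≡ x → f p * δ x p ≡ 0ℤ
  other p _ p≢x = trans (cong (_*_ (f p)) (δ-≢ (λ x≡p → p≢x (sym x≡p)))) (ℤ.*-zeroʳ (f p))

-- After `expand` and the exchange of sums, the inner sum has the single term x = ψ p. It is enough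
-- that ψ maps the old window into the new one, so enlargement, translation and reflection are all
-- instances.
reindex-window : ∀ {f s} (h : HasSum f s) (φ ψ : ℤ → ℤ) → (∀ x → φ (ψ x) ≡ x) → (∀ x → ψ (φ x) ≡ x) →
                 ∀ K → (∀ x → x ∈ window (radius h) → ψ x ∈ window K) → ∑ (window K) (f ∘ φ) ≡ s
reindex-window {f} {s} h φ ψ φψ ψφ K inside = begin
  ∑ (window K) (f ∘ φ)
    ≡⟨ ∑-ext (window K) (λ x → expand h (φ x)) ⟩
  ∑ (window K) (λ x → ∑ (window (radius h)) (λ p → f p * δ (φ x) p))
    ≡⟨ ∑-swap (window K) (window (radius h)) (λ x p → f p * δ (φ x) p) ⟩
  ∑ (window (radius h)) (λ p → ∑ (window K) (λ x → f p * δ (φ x) p))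
    ≡⟨ ∑-cong (window (radius h)) inner ⟩
  ∑ (window (radius h)) f
    ≡⟨ windowSum h ⟩
  s ∎
  where
  open ≡-Reasoning
  inner : ∀ p → p ∈ window (radius h) → ∑ (window K) (λ x → f p * δ (φ x) p) ≡ f p
  inner p p∈ = trans (∑-single (window-unique K) _ (inside p p∈) other)
                     (trans (cong (_*_ (f p)) (δ-≡ (φψ p))) (ℤ.*-identityʳ (f p)))
    where
    other : ∀ x → x ∈ window K → ¬ x ≡ ψ p → f p * δ (φ x) p ≡ 0ℤ
    other x _ x≢ = trans (cong (_*_ (f p)) (δ-≢ (λ e → x≢ (trans (sym (ψφ x)) (cong ψ e))))) (ℤ.*-zeroʳ (f p))

window-mono : ∀ {M K} → M ℕ.≤ K → ∀ x → x ∈ window M → x ∈ window K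
window-mono M≤K x x∈ = let l , u = ∈-window⁻ x∈ in
  ∈-window⁺ (ℤ.≤-trans (ℤ.neg-mono-≤ (+≤+ M≤K)) l) (ℤ.≤-trans u (+≤+ M≤K))

total-at : ∀ {f s} (h : HasSum f s) {K} → radius h ℕ.≤ K → ∑ (window K) f ≡ s
total-at h {K} M≤K = reindex-window h id id (λ _ → refl) (λ _ → refl) K (window-mono M≤K)

unique : ∀ {f s s′} → HasSum f s → HasSum f s′ → s ≡ s′
unique h h′ = trans (sym (total-at h (ℕ.m≤m⊔n (radius h) (radius h′)))) (total-at h′ (ℕ.m≤n⊔m (radius h) (radius h′)))

hasSum-ext : ∀ {f g s} → (∀ x → f x ≡ g x) → HasSum f s → HasSum g s
hasSum-ext e (hasSum M l u t) =
  hasSum M (λ x p → trans (sym (e x)) (l x p)) (λ x p → trans (sym (e x)) (u x p))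
         (trans (∑-ext (window M) (sym ∘ e)) t)

private
  module Common {f g s s′} (h : HasSum f s) (h′ : HasSum g s′) where
    K : ℕ
    K = radius h ℕ.⊔ radius h′
    M≤K : + radius h ≤ + K
    M≤K = +≤+ (ℕ.m≤m⊔n (radius h) (radius h′))
    M′≤K : + radius h′ ≤ + K
    M′≤K = +≤+ (ℕ.m≤n⊔m (radius h) (radius h′))
    lows : ∀ x → x < - + K → f x ≡ 0ℤ × g x ≡ 0ℤ
    lows x p = zero-below h x (ℤ.<-≤-trans p (ℤ.neg-mono-≤ M≤K)) , zero-below h′ x (ℤ.<-≤-trans p (ℤ.neg-mono-≤ M′≤K))
    highs : ∀ x → + K < x → f x ≡ 0ℤ × g x ≡ 0ℤ
    highs x p = zero-above h x (ℤ.≤-<-trans M≤K p) , zero-above h′ x (ℤ.≤-<-trans M′≤K p)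
    totals : ∑ (window K) f ≡ s × ∑ (window K) g ≡ s′
    totals = total-at h (ℤ.drop‿+≤+ M≤K) , total-at h′ (ℤ.drop‿+≤+ M′≤K)

hasSum-+ : ∀ {f g s s′} → HasSum f s → HasSum g s′ → HasSum (λ x → f x + g x) (s + s′)
hasSum-+ {f} {g} h h′ = hasSum K
  (λ x p → let u , v = lows x p in cong₂ _+_ u v)
  (λ x p → let u , v = highs x p in cong₂ _+_ u v)
  (trans (∑-+ (window K) f g) (let u , v = totals in cong₂ _+_ u v))
  where open Common h h′

hasSum-- : ∀ {f g s s′} → HasSum f s → HasSum g s′ → HasSum (λ x → f x - g x) (s - s′)
hasSum-- {f} {g} h h′ = hasSum K
  (λ x p → let u , v = lows x p in cong₂ _-_ u v)
  (λ x p → let u , v = highs x p in cong₂ _-_ u v)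
  (trans (∑-- (window K) f g) (let u , v = totals in cong₂ _-_ u v))
  where open Common h h′

hasSum-0 : HasSum (λ _ → 0ℤ) 0ℤ
hasSum-0 = hasSum 0 (λ _ _ → refl) (λ _ _ → refl) (∑-zero (window 0) (λ _ _ → refl))

i≤∣i∣ : ∀ i → i ≤ + ∣ i ∣
i≤∣i∣ (+ n)    = ℤ.≤-refl
i≤∣i∣ -[1+ n ] = -≤+

-∣i∣≤i : ∀ i → - + ∣ i ∣ ≤ i
-∣i∣≤i (+ zero)  = ℤ.≤-refl
-∣i∣≤i (+ suc n) = -≤+
-∣i∣≤i -[1+ n ]  = ℤ.≤-refl

hasSum-δ : ∀ y k → HasSum (λ x → δ x y * k) k
hasSum-δ y k = hasSum ∣ y ∣
  (λ x p → cong (_* k) (δ-≢ λ { refl → ℤ.<-irrefl refl (ℤ.<-≤-trans p (-∣i∣≤i x)) }))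
  (λ x p → cong (_* k) (δ-≢ λ { refl → ℤ.<-irrefl refl (ℤ.≤-<-trans (i≤∣i∣ x) p) }))
  (trans (∑-single (window-unique ∣ y ∣) _ (∈-window⁺ (-∣i∣≤i y) (i≤∣i∣ y))
            (λ x _ x≢y → cong (_* k) (δ-≢ x≢y)))
         (trans (cong (_* k) (δ-≡ refl)) (ℤ.*-identityˡ k)))

hasSum-∑ : (ys : List A) (f : A → ℤ → ℤ) (s : A → ℤ) → (∀ y → HasSum (f y) (s y)) →
           HasSum (λ x → ∑ ys (λ y → f y x)) (∑ ys s)
hasSum-∑ []       f s h = hasSum-0
hasSum-∑ (y ∷ ys) f s h = hasSum-+ (h y) (hasSum-∑ ys f s h)

module _ {f : ℤ → ℤ} {s : ℤ} (h : HasSum f s) (a : ℤ) where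
  private
    M = radius h
    K′ = M ℕ.+ ∣ a ∣
    +K : + K′ ≡ + M + + ∣ a ∣
    +K = ℤ.pos-+ M ∣ a ∣
    ≤a = nonneg (i≤∣i∣ a)
    -a≤ = nonneg (-∣i∣≤i a)

    module _ {x : ℤ} (x< : x < - + K′) where
      lowK : 0ℤ ≤ - (+ M + + ∣ a ∣) - x - 1ℤ
      lowK = subst (λ k → 0ℤ ≤ - k - x - 1ℤ) +K (pos x<)
    module _ {x : ℤ} (<x : + K′ < x) where
      highK : 0ℤ ≤ x - (+ M + + ∣ a ∣) - 1ℤ
      highK = subst (λ k → 0ℤ ≤ x - k - 1ℤ) +K (pos <x)

    in-window : ∀ {x} → 0ℤ ≤ x - - (+ M + + ∣ a ∣) → 0ℤ ≤ + M + + ∣ a ∣ - x → x ∈ window K′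
    in-window {x} l u = ∈-window⁺ (≤-from l (cong (λ k → x - - k) (sym +K))) (≤-from u (cong (_- x) (sym +K)))

  hasSum-shift : HasSum (λ x → f (a + x)) s
  hasSum-shift = hasSum K′
    (λ x p → zero-below h (a + x) (<-from (lowK p ⊕ ≤a) (e₁ a (+ ∣ a ∣) (+ M) x)))
    (λ x p → zero-above h (a + x) (<-from (highK p ⊕ -a≤) (e₂ a (+ ∣ a ∣) (+ M) x)))
    (reindex-window h (_+_ a) (_- a) (e₃ a) (e₄ a) K′ λ x x∈ → let l , u = ∈-window⁻ x∈ in
      in-window (subst (0ℤ ≤_) (e₅ a (+ ∣ a ∣) (+ M) x) (nonneg l ⊕ ≤a))
                (subst (0ℤ ≤_) (e₆ a (+ ∣ a ∣) (+ M) x) (nonneg u ⊕ -a≤)))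
    where
    e₁ : ∀ a d m x → (- (m + d) - x - 1ℤ) + (d - a) ≡ - m - (a + x) - 1ℤ
    e₁ = solve-∀
    e₂ : ∀ a d m x → (x - (m + d) - 1ℤ) + (a - - d) ≡ a + x - m - 1ℤ
    e₂ = solve-∀
    e₃ : ∀ a x → a + (x - a) ≡ x
    e₃ = solve-∀
    e₄ : ∀ a x → a + x - a ≡ x
    e₄ = solve-∀
    e₅ : ∀ a d m x → (x - - m) + (d - a) ≡ x - a - - (m + d)
    e₅ = solve-∀
    e₆ : ∀ a d m x → (m - x) + (a - - d) ≡ m + d - (x - a)
    e₆ = solve-∀

  hasSum-reflect : HasSum (λ x → f (a - x)) s
  hasSum-reflect = hasSum K′
    (λ x p → zero-above h (a - x) (<-from (lowK p ⊕ -a≤) (e₁ a (+ ∣ a ∣) (+ M) x)))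
    (λ x p → zero-below h (a - x) (<-from (highK p ⊕ ≤a) (e₂ a (+ ∣ a ∣) (+ M) x)))
    (reindex-window h (_-_ a) (_-_ a) (e₃ a) (e₃ a) K′ λ x x∈ → let l , u = ∈-window⁻ x∈ in
      in-window (subst (0ℤ ≤_) (e₅ a (+ ∣ a ∣) (+ M) x) (nonneg u ⊕ -a≤))
                (subst (0ℤ ≤_) (e₆ a (+ ∣ a ∣) (+ M) x) (nonneg l ⊕ ≤a)))
    where
    e₁ : ∀ a d m x → (- (m + d) - x - 1ℤ) + (a - - d) ≡ a - x - m - 1ℤ
    e₁ = solve-∀
    e₂ : ∀ a d m x → (x - (m + d) - 1ℤ) + (d - a) ≡ - m - (a - x) - 1ℤ
    e₂ = solve-∀
    e₃ : ∀ a x → a - (a - x) ≡ x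
    e₃ = solve-∀
    e₅ : ∀ a d m x → (m - x) + (a - - d) ≡ a - x - - (m + d)
    e₅ = solve-∀
    e₆ : ∀ a d m x → (x - - m) + (d - a) ≡ m + d - (a - x)
    e₆ = solve-∀

-- Introduces a number by its summand: the first projection names the sum, the second lets it enter
-- later identities.
finite-support : ∀ f M → (∀ x → x < - + M → f x ≡ 0ℤ) → (∀ x → + M < x → f x ≡ 0ℤ) → ∃ (HasSum f)
finite-support f M l u = _ , hasSum M l u refl

-- The step function `θ`.

abstract
  θ : ℤ → ℤ
  θ z = I (0ℤ ℤ.≤? z)

  θ-yes : ∀ {z} → 0ℤ ≤ z → θ z ≡ 1ℤ
  θ-yes {z} = I-yes (0ℤ ℤ.≤? z)

  θ-no : ∀ {z} → 0ℤ ≤ - z - 1ℤ → θ z ≡ 0ℤ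
  θ-no {z} p = I-no (0ℤ ℤ.≤? z) (λ q → absurd (p ⊕ q) (e z))
    where e : ∀ z → - z - 1ℤ + z ≡ -1ℤ
          e = solve-∀

θ-neg : ∀ z → θ (- z) ≡ 1ℤ + δ z 0ℤ - θ z
θ-neg z with ℤ.<-cmp z 0ℤ
... | tri< z<0 _ _ = trans (θ-yes (subst (0ℤ ≤_) (e z) (pos z<0 ⊕ +≤+ ℕ.z≤n)))
    (sym (cong₂ (λ a b → 1ℤ + a - b) (δ-≢ (ℤ.<⇒≢ z<0)) (θ-no (subst (0ℤ ≤_) (e′ z) (pos z<0)))))
  where e : ∀ z → 0ℤ - z - 1ℤ + 1ℤ ≡ - z
        e = solve-∀
        e′ : ∀ z → 0ℤ - z - 1ℤ ≡ - z - 1ℤ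
        e′ = solve-∀
... | tri≈ _ refl _ = trans (θ-yes (+≤+ ℕ.z≤n)) (sym (cong₂ (λ a b → 1ℤ + a - b) (δ-≡ refl) (θ-yes (+≤+ ℕ.z≤n))))
... | tri> _ _ z>0 = trans (θ-no (subst (0ℤ ≤_) (e z) (pos z>0)))
    (sym (cong₂ (λ a b → 1ℤ + a - b) (δ-≢ (ℤ.<⇒≢ z>0 ∘ sym)) (θ-yes (ℤ.<⇒≤ z>0))))
  where e : ∀ z → z - 0ℤ - 1ℤ ≡ - - z - 1ℤ
        e = solve-∀

private
  0*x*y : ∀ {x} → x ≡ 0ℤ → ∀ y → x * y ≡ 0ℤ
  0*x*y refl y = refl

  x*0 : ∀ x {y} → y ≡ 0ℤ → x * y ≡ 0ℤ
  x*0 x refl = ℤ.*-zeroʳ x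

-- Hook counts in an antisymmetric bead configuration.

module _ (m : ℤ) where
  -- For m > 0 the sum of these terms is the number of nonzero x with -m < 2x < m: the terms at 2x = ±m cancel.
  errTerm : ℤ → ℤ
  errTerm x = (1ℤ - δ x 0ℤ) * (θ (x + x + m) - θ (x + x - m) - δ (x + x) m)

  private
    ∣m∣ = + ∣ m ∣
    m≤ = nonneg (i≤∣i∣ m)
    -m≤ = nonneg (-∣i∣≤i m)

    err-low : ∀ x → x < - ∣m∣ → errTerm x ≡ 0ℤ
    err-low x p = x*0 (1ℤ - δ x 0ℤ) (cong₂ _-_ (cong₂ _-_
        (θ-no (subst (0ℤ ≤_) (e₁ x m ∣m∣) (pos p ⊕ pos p ⊕ m≤ ⊕ +≤+ ℕ.z≤n ⊕ +≤+ ℕ.z≤n)))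
        (θ-no (subst (0ℤ ≤_) (e₂ x m ∣m∣) (pos p ⊕ pos p ⊕ -m≤ ⊕ +≤+ ℕ.z≤n ⊕ +≤+ ℕ.z≤n))))
        (δ-neg (pos p ⊕ pos p ⊕ -m≤ ⊕ +≤+ ℕ.z≤n ⊕ +≤+ ℕ.z≤n) (e₃ x m ∣m∣)))
      where
      e₁ : ∀ x m a → (- a - x - 1ℤ) + (- a - x - 1ℤ) + (a - m) + a + 1ℤ ≡ - (x + x + m) - 1ℤ
      e₁ = solve-∀
      e₂ : ∀ x m a → (- a - x - 1ℤ) + (- a - x - 1ℤ) + (m - - a) + a + 1ℤ ≡ - (x + x - m) - 1ℤ
      e₂ = solve-∀
      e₃ : ∀ x m a → (- a - x - 1ℤ) + (- a - x - 1ℤ) + (m - - a) + a + 1ℤ ≡ m - (x + x) - 1ℤ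
      e₃ = solve-∀

    err-high : ∀ x → ∣m∣ < x → errTerm x ≡ 0ℤ
    err-high x p = x*0 (1ℤ - δ x 0ℤ) (cong₂ _-_ (cong₂ _-_
        (θ-yes (subst (0ℤ ≤_) (e₁ x m ∣m∣) (pos p ⊕ pos p ⊕ -m≤ ⊕ +≤+ ℕ.z≤n ⊕ +≤+ ℕ.z≤n)))
        (θ-yes (subst (0ℤ ≤_) (e₂ x m ∣m∣) (pos p ⊕ pos p ⊕ m≤ ⊕ +≤+ ℕ.z≤n ⊕ +≤+ ℕ.z≤n))))
        (δ-pos (pos p ⊕ pos p ⊕ m≤ ⊕ +≤+ ℕ.z≤n ⊕ +≤+ ℕ.z≤n) (e₃ x m ∣m∣)))
      where
      e₁ : ∀ x m a → (x - a - 1ℤ) + (x - a - 1ℤ) + (m - - a) + a + + 2 ≡ x + x + m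
      e₁ = solve-∀
      e₂ : ∀ x m a → (x - a - 1ℤ) + (x - a - 1ℤ) + (a - m) + a + + 2 ≡ x + x - m
      e₂ = solve-∀
      e₃ : ∀ x m a → (x - a - 1ℤ) + (x - a - 1ℤ) + (a - m) + a + 1ℤ ≡ x + x - m - 1ℤ
      e₃ = solve-∀

  errSum : ∃ (HasSum errTerm)
  errSum = finite-support errTerm ∣ m ∣ err-low err-high

-- The bead configuration c of a doubled distinct partition: c x = 1 if x = λⱼ - j for some j, and 0 otherwise.
record Beads (c : ℤ → ℤ) : Set where
  field
    extent : ℕ
    below  : ∀ x → x < - + extent → c x ≡ 1ℤ
    above  : ∀ x → + extent < x → c x ≡ 0ℤ
    idem   : ∀ x → c x * c x ≡ c x
    symm   : ∀ x → c x + c (- x) ≡ 1ℤ - δ x 0ℤ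

module _ {c : ℤ → ℤ} (C : Beads c) where
  open Beads C
  private
    L = + extent

  -- By antisymmetry an unoccupied position mirrors a bead. The position 0 is the exception: it is
  -- unoccupied and its own mirror image, whence the δ.
  gap : ∀ m x → 1ℤ - c (x - m) ≡ c (m - x) + δ x m
  gap m x = begin
    1ℤ - c (x - m)
      ≡⟨ e₁ (c (x - m)) (δ (x - m) 0ℤ) ⟩
    (1ℤ - δ (x - m) 0ℤ) - c (x - m) + δ (x - m) 0ℤ
      ≡⟨ cong (λ k → k - c (x - m) + δ (x - m) 0ℤ) (sym (symm (x - m))) ⟩
    c (x - m) + c (- (x - m)) - c (x - m) + δ (x - m) 0ℤ
      ≡⟨ e₂ (c (x - m)) (c (- (x - m))) (δ (x - m) 0ℤ) ⟩
    c (- (x - m)) + δ (x - m) 0ℤ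
      ≡⟨ cong₂ _+_ (cong c (e₃ x m)) (δ-shift (x - m) 0ℤ x m (e₄ x m)) ⟩
    c (m - x) + δ x m ∎
    where
    open ≡-Reasoning
    e₁ : ∀ a d → 1ℤ - a ≡ (1ℤ - d) - a + d
    e₁ = solve-∀
    e₂ : ∀ a b d → a + b - a + d ≡ b + d
    e₂ = solve-∀
    e₃ : ∀ x m → - (x - m) ≡ m - x
    e₃ = solve-∀
    e₄ : ∀ x m → x - m - 0ℤ ≡ x - m
    e₄ = solve-∀

  hookTerm : ℤ → ℤ → ℤ
  hookTerm m x = c x * (1ℤ - c (x - m))

  -- The argument x + x - m of `θ` is x + y for the hole y = x - m, or x - z for the partner z = m -
  -- x, so its sign separates the two values of ε.
  plusTerm minusTerm pairTerm halfTerm upperTerm : ℤ → ℤ → ℤ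
  plusTerm  m x = hookTerm m x * θ (x + x - m)
  minusTerm m x = hookTerm m x * (1ℤ - θ (x + x - m))
  pairTerm  m x = c x * c (m - x)
  halfTerm  m x = δ (x + x) m * c x
  upperTerm m x = c x * θ (x + x - m)

  module _ (m : ℤ) where
    private
      M = extent ℕ.+ ∣ m ∣
      ∣m∣ = + ∣ m ∣
      m≤ = nonneg (i≤∣i∣ m)
      -m≤ = nonneg (-∣i∣≤i m)
      L≥0 : 0ℤ ≤ L
      L≥0 = +≤+ ℕ.z≤n
      ∣m∣≥0 : 0ℤ ≤ ∣m∣
      ∣m∣≥0 = +≤+ ℕ.z≤n
      1≥0 : 0ℤ ≤ 1ℤ
      1≥0 = +≤+ ℕ.z≤n

      c-high : ∀ x → + M < x → c x ≡ 0ℤ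
      c-high x p = above x (ℤ.≤-<-trans (+≤+ (ℕ.m≤m+n extent ∣ m ∣)) p)

      neg : ∀ x → x < - + M → 0ℤ ≤ - (L + ∣m∣) - x - 1ℤ
      neg x p = subst (λ k → 0ℤ ≤ - k - x - 1ℤ) (ℤ.pos-+ extent ∣ m ∣) (pos p)

      θ-low : ∀ x → x < - + M → θ (x + x - m) ≡ 0ℤ
      θ-low x p = θ-no (subst (0ℤ ≤_) (e x m ∣m∣ L) (neg x p ⊕ neg x p ⊕ -m≤ ⊕ L≥0 ⊕ L≥0 ⊕ ∣m∣≥0 ⊕ 1≥0))
        where e : ∀ x m a l → (- (l + a) - x - 1ℤ) + (- (l + a) - x - 1ℤ) + (m - - a) + l + l + a + 1ℤ ≡ - (x + x - m) - 1ℤ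
              e = solve-∀

      δ-low : ∀ x → x < - + M → δ (x + x) m ≡ 0ℤ
      δ-low x p = δ-neg (neg x p ⊕ neg x p ⊕ -m≤ ⊕ L≥0 ⊕ L≥0 ⊕ ∣m∣≥0 ⊕ 1≥0) (e x m ∣m∣ L)
        where e : ∀ x m a l → (- (l + a) - x - 1ℤ) + (- (l + a) - x - 1ℤ) + (m - - a) + l + l + a + 1ℤ ≡ m - (x + x) - 1ℤ
              e = solve-∀

      hook-low : ∀ x → x < - + M → hookTerm m x ≡ 0ℤ
      hook-low x p = x*0 (c x) (cong (_-_ 1ℤ) (below (x - m) (<-from (neg x p ⊕ -m≤) (e x m ∣m∣ L))))
        where e : ∀ x m a l → (- (l + a) - x - 1ℤ) + (m - - a) ≡ - l - (x - m) - 1ℤ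
              e = solve-∀

      pair-low : ∀ x → x < - + M → c (m - x) ≡ 0ℤ
      pair-low x p = above (m - x) (<-from (neg x p ⊕ -m≤) (e x m ∣m∣ L))
        where e : ∀ x m a l → (- (l + a) - x - 1ℤ) + (m - - a) ≡ m - x - l - 1ℤ
              e = solve-∀

    plusSum : ∃ (HasSum (plusTerm m))
    plusSum = finite-support _ M (λ x p → 0*x*y (hook-low x p) _)
      (λ x p → 0*x*y (0*x*y (c-high x p) _) _)

    minusSum : ∃ (HasSum (minusTerm m))
    minusSum = finite-support _ M (λ x p → 0*x*y (hook-low x p) _)
      (λ x p → 0*x*y (0*x*y (c-high x p) _) _)

    pairSum : ∃ (HasSum (pairTerm m))
    pairSum = finite-support _ M (λ x p → x*0 (c x) (pair-low x p)) (λ x p → 0*x*y (c-high x p) _)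

    halfSum : ∃ (HasSum (halfTerm m))
    halfSum = finite-support _ M (λ x p → 0*x*y (δ-low x p) _) (λ x p → x*0 (δ (x + x) m) (c-high x p))

    upperSum : ∃ (HasSum (upperTerm m))
    upperSum = finite-support _ M (λ x p → x*0 (c x) (θ-low x p)) (λ x p → 0*x*y (c-high x p) _)

  -- For m > 0, A⁺ m and A⁻ m count the boxes with hook length m and ε = 1, -1; Q m counts the pairs of beads
  -- with sum m, and H m the diagonal pairs among them.
  A⁺ A⁻ Q H U : ℤ → ℤ
  A⁺ = proj₁ ∘ plusSum
  A⁻ = proj₁ ∘ minusSum
  Q  = proj₁ ∘ pairSum
  H  = proj₁ ∘ halfSum
  U  = proj₁ ∘ upperSum

  -- Adding the two sides of the diagonal removes `θ`; by `gap` a hook is then a pair of beads, or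
  -- the bead m together with z = 0, which accounts for `c m`.
  A⁺+A⁻ : ∀ m → A⁺ m + A⁻ m ≡ Q m + c m
  A⁺+A⁻ m = unique
    (hasSum-+ (proj₂ (plusSum m)) (proj₂ (minusSum m)))
    (hasSum-ext eq (hasSum-+ (proj₂ (pairSum m)) (hasSum-δ m (c m))))
    where
    open ≡-Reasoning
    e₁ : ∀ h t → h ≡ h * t + h * (1ℤ - t)
    e₁ = solve-∀
    e₂ : ∀ a b d → a * b + d * a ≡ a * (b + d)
    e₂ = solve-∀
    eq : ∀ x → pairTerm m x + δ x m * c m ≡ plusTerm m x + minusTerm m x
    eq x = begin
      c x * c (m - x) + δ x m * c m    ≡⟨ cong (_+_ (c x * c (m - x))) (sym (δ-subst c x m)) ⟩
      c x * c (m - x) + δ x m * c x    ≡⟨ e₂ (c x) (c (m - x)) (δ x m) ⟩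
      c x * (c (m - x) + δ x m)        ≡⟨ cong (_*_ (c x)) (sym (gap m x)) ⟩
      hookTerm m x                     ≡⟨ e₁ (hookTerm m x) (θ (x + x - m)) ⟩
      plusTerm m x + minusTerm m x     ∎

  -- The pairs x + z = m of beads counted by A⁻ are those counted by A⁺ with x and z exchanged.
  A⁺-A⁻ : ∀ m → A⁺ m - c m * θ m - H m ≡ A⁻ m - c m * (1ℤ - θ m)
  A⁺-A⁻ m = unique
    (hasSum-ext lhs (hasSum-- (hasSum-- (proj₂ (plusSum m)) (hasSum-δ m (c m * θ m))) (proj₂ (halfSum m))))
    (hasSum-ext rhs (hasSum-reflect (hasSum-- (proj₂ (minusSum m)) (hasSum-δ m (c m * (1ℤ - θ m)))) m))
    where
    open ≡-Reasoning
    -- Selects the pairs with x > z = m - x: `θ` admits x ≥ z and the δ removes the diagonal.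
    common : ℤ → ℤ
    common x = c x * c (m - x) * (θ (x + x - m) - δ (x + x) m)
    half : ∀ x → c x * c (m - x) * δ (x + x) m ≡ δ (x + x) m * c x
    half x with x + x ℤ.≟ m
    ... | no ≢m   = trans (x*0 (c x * c (m - x)) (δ-≢ ≢m)) (sym (0*x*y (δ-≢ ≢m) (c x)))
    ... | yes refl = trans (ℤ.*-comm (c x * c (x + x - x)) _)
                          (cong (_*_ (δ (x + x) (x + x))) (trans (cong (λ k → c x * c k) (e x)) (idem x)))
      where e : ∀ x → x + x - x ≡ x
            e = solve-∀
    lhs : ∀ x → plusTerm m x - δ x m * (c m * θ m) - halfTerm m x ≡ common x
    lhs x = begin
      hookTerm m x * θ (x + x - m) - δ x m * (c m * θ m) - halfTerm m x
        ≡⟨ cong₂ (λ p q → c x * p * θ (x + x - m) - q - halfTerm m x) (gap m x) (trans (cong (λ k → δ x m * (c m * θ k)) (e₀ m)) (sym (δ-subst (λ x → c x * θ (x + x - m)) x m))) ⟩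
      c x * (c (m - x) + δ x m) * θ (x + x - m) - δ x m * (c x * θ (x + x - m)) - halfTerm m x
        ≡⟨ e₁ (c x) (c (m - x)) (δ x m) (θ (x + x - m)) (halfTerm m x) ⟩
      c x * c (m - x) * θ (x + x - m) - halfTerm m x
        ≡⟨ cong (λ k → c x * c (m - x) * θ (x + x - m) - k) (sym (half x)) ⟩
      c x * c (m - x) * θ (x + x - m) - c x * c (m - x) * δ (x + x) m
        ≡⟨ e₂ (c x * c (m - x)) (θ (x + x - m)) (δ (x + x) m) ⟩
      common x ∎
      where
      e₀ : ∀ m → m ≡ m + m - m
      e₀ = solve-∀
      e₁ : ∀ a b d t h → a * (b + d) * t - d * (a * t) - h ≡ a * b * t - h
      e₁ = solve-∀
      e₂ : ∀ a b d → a * b - a * d ≡ a * (b - d)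
      e₂ = solve-∀
    unreflected : ∀ x → minusTerm m x - δ x m * (c m * (1ℤ - θ m)) ≡ c x * c (m - x) * (1ℤ - θ (x + x - m))
    unreflected x = begin
      hookTerm m x * (1ℤ - θ (x + x - m)) - δ x m * (c m * (1ℤ - θ m))
        ≡⟨ cong₂ (λ p q → c x * p * (1ℤ - θ (x + x - m)) - q) (gap m x) (trans (cong (λ k → δ x m * (c m * (1ℤ - θ k))) (e₀ m)) (sym (δ-subst (λ x → c x * (1ℤ - θ (x + x - m))) x m))) ⟩
      c x * (c (m - x) + δ x m) * (1ℤ - θ (x + x - m)) - δ x m * (c x * (1ℤ - θ (x + x - m)))
        ≡⟨ e₁ (c x) (c (m - x)) (δ x m) (1ℤ - θ (x + x - m)) ⟩
      c x * c (m - x) * (1ℤ - θ (x + x - m)) ∎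
      where
      e₀ : ∀ m → m ≡ m + m - m
      e₀ = solve-∀
      e₁ : ∀ a b d t → a * (b + d) * t - d * (a * t) ≡ a * b * t
      e₁ = solve-∀
    rhs : ∀ x → minusTerm m (m - x) - δ (m - x) m * (c m * (1ℤ - θ m)) ≡ common x
    rhs x = begin
      minusTerm m (m - x) - δ (m - x) m * (c m * (1ℤ - θ m))
        ≡⟨ unreflected (m - x) ⟩
      c (m - x) * c (m - (m - x)) * (1ℤ - θ ((m - x) + (m - x) - m))
        ≡⟨ cong₂ (λ p q → c (m - x) * c p * (1ℤ - θ q)) (e₁ m x) (e₂ m x) ⟩
      c (m - x) * c x * (1ℤ - θ (- (x + x - m)))
        ≡⟨ cong (λ p → c (m - x) * c x * (1ℤ - p)) (trans (θ-neg (x + x - m)) (cong (λ d → 1ℤ + d - θ (x + x - m)) (δ-shift (x + x - m) 0ℤ (x + x) m (e₃ m x)))) ⟩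
      c (m - x) * c x * (1ℤ - (1ℤ + δ (x + x) m - θ (x + x - m)))
        ≡⟨ e₄ (c (m - x)) (c x) (δ (x + x) m) (θ (x + x - m)) ⟩
      common x ∎
      where
      e₁ : ∀ m x → m - (m - x) ≡ x
      e₁ = solve-∀
      e₂ : ∀ m x → (m - x) + (m - x) - m ≡ - (x + x - m)
      e₂ = solve-∀
      e₃ : ∀ m x → x + x - m - 0ℤ ≡ x + x - m
      e₃ = solve-∀
      e₄ : ∀ a b d t → a * b * (1ℤ - (1ℤ + d - t)) ≡ b * a * (t - d)
      e₄ = solve-∀

  -- The sum and the difference of `A⁺` and `A⁻` are known, so each is determined after doubling; no
  -- division by 2 is needed.
  2A⁺ : ∀ m → + 2 * A⁺ m ≡ Q m + H m + + 2 * (c m * θ m)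
  2A⁺ m = begin
    + 2 * A⁺ m
      ≡⟨ e₁ (A⁺ m) (A⁻ m) (c m) (θ m) (H m) ⟩
    (A⁺ m + A⁻ m) + (A⁺ m - c m * θ m - H m) - (A⁻ m - c m * (1ℤ - θ m)) + H m + + 2 * (c m * θ m) - c m
      ≡⟨ cong₂ (λ p q → p + q - (A⁻ m - c m * (1ℤ - θ m)) + H m + + 2 * (c m * θ m) - c m) (A⁺+A⁻ m) (A⁺-A⁻ m) ⟩
    (Q m + c m) + (A⁻ m - c m * (1ℤ - θ m)) - (A⁻ m - c m * (1ℤ - θ m)) + H m + + 2 * (c m * θ m) - c m
      ≡⟨ e₂ (Q m) (A⁻ m) (c m) (θ m) (H m) ⟩
    Q m + H m + + 2 * (c m * θ m) ∎
    where
    open ≡-Reasoning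
    e₁ : ∀ p q c t h → + 2 * p ≡ (p + q) + (p - c * t - h) - (q - c * (1ℤ - t)) + h + + 2 * (c * t) - c
    e₁ = solve-∀
    e₂ : ∀ p q c t h → (p + c) + (q - c * (1ℤ - t)) - (q - c * (1ℤ - t)) + h + + 2 * (c * t) - c ≡ p + h + + 2 * (c * t)
    e₂ = solve-∀

  2A⁻ : ∀ m → + 2 * A⁻ m ≡ Q m - H m + + 2 * (c m * (1ℤ - θ m))
  2A⁻ m = begin
    + 2 * A⁻ m
      ≡⟨ e₁ (A⁺ m) (A⁻ m) ⟩
    + 2 * (A⁺ m + A⁻ m) - + 2 * A⁺ m
      ≡⟨ cong₂ (λ p q → + 2 * p - q) (A⁺+A⁻ m) (2A⁺ m) ⟩
    + 2 * (Q m + c m) - (Q m + H m + + 2 * (c m * θ m))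
      ≡⟨ e₂ (Q m) (c m) (θ m) (H m) ⟩
    Q m - H m + + 2 * (c m * (1ℤ - θ m)) ∎
    where
    open ≡-Reasoning
    e₁ : ∀ p q → + 2 * q ≡ + 2 * (p + q) - + 2 * p
    e₁ = solve-∀
    e₂ : ∀ p c t h → + 2 * (p + c) - (p + h + + 2 * (c * t)) ≡ p - h + + 2 * (c * (1ℤ - t))
    e₂ = solve-∀

  -- A shift by m aligns both summands on the same `θ`; the products c x * c (x - m) then cancel,
  -- and a difference of quadratic counts becomes linear in c.
  A⁺-reflect : ∀ m → A⁺ m - A⁺ (- m) ≡ U m - U (- m)
  A⁺-reflect m = unique
    (hasSum-ext eq (hasSum-- (proj₂ (plusSum m)) (hasSum-shift (proj₂ (plusSum (- m))) (- m))))
    (hasSum-- (proj₂ (upperSum m)) (hasSum-shift (proj₂ (upperSum (- m))) (- m)))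
    where
    open ≡-Reasoning
    e₁ : ∀ m x → - m + x - - m ≡ x
    e₁ = solve-∀
    e₂ : ∀ m x → (- m + x) + (- m + x) - - m ≡ x + x - m
    e₂ = solve-∀
    e₃ : ∀ m x → x - m ≡ - m + x
    e₃ = solve-∀
    e₄ : ∀ a b t → a * (1ℤ - b) * t - b * (1ℤ - a) * t ≡ a * t - b * t
    e₄ = solve-∀
    eq : ∀ x → plusTerm m x - plusTerm (- m) (- m + x) ≡ upperTerm m x - upperTerm (- m) (- m + x)
    eq x = begin
      c x * (1ℤ - c (x - m)) * θ (x + x - m) - c (- m + x) * (1ℤ - c (- m + x - - m)) * θ ((- m + x) + (- m + x) - - m)
        ≡⟨ cong₂ (λ p q → c x * (1ℤ - c p) * θ (x + x - m) - c (- m + x) * (1ℤ - c q) * θ ((- m + x) + (- m + x) - - m)) (e₃ m x) (e₁ m x) ⟩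
      c x * (1ℤ - c (- m + x)) * θ (x + x - m) - c (- m + x) * (1ℤ - c x) * θ ((- m + x) + (- m + x) - - m)
        ≡⟨ cong (λ p → c x * (1ℤ - c (- m + x)) * θ (x + x - m) - c (- m + x) * (1ℤ - c x) * θ p) (e₂ m x) ⟩
      c x * (1ℤ - c (- m + x)) * θ (x + x - m) - c (- m + x) * (1ℤ - c x) * θ (x + x - m)
        ≡⟨ e₄ (c x) (c (- m + x)) (θ (x + x - m)) ⟩
      c x * θ (x + x - m) - c (- m + x) * θ (x + x - m)
        ≡⟨ cong (λ p → c x * θ (x + x - m) - c (- m + x) * θ p) (sym (e₂ m x)) ⟩
      upperTerm m x - upperTerm (- m) (- m + x) ∎

  -- Averaging over x and -x brings in c x + c (- x), which does not depend on the configuration.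
  -- Only the ties 2x = -m keep a trace of c, collected in `H (- m)`.
  2U : ∀ m → + 2 * (U m - U (- m)) ≡ - (H (- m) + H (- m)) - proj₁ (errSum m)
  2U m = begin
    + 2 * (U m - U (- m))
      ≡⟨ e₁ (U m) (U (- m)) (H m) (H (- m)) ⟩
    ((U m - U (- m)) + (U m - U (- m)) + (H (- m) - H m) + (H m + H (- m))) - (H (- m) + H (- m))
      ≡⟨ cong (_- (H (- m) + H (- m))) total ⟩
    (0ℤ - proj₁ (errSum m)) - (H (- m) + H (- m))
      ≡⟨ e₂ (proj₁ (errSum m)) (H (- m)) ⟩
    - (H (- m) + H (- m)) - proj₁ (errSum m) ∎
    where
    open ≡-Reasoning
    e₁ : ∀ u v h k → + 2 * (u - v) ≡ ((u - v) + (u - v) + (k - h) + (h + k)) - (k + k)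
    e₁ = solve-∀
    e₂ : ∀ e k → (0ℤ - e) - (k + k) ≡ - (k + k) - e
    e₂ = solve-∀
    U-U : HasSum (λ x → upperTerm m x - upperTerm (- m) x) (U m - U (- m))
    U-U = hasSum-- (proj₂ (upperSum m)) (proj₂ (upperSum (- m)))
    -- Reflecting `θ` creates extra terms at the ties 2x = m and 2x = -m, which `H-H` removes. `H+H`
    -- then cancels `H m` and leaves a summand with the factor c x + c (- x).
    H-H : HasSum (λ x → halfTerm (- m) (0ℤ - x) - halfTerm m (0ℤ - x)) (H (- m) - H m)
    H-H = hasSum-reflect (hasSum-- (proj₂ (halfSum (- m))) (proj₂ (halfSum m))) 0ℤ
    H+H : HasSum (λ x → halfTerm m x + halfTerm (- m) (0ℤ - x)) (H m + H (- m))
    H+H = hasSum-+ (proj₂ (halfSum m)) (hasSum-reflect (proj₂ (halfSum (- m))) 0ℤ)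
    ring₁ : ∀ a b p p′ d d′ → (a * p - a * p′) + (b * (1ℤ + d′ - p′) - b * (1ℤ + d - p)) + (d * b - d′ * b) + (d * a + d * b)
              ≡ (a + b) * (p - p′ + d)
    ring₁ = solve-∀
    ring₂ : ∀ s p p′ d → (1ℤ - s) * (p - p′ + d) ≡ 0ℤ - (1ℤ - s) * (p′ - p - d)
    ring₂ = solve-∀
    a₁ : ∀ m x → (0ℤ - x) + (0ℤ - x) - m ≡ - (x + x + m)
    a₁ = solve-∀
    a₂ : ∀ m x → (0ℤ - x) + (0ℤ - x) - - m ≡ - (x + x - m)
    a₂ = solve-∀
    a₃ : ∀ m x → x + x - - m ≡ x + x + m
    a₃ = solve-∀
    a₄ : ∀ x → 0ℤ - x ≡ - x
    a₄ = solve-∀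
    f₁ : ∀ m x → (0ℤ - x) + (0ℤ - x) - - m ≡ m - (x + x)
    f₁ = solve-∀
    f₂ : ∀ m x → (0ℤ - x) + (0ℤ - x) - m ≡ - m - (x + x)
    f₂ = solve-∀
    f₃ : ∀ m x → x + x + m - 0ℤ ≡ x + x - - m
    f₃ = solve-∀
    f₄ : ∀ m x → x + x - m - 0ℤ ≡ x + x - m
    f₄ = solve-∀
    reflect⁺ : ∀ x → θ ((0ℤ - x) + (0ℤ - x) - m) ≡ 1ℤ + δ (x + x) (- m) - θ (x + x + m)
    reflect⁺ x = trans (cong θ (a₁ m x)) (trans (θ-neg (x + x + m))
      (cong (λ d → 1ℤ + d - θ (x + x + m)) (δ-shift (x + x + m) 0ℤ (x + x) (- m) (f₃ m x))))
    reflect⁻ : ∀ x → θ ((0ℤ - x) + (0ℤ - x) - - m) ≡ 1ℤ + δ (x + x) m - θ (x + x - m)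
    reflect⁻ x = trans (cong θ (a₂ m x)) (trans (θ-neg (x + x - m))
      (cong (λ d → 1ℤ + d - θ (x + x - m)) (δ-shift (x + x - m) 0ℤ (x + x) m (f₄ m x))))
    diff : ∀ x → upperTerm m x - upperTerm (- m) x ≡ c x * θ (x + x - m) - c x * θ (x + x + m)
    diff x = cong (λ z → c x * θ (x + x - m) - c x * θ z) (a₃ m x)
    diff′ : ∀ x → upperTerm m (0ℤ - x) - upperTerm (- m) (0ℤ - x)
          ≡ c (0ℤ - x) * (1ℤ + δ (x + x) (- m) - θ (x + x + m)) - c (0ℤ - x) * (1ℤ + δ (x + x) m - θ (x + x - m))
    diff′ x = cong₂ (λ p q → c (0ℤ - x) * p - c (0ℤ - x) * q) (reflect⁺ x) (reflect⁻ x)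
    half⁻ : ∀ x → halfTerm (- m) (0ℤ - x) ≡ δ (x + x) m * c (0ℤ - x)
    half⁻ x = cong (_* c (0ℤ - x)) (δ-flip ((0ℤ - x) + (0ℤ - x)) (- m) (x + x) m (f₁ m x))
    half⁺ : ∀ x → halfTerm m (0ℤ - x) ≡ δ (x + x) (- m) * c (0ℤ - x)
    half⁺ x = cong (_* c (0ℤ - x)) (δ-flip ((0ℤ - x) + (0ℤ - x)) m (x + x) (- m) (f₂ m x))
    pointwise : ∀ x → (upperTerm m x - upperTerm (- m) x) + (upperTerm m (0ℤ - x) - upperTerm (- m) (0ℤ - x))
              + (halfTerm (- m) (0ℤ - x) - halfTerm m (0ℤ - x)) + (halfTerm m x + halfTerm (- m) (0ℤ - x))
              ≡ 0ℤ - errTerm m x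
    pointwise x = begin
      _ ≡⟨ cong₂ _+_ (cong₂ _+_ (cong₂ _+_ (diff x) (diff′ x)) (cong₂ _-_ (half⁻ x) (half⁺ x)))
                     (cong (_+_ (halfTerm m x)) (half⁻ x)) ⟩
      _ ≡⟨ ring₁ (c x) (c (0ℤ - x)) (θ (x + x - m)) (θ (x + x + m)) (δ (x + x) m) (δ (x + x) (- m)) ⟩
      (c x + c (0ℤ - x)) * (θ (x + x - m) - θ (x + x + m) + δ (x + x) m)
        ≡⟨ cong (_* (θ (x + x - m) - θ (x + x + m) + δ (x + x) m)) (trans (cong (λ z → c x + c z) (a₄ x)) (symm x)) ⟩
      (1ℤ - δ x 0ℤ) * (θ (x + x - m) - θ (x + x + m) + δ (x + x) m)
        ≡⟨ ring₂ (δ x 0ℤ) (θ (x + x - m)) (θ (x + x + m)) (δ (x + x) m) ⟩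
      0ℤ - errTerm m x ∎
    total : (U m - U (- m)) + (U m - U (- m)) + (H (- m) - H m) + (H m + H (- m)) ≡ 0ℤ - proj₁ (errSum m)
    total = unique
      (hasSum-ext pointwise (hasSum-+ (hasSum-+ (hasSum-+ U-U (hasSum-reflect U-U 0ℤ)) H-H) H+H))
      (hasSum-- hasSum-0 (proj₂ (errSum m)))

  -- Passing to -m gives `A⁺ m` the shape that `2A⁻` has at the argument -m, namely Q - H plus a
  -- correction. This is why `A⁺ (g - n)` can stand in for `A⁻ (n - g)`.
  2A⁺-positive : ∀ m → 0ℤ < m → + 2 * A⁺ m ≡ Q (- m) - H (- m) - proj₁ (errSum m)
  2A⁺-positive m m>0 = begin
    + 2 * A⁺ m
      ≡⟨ e₁ (A⁺ m) (A⁺ (- m)) ⟩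
    + 2 * A⁺ (- m) + + 2 * (A⁺ m - A⁺ (- m))
      ≡⟨ cong₂ _+_ (2A⁺ (- m)) (trans (cong (_*_ (+ 2)) (A⁺-reflect m)) (2U m)) ⟩
    Q (- m) + H (- m) + + 2 * (c (- m) * θ (- m)) + (- (H (- m) + H (- m)) - proj₁ (errSum m))
      ≡⟨ cong (λ z → Q (- m) + H (- m) + + 2 * (c (- m) * z) + (- (H (- m) + H (- m)) - proj₁ (errSum m))) (θ-no (subst (0ℤ ≤_) (e₂ m) (pos m>0))) ⟩
    Q (- m) + H (- m) + + 2 * (c (- m) * 0ℤ) + (- (H (- m) + H (- m)) - proj₁ (errSum m))
      ≡⟨ e₃ (Q (- m)) (H (- m)) (c (- m)) (proj₁ (errSum m)) ⟩
    Q (- m) - H (- m) - proj₁ (errSum m) ∎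
    where
    open ≡-Reasoning
    e₁ : ∀ p q → + 2 * p ≡ + 2 * q + + 2 * (p - q)
    e₁ = solve-∀
    e₂ : ∀ m → m - 0ℤ - 1ℤ ≡ - - m - 1ℤ
    e₂ = solve-∀
    e₃ : ∀ q h c e → q + h + + 2 * (c * 0ℤ) + (- (h + h) - e) ≡ q - h - e
    e₃ = solve-∀

-- Sums over indices and pairs of indices, and the first gaps.

∑ᶠ : ∀ {t} → (Fin t → ℤ) → ℤ
∑ᶠ {t} = ∑ (allFin t)

∑-upper : ∀ {t} → (Fin t → Fin t → ℤ) → ℤ
∑-upper {t} f = ∑[ i ← allFin t ] ∑ (filter (i Fin.<?_) (allFin t)) (f i)

∑-upper-I : ∀ {t} (f : Fin t → Fin t → ℤ) →
            ∑-upper f ≡ ∑ᶠ λ i → ∑ᶠ λ j → I (i Fin.<? j) * f i j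
∑-upper-I {t} f = ∑-ext (allFin t) (λ i → ∑-filter (i Fin.<?_) (allFin t) (f i))

∑-upper-cong : ∀ {t} {f g : Fin t → Fin t → ℤ} → (∀ i j → i Fin.< j → f i j ≡ g i j) → ∑-upper f ≡ ∑-upper g
∑-upper-cong {t} h = ∑-ext (allFin t) λ i → ∑-cong _ λ j j∈ →
  h i j (proj₂ (∈.∈-filter⁻ (i Fin.<?_) {xs = allFin t} j∈))

∑-square : ∀ {t} (f : Fin t → Fin t → ℤ) →
           (∑ᶠ λ i → ∑ᶠ (f i)) ≡ ∑ᶠ (λ i → f i i) + ∑-upper (λ i j → f i j + f j i)
∑-square {t} f = begin
  (∑ᶠ λ i → ∑ᶠ (f i))
    ≡⟨ ∑-ext F (λ i → trans (∑-ext F (split i)) (trans (∑-+ F (λ j → eq i j + lt i j) (gt i)) (cong (_+ ∑ᶠ (gt i)) (∑-+ F (eq i) (lt i))))) ⟩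
  (∑ᶠ λ i → ∑ᶠ (eq i) + ∑ᶠ (lt i) + ∑ᶠ (gt i))
    ≡⟨ trans (∑-+ F (λ i → ∑ᶠ (eq i) + ∑ᶠ (lt i)) (λ i → ∑ᶠ (gt i))) (cong (_+ ∑ᶠ (λ i → ∑ᶠ (gt i))) (∑-+ F (λ i → ∑ᶠ (eq i)) (λ i → ∑ᶠ (lt i)))) ⟩
  ∑ᶠ (λ i → ∑ᶠ (eq i)) + ∑ᶠ (λ i → ∑ᶠ (lt i)) + ∑ᶠ (λ i → ∑ᶠ (gt i))
    ≡⟨ cong₂ (λ p q → p + ∑ᶠ (λ i → ∑ᶠ (lt i)) + q) (∑-ext F diagonal) (∑-swap F F gt) ⟩
  ∑ᶠ (λ i → f i i) + ∑ᶠ (λ i → ∑ᶠ (lt i)) + ∑ᶠ (λ i → ∑ᶠ (λ j → gt j i))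
    ≡⟨ ℤ.+-assoc (∑ᶠ (λ i → f i i)) _ _ ⟩
  ∑ᶠ (λ i → f i i) + (∑ᶠ (λ i → ∑ᶠ (lt i)) + ∑ᶠ (λ i → ∑ᶠ (λ j → gt j i)))
    ≡⟨ cong (_+_ (∑ᶠ (λ i → f i i))) (sym upper) ⟩
  ∑ᶠ (λ i → f i i) + ∑-upper (λ i j → f i j + f j i) ∎
  where
  open ≡-Reasoning
  F = allFin t
  eq lt gt : Fin t → Fin t → ℤ
  eq i j = I (i Fin.≟ j) * f i j
  lt i j = I (i Fin.<? j) * f i j
  gt i j = I (j Fin.<? i) * f i j
  upper : ∑-upper (λ i j → f i j + f j i) ≡ ∑ᶠ (λ i → ∑ᶠ (lt i)) + ∑ᶠ (λ i → ∑ᶠ (λ j → gt j i))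
  upper = trans (∑-upper-I (λ i j → f i j + f j i)) (trans
    (∑-ext F (λ i → trans (∑-ext F (λ j → ℤ.*-distribˡ-+ (I (i Fin.<? j)) (f i j) (f j i))) (∑-+ F (lt i) (λ j → gt j i))))
    (∑-+ F (λ i → ∑ᶠ (lt i)) (λ i → ∑ᶠ (λ j → gt j i))))
  one : ∀ i j → 1ℤ ≡ I (i Fin.≟ j) + I (i Fin.<? j) + I (j Fin.<? i)
  one i j with Fin.<-cmp i j
  ... | tri< p q r = sym (cong₂ _+_ (cong₂ _+_ (I-no (i Fin.≟ j) q) (I-yes (i Fin.<? j) p)) (I-no (j Fin.<? i) r))
  ... | tri≈ p q r = sym (cong₂ _+_ (cong₂ _+_ (I-yes (i Fin.≟ j) q) (I-no (i Fin.<? j) p)) (I-no (j Fin.<? i) r))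
  ... | tri> p q r = sym (cong₂ _+_ (cong₂ _+_ (I-no (i Fin.≟ j) q) (I-no (i Fin.<? j) p)) (I-yes (j Fin.<? i) r))
  distrib : ∀ a b c k → (a + b + c) * k ≡ a * k + b * k + c * k
  distrib = solve-∀
  split : ∀ i j → f i j ≡ I (i Fin.≟ j) * f i j + I (i Fin.<? j) * f i j + I (j Fin.<? i) * f i j
  split i j = trans (sym (ℤ.*-identityˡ (f i j))) (trans (cong (_* f i j) (one i j)) (distrib (I (i Fin.≟ j)) (I (i Fin.<? j)) (I (j Fin.<? i)) (f i j)))
  diagonal : ∀ i → ∑ᶠ (λ j → I (i Fin.≟ j) * f i j) ≡ f i i
  diagonal i = trans (∑-single (Unique.allFin⁺ t) _ (∈.∈-allFin i)
      (λ j _ j≢i → cong (_* f i j) (I-no (i Fin.≟ j) (j≢i ∘ sym))))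
    (trans (cong (_* f i i) (I-yes (i Fin.≟ i) refl)) (ℤ.*-identityˡ (f i i)))

-- The multiplicity of n among the arguments rᵢ, rᵢ - rⱼ and rᵢ + rⱼ in the numerators of the
-- product formula.
roots : ∀ {t} → (Fin t → ℤ) → ℤ → ℤ
roots r n = ∑ᶠ (λ i → δ (r i) n) + ∑-upper (λ i j → δ (r i - r j) n + δ (r i + r j) n)

-- Indicator function of the first gaps 0, T, T ± rᵢ on the runners of the 2T-abacus.
gaps : ∀ {t} → ℤ → (Fin t → ℤ) → ℤ → ℤ
gaps T r x = δ x 0ℤ + δ x T + ∑ᶠ (λ i → δ x (T + r i) + δ x (T - r i))

hasSum-gaps : ∀ {t} T (r : Fin t → ℤ) (φ : ℤ → ℤ) →
              HasSum (λ x → gaps T r x * φ x) (φ 0ℤ + φ T + ∑ᶠ (λ i → φ (T + r i) + φ (T - r i)))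
hasSum-gaps {t} T r φ = hasSum-ext (λ x → sym (eq x))
  (hasSum-+ (hasSum-+ (hasSum-δ 0ℤ (φ 0ℤ)) (hasSum-δ T (φ T)))
    (hasSum-∑ (allFin t) _ _ (λ i → hasSum-+ (hasSum-δ (T + r i) (φ (T + r i))) (hasSum-δ (T - r i) (φ (T - r i))))))
  where
  open ≡-Reasoning
  distrib : ∀ a b c k → (a + b + c) * k ≡ a * k + b * k + k * c
  distrib = solve-∀
  distrib₂ : ∀ a b k → k * (a + b) ≡ a * k + b * k
  distrib₂ = solve-∀
  eq : ∀ x → gaps T r x * φ x ≡ δ x 0ℤ * φ 0ℤ + δ x T * φ T + ∑ᶠ (λ i → δ x (T + r i) * φ (T + r i) + δ x (T - r i) * φ (T - r i))
  eq x = begin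
    gaps T r x * φ x
      ≡⟨ distrib (δ x 0ℤ) (δ x T) (∑ᶠ (λ i → δ x (T + r i) + δ x (T - r i))) (φ x) ⟩
    δ x 0ℤ * φ x + δ x T * φ x + φ x * ∑ᶠ (λ i → δ x (T + r i) + δ x (T - r i))
      ≡⟨ cong₂ _+_ (cong₂ _+_ (δ-subst φ x 0ℤ) (δ-subst φ x T)) (sym (∑-*ˡ (allFin t) (φ x) (λ i → δ x (T + r i) + δ x (T - r i)))) ⟩
    δ x 0ℤ * φ 0ℤ + δ x T * φ T + ∑ᶠ (λ i → φ x * (δ x (T + r i) + δ x (T - r i)))
      ≡⟨ cong (_+_ (δ x 0ℤ * φ 0ℤ + δ x T * φ T)) (∑-ext (allFin t) λ i →
           trans (distrib₂ (δ x (T + r i)) (δ x (T - r i)) (φ x)) (cong₂ _+_ (δ-subst φ x (T + r i)) (δ-subst φ x (T - r i)))) ⟩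
    δ x 0ℤ * φ 0ℤ + δ x T * φ T + ∑ᶠ (λ i → δ x (T + r i) * φ (T + r i) + δ x (T - r i) * φ (T - r i)) ∎

-- Isolates what the count uses about ω, so that the empty partition becomes an instance directly
-- from its beads, without a partition or a coding being built for it.
record Coded (T : ℤ) {t : ℕ} (r : Fin t → ℤ) (c : ℤ → ℤ) : Set where
  field
    beads        : Beads c
    firstGaps    : ∀ x → c (x - (T + T)) - c x ≡ gaps T r x
    r-positive   : ∀ i → 0ℤ < r i
    r-decreasing : ∀ i j → i Fin.< j → r j < r i

-- The second difference with step g.

module _ {T : ℤ} {t : ℕ} {r : Fin t → ℤ} {c : ℤ → ℤ} (C : Coded T r c) (T>0 : 0ℤ < T) where
  open Coded C
  private
    g = T + T
    b = gaps T r
    F = allFin t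

  -- A product of two first differences expands into four pair terms. In the two that contain c (x -
  -- g) a shift by g restores c x, and the sums become n - g, n, n and n + g.
  ΔQ : ∀ n → HasSum (λ x → b x * b (n + g - x)) (Q beads (n + g) + Q beads (n - g) - + 2 * Q beads n)
  ΔQ n = subst (HasSum _) (e₀ (Q beads (n - g)) (Q beads n) (Q beads (n + g)))
    (hasSum-ext eq (hasSum-+ (hasSum-- (hasSum-- (hasSum-shift (q (n - g)) (- g)) (hasSum-shift (q n) (- g))) (q n)) (q (n + g))))
    where
    open ≡-Reasoning
    q : ∀ m → HasSum (pairTerm beads m) (Q beads m)
    q m = proj₂ (pairSum beads m)
    e₀ : ∀ u v w → u - v - v + w ≡ w + u - + 2 * v
    e₀ = solve-∀
    e₁ : ∀ n g x → n - g - (- g + x) ≡ n - x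
    e₁ = solve-∀
    e₂ : ∀ n g x → n - (- g + x) ≡ n + g - x
    e₂ = solve-∀
    e₃ : ∀ g x → - g + x ≡ x - g
    e₃ = solve-∀
    e₄ : ∀ n g x → n + g - x - g ≡ n - x
    e₄ = solve-∀
    e₅ : ∀ a′ a d d′ → a′ * d - a′ * d′ - a * d + a * d′ ≡ (a′ - a) * (d - d′)
    e₅ = solve-∀
    eq : ∀ x → pairTerm beads (n - g) (- g + x) - pairTerm beads n (- g + x) - pairTerm beads n x + pairTerm beads (n + g) x ≡ b x * b (n + g - x)
    eq x = begin
      c (- g + x) * c (n - g - (- g + x)) - c (- g + x) * c (n - (- g + x)) - c x * c (n - x) + c x * c (n + g - x)
        ≡⟨ cong (λ z → c z * c (n - g - (- g + x)) - c z * c (n - (- g + x)) - c x * c (n - x) + c x * c (n + g - x)) (e₃ g x) ⟩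
      c (x - g) * c (n - g - (- g + x)) - c (x - g) * c (n - (- g + x)) - c x * c (n - x) + c x * c (n + g - x)
        ≡⟨ cong₂ (λ z w → c (x - g) * c z - c (x - g) * c w - c x * c (n - x) + c x * c (n + g - x)) (e₁ n g x) (e₂ n g x) ⟩
      c (x - g) * c (n - x) - c (x - g) * c (n + g - x) - c x * c (n - x) + c x * c (n + g - x)
        ≡⟨ e₅ (c (x - g)) (c x) (c (n - x)) (c (n + g - x)) ⟩
      (c (x - g) - c x) * (c (n - x) - c (n + g - x))
        ≡⟨ cong₂ _*_ (firstGaps x) (trans (cong (λ z → c z - c (n + g - x)) (sym (e₄ n g x))) (firstGaps (n + g - x))) ⟩
      b x * b (n + g - x) ∎

  -- Shifting x by g moves x + x by 2g, so a single first difference already links n - g with n + g.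
  ΔH : ∀ n → HasSum (λ x → b x * δ (x + x) (n + g)) (H beads (n - g) - H beads (n + g))
  ΔH n = hasSum-ext eq (hasSum-- (hasSum-shift (proj₂ (halfSum beads (n - g))) (- g)) (proj₂ (halfSum beads (n + g))))
    where
    open ≡-Reasoning
    e₁ : ∀ n g x → (- g + x) + (- g + x) - (n - g) ≡ x + x - (n + g)
    e₁ = solve-∀
    e₂ : ∀ g x → - g + x ≡ x - g
    e₂ = solve-∀
    e₃ : ∀ d a b → d * a - d * b ≡ (a - b) * d
    e₃ = solve-∀
    eq : ∀ x → halfTerm beads (n - g) (- g + x) - halfTerm beads (n + g) x ≡ b x * δ (x + x) (n + g)
    eq x = begin
      δ ((- g + x) + (- g + x)) (n - g) * c (- g + x) - δ (x + x) (n + g) * c x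
        ≡⟨ cong₂ (λ d z → d * c z - δ (x + x) (n + g) * c x) (δ-shift _ _ _ _ (e₁ n g x)) (e₂ g x) ⟩
      δ (x + x) (n + g) * c (x - g) - δ (x + x) (n + g) * c x
        ≡⟨ e₃ (δ (x + x) (n + g)) (c (x - g)) (c x) ⟩
      (c (x - g) - c x) * δ (x + x) (n + g)
        ≡⟨ cong (_* δ (x + x) (n + g)) (firstGaps x) ⟩
      b x * δ (x + x) (n + g) ∎

  module _ {n : ℤ} (n>0 : 0ℤ < n) where
    private
      n₊ = pos n>0
      T₊ = pos T>0
      r₊ : ∀ i → 0ℤ ≤ r i - 0ℤ - 1ℤ
      r₊ i = pos (r-positive i)
      1₊ : 0ℤ ≤ 1ℤ
      1₊ = +≤+ ℕ.z≤n
      P₀ = ∑ᶠ (λ i → δ (r i) (n + T))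
      P₁ = ∑ᶠ (λ i → δ (r i) n)

    -- As n, T and the rᵢ are positive, n + g lies above 0, T and T - rᵢ; only T + rᵢ can be hit.
    -- The evaluations that follow discard families of gaps in the same way.
    gaps-g : b (n + g) ≡ P₀
    gaps-g = trans (cong₂ _+_ (cong₂ _+_ (δ-pos (n₊ ⊕ T₊ ⊕ T₊ ⊕ 1₊ ⊕ 1₊) (e₁ n T)) (δ-pos (n₊ ⊕ T₊ ⊕ 1₊) (e₂ n T)))
        (∑-ext F {g = λ i → δ (r i) (n + T)} λ i → trans (cong₂ _+_ (δ-flip _ _ (r i) (n + T) (e₃ n T (r i))) (δ-pos (n₊ ⊕ T₊ ⊕ r₊ i ⊕ 1₊ ⊕ 1₊) (e₄ n T (r i)))) (ℤ.+-identityʳ _)))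
      (ℤ.+-identityˡ P₀)
      where
      e₁ : ∀ n t → (n - 0ℤ - 1ℤ) + (t - 0ℤ - 1ℤ) + (t - 0ℤ - 1ℤ) + 1ℤ + 1ℤ ≡ n + (t + t) - 0ℤ - 1ℤ
      e₁ = solve-∀
      e₂ : ∀ n t → (n - 0ℤ - 1ℤ) + (t - 0ℤ - 1ℤ) + 1ℤ ≡ n + (t + t) - t - 1ℤ
      e₂ = solve-∀
      e₃ : ∀ n t r → n + (t + t) - (t + r) ≡ n + t - r
      e₃ = solve-∀
      e₄ : ∀ n t r → (n - 0ℤ - 1ℤ) + (t - 0ℤ - 1ℤ) + (r - 0ℤ - 1ℤ) + 1ℤ + 1ℤ ≡ n + (t + t) - (t - r) - 1ℤ
      e₄ = solve-∀

    gaps-T : b (n + g - T) ≡ P₁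
    gaps-T = trans (cong₂ _+_ (cong₂ _+_ (δ-pos (n₊ ⊕ T₊ ⊕ 1₊) (e₁ n T)) (δ-pos n₊ (e₂ n T)))
        (∑-ext F {g = λ i → δ (r i) n} λ i → trans (cong₂ _+_ (δ-flip _ _ (r i) n (e₃ n T (r i))) (δ-pos (n₊ ⊕ r₊ i ⊕ 1₊) (e₄ n T (r i)))) (ℤ.+-identityʳ _)))
      (ℤ.+-identityˡ P₁)
      where
      e₁ : ∀ n t → (n - 0ℤ - 1ℤ) + (t - 0ℤ - 1ℤ) + 1ℤ ≡ n + (t + t) - t - 0ℤ - 1ℤ
      e₁ = solve-∀
      e₂ : ∀ n t → n - 0ℤ - 1ℤ ≡ n + (t + t) - t - t - 1ℤ
      e₂ = solve-∀
      e₃ : ∀ n t r → n + (t + t) - t - (t + r) ≡ n - r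
      e₃ = solve-∀
      e₄ : ∀ n t r → (n - 0ℤ - 1ℤ) + (r - 0ℤ - 1ℤ) + 1ℤ ≡ n + (t + t) - t - (t - r) - 1ℤ
      e₄ = solve-∀

    gaps-T+r : ∀ i → b (n + g - (T + r i)) ≡ δ (r i) (n + T) + δ (r i) n + ∑ᶠ (λ j → δ (r i + r j) n + δ (r i - r j) n)
    gaps-T+r i = cong₂ _+_ (cong₂ _+_ (δ-flip _ _ (r i) (n + T) (e₁ n T (r i))) (δ-flip _ _ (r i) n (e₂ n T (r i))))
        (∑-ext F λ j → cong₂ _+_ (δ-flip _ _ (r i + r j) n (e₃ n T (r i) (r j))) (δ-flip _ _ (r i - r j) n (e₄ n T (r i) (r j))))
      where
      e₁ : ∀ n t r → n + (t + t) - (t + r) - 0ℤ ≡ n + t - r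
      e₁ = solve-∀
      e₂ : ∀ n t r → n + (t + t) - (t + r) - t ≡ n - r
      e₂ = solve-∀
      e₃ : ∀ n t r s → n + (t + t) - (t + r) - (t + s) ≡ n - (r + s)
      e₃ = solve-∀
      e₄ : ∀ n t r s → n + (t + t) - (t + r) - (t - s) ≡ n - (r - s)
      e₄ = solve-∀

    gaps-T-r : ∀ i → b (n + g - (T - r i)) ≡ ∑ᶠ (λ j → δ (r j - r i) n)
    gaps-T-r i = trans (cong₂ _+_ (cong₂ _+_ (δ-pos (n₊ ⊕ T₊ ⊕ r₊ i ⊕ 1₊ ⊕ 1₊) (e₁ n T (r i))) (δ-pos (n₊ ⊕ r₊ i ⊕ 1₊) (e₂ n T (r i))))
        (∑-ext F {g = λ j → δ (r j - r i) n} λ j → trans (cong₂ _+_ (δ-flip _ _ (r j - r i) n (e₃ n T (r i) (r j))) (δ-pos (n₊ ⊕ r₊ i ⊕ r₊ j ⊕ 1₊ ⊕ 1₊) (e₄ n T (r i) (r j)))) (ℤ.+-identityʳ _)))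
      (ℤ.+-identityˡ _)
      where
      e₁ : ∀ n t r → (n - 0ℤ - 1ℤ) + (t - 0ℤ - 1ℤ) + (r - 0ℤ - 1ℤ) + 1ℤ + 1ℤ ≡ n + (t + t) - (t - r) - 0ℤ - 1ℤ
      e₁ = solve-∀
      e₂ : ∀ n t r → (n - 0ℤ - 1ℤ) + (r - 0ℤ - 1ℤ) + 1ℤ ≡ n + (t + t) - (t - r) - t - 1ℤ
      e₂ = solve-∀
      e₃ : ∀ n t r s → n + (t + t) - (t - r) - (t + s) ≡ n - (s - r)
      e₃ = solve-∀
      e₄ : ∀ n t r s → (n - 0ℤ - 1ℤ) + (r - 0ℤ - 1ℤ) + (s - 0ℤ - 1ℤ) + 1ℤ + 1ℤ ≡ n + (t + t) - (t - r) - (t - s) - 1ℤ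
      e₄ = solve-∀

    gap-half : ∀ i → δ ((T + r i) + (T + r i)) (n + g) + δ ((T - r i) + (T - r i)) (n + g) ≡ δ (r i + r i) n
    gap-half i = trans (cong₂ _+_ (δ-shift _ _ (r i + r i) n (e₁ n T (r i))) (δ-neg (n₊ ⊕ r₊ i ⊕ r₊ i ⊕ 1₊ ⊕ 1₊) (e₂ n T (r i)))) (ℤ.+-identityʳ _)
      where
      e₁ : ∀ n t r → (t + r) + (t + r) - (n + (t + t)) ≡ r + r - n
      e₁ = solve-∀
      e₂ : ∀ n t r → (n - 0ℤ - 1ℤ) + (r - 0ℤ - 1ℤ) + (r - 0ℤ - 1ℤ) + 1ℤ + 1ℤ ≡ n + (t + t) - ((t - r) + (t - r)) - 1ℤ
      e₂ = solve-∀

    ΔH-value : H beads (n - g) - H beads (n + g) ≡ ∑ᶠ (λ i → δ (r i + r i) n)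
    ΔH-value = trans (unique (ΔH n) (hasSum-gaps T r (λ x → δ (x + x) (n + g))))
      (trans (cong₂ _+_ (cong₂ _+_ (δ-neg (n₊ ⊕ T₊ ⊕ T₊ ⊕ 1₊ ⊕ 1₊) (e₁ n T)) (δ-neg n₊ (e₂ n T))) (∑-ext F gap-half)) (ℤ.+-identityˡ _))
      where
      e₁ : ∀ n t → (n - 0ℤ - 1ℤ) + (t - 0ℤ - 1ℤ) + (t - 0ℤ - 1ℤ) + 1ℤ + 1ℤ ≡ n + (t + t) - (0ℤ + 0ℤ) - 1ℤ
      e₁ = solve-∀
      e₂ : ∀ n t → n - 0ℤ - 1ℤ ≡ n + (t + t) - (t + t) - 1ℤ
      e₂ = solve-∀

    private
      f : Fin t → Fin t → ℤ
      f i j = δ (r i + r j) n + δ (r i - r j) n + δ (r j - r i) n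

    ΔQ-value : Q beads (n + g) + Q beads (n - g) - + 2 * Q beads n ≡ + 2 * P₀ + + 2 * P₁ + ∑ᶠ (λ i → ∑ᶠ (f i))
    ΔQ-value = begin
      Q beads (n + g) + Q beads (n - g) - + 2 * Q beads n
        ≡⟨ unique (ΔQ n) (hasSum-gaps T r (λ x → b (n + g - x))) ⟩
      b (n + g - 0ℤ) + b (n + g - T) + ∑ᶠ (λ i → b (n + g - (T + r i)) + b (n + g - (T - r i)))
        ≡⟨ cong₂ _+_ (cong₂ _+_ (trans (cong b (ℤ.+-identityʳ (n + g))) gaps-g) gaps-T) (∑-ext F row) ⟩
      P₀ + P₁ + ∑ᶠ (λ i → δ (r i) (n + T) + δ (r i) n + ∑ᶠ (f i))
        ≡⟨ cong (_+_ (P₀ + P₁)) (trans (∑-+ F (λ i → δ (r i) (n + T) + δ (r i) n) (λ i → ∑ᶠ (f i))) (cong (_+ ∑ᶠ (λ i → ∑ᶠ (f i))) (∑-+ F (λ i → δ (r i) (n + T)) (λ i → δ (r i) n)))) ⟩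
      P₀ + P₁ + (P₀ + P₁ + ∑ᶠ (λ i → ∑ᶠ (f i)))
        ≡⟨ e₁ P₀ P₁ (∑ᶠ (λ i → ∑ᶠ (f i))) ⟩
      + 2 * P₀ + + 2 * P₁ + ∑ᶠ (λ i → ∑ᶠ (f i)) ∎
      where
      open ≡-Reasoning
      e₁ : ∀ a b s → a + b + (a + b + s) ≡ + 2 * a + + 2 * b + s
      e₁ = solve-∀
      row : ∀ i → b (n + g - (T + r i)) + b (n + g - (T - r i)) ≡ δ (r i) (n + T) + δ (r i) n + ∑ᶠ (f i)
      row i = trans (cong₂ _+_ (gaps-T+r i) (gaps-T-r i))
        (trans (ℤ.+-assoc (δ (r i) (n + T) + δ (r i) n) _ _) (cong (_+_ (δ (r i) (n + T) + δ (r i) n)) (sym (∑-+ F (λ j → δ (r i + r j) n + δ (r i - r j) n) (λ j → δ (r j - r i) n)))))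

    square : ∑ᶠ (λ i → ∑ᶠ (f i)) ≡ ∑ᶠ (λ i → δ (r i + r i) n) + + 2 * ∑-upper (λ i j → δ (r i - r j) n + δ (r i + r j) n)
    square = trans (∑-square f) (cong₂ _+_ (∑-ext F diag) (trans (∑-upper-cong off) pull))
      where
      diag : ∀ i → f i i ≡ δ (r i + r i) n
      diag i = trans (cong₂ _+_ (cong (_+_ (δ (r i + r i) n)) z) z) (e₁ (δ (r i + r i) n))
        where
        e₁ : ∀ d → d + 0ℤ + 0ℤ ≡ d
        e₁ = solve-∀
        e₂ : ∀ n r → n - 0ℤ - 1ℤ ≡ n - (r - r) - 1ℤ
        e₂ = solve-∀
        z : δ (r i - r i) n ≡ 0ℤ
        z = δ-neg n₊ (e₂ n (r i))
      off : ∀ i j → i Fin.< j → f i j + f j i ≡ + 2 * (δ (r i - r j) n + δ (r i + r j) n)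
      off i j i<j = trans (cong₂ (λ p q → δ (r i + r j) n + δ (r i - r j) n + p + (q + p + δ (r i - r j) n)) z (cong (λ s → δ s n) (ℤ.+-comm (r j) (r i))))
        (e₁ (δ (r i + r j) n) (δ (r i - r j) n))
        where
        e₁ : ∀ p m → p + m + 0ℤ + (p + 0ℤ + m) ≡ + 2 * (m + p)
        e₁ = solve-∀
        e₂ : ∀ n r s → (n - 0ℤ - 1ℤ) + (r - s - 1ℤ) + 1ℤ ≡ n - (s - r) - 1ℤ
        e₂ = solve-∀
        z : δ (r j - r i) n ≡ 0ℤ
        z = δ-neg (n₊ ⊕ pos (r-decreasing i j i<j) ⊕ 1₊) (e₂ n (r i) (r j))
      pull : ∑-upper (λ i j → + 2 * (δ (r i - r j) n + δ (r i + r j) n)) ≡ + 2 * ∑-upper (λ i j → δ (r i - r j) n + δ (r i + r j) n)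
      pull = trans (∑-ext F λ i → ∑-*ˡ (filter (i Fin.<?_) F) (+ 2) (term i)) (∑-*ˡ F (+ 2) (λ i → ∑ (filter (i Fin.<?_) F) (term i)))
        where
        term : Fin t → Fin t → ℤ
        term i j = δ (r i - r j) n + δ (r i + r j) n

    -- `ΔQ-value` contains more than the roots: the diagonal terms 2rᵢ = n are cancelled by
    -- `ΔH-value`, and the terms rᵢ = n + T by c (n + g) - c n, since n + g is a first gap exactly
    -- for these.
    second-difference :
      (Q beads (n + g) + Q beads (n - g) - + 2 * Q beads n) - (H beads (n - g) - H beads (n + g)) + + 2 * (c (n + g) - c n)
      ≡ + 2 * roots r n
    second-difference = trans (cong₂ _+_ (cong₂ _-_ (trans ΔQ-value (cong (_+_ (+ 2 * P₀ + + 2 * P₁)) square)) ΔH-value) (cong (_*_ (+ 2)) last))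
      (e₁ P₀ P₁ (∑ᶠ (λ i → δ (r i + r i) n)) (∑-upper (λ i j → δ (r i - r j) n + δ (r i + r j) n)))
      where
      e₁ : ∀ a b d u → (+ 2 * a + + 2 * b + (d + + 2 * u)) - d + + 2 * (- a) ≡ + 2 * (b + u)
      e₁ = solve-∀
      e₂ : ∀ n g → n ≡ n + g - g
      e₂ = solve-∀
      e₃ : ∀ a b → a - b ≡ - (b - a)
      e₃ = solve-∀
      last : c (n + g) - c n ≡ - P₀
      last = trans (e₃ (c (n + g)) (c n)) (cong -_ (trans (cong (λ z → c z - c (n + g)) (e₂ n g)) (trans (firstGaps (n + g)) gaps-g)))

module _ {c : ℤ → ℤ} (C : Beads c) (g : ℤ) where
  -- For n < g, where n - g is no hook length, the exponent of 1/τ(n) in the α-product takes the place of A⁻ (n - g).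
  wrapped : ℤ → ℤ
  wrapped n with g ℤ.≤? n
  ... | yes _ = A⁻ C (n - g)
  ... | no _  = A⁺ C (g - n)

  -- For n > 0, the exponent of τ(n) in the left-hand product divided by the α-product.
  hookCoefficient : ℤ → ℤ
  hookCoefficient n = A⁺ C (n + g) + wrapped n - A⁺ C n - A⁻ C n

-- The part of twice `wrapped` in which no bead occurs, up to sign.
err : ℤ → ℤ → ℤ
err g n with g ℤ.≤? n
... | yes _ = 0ℤ
... | no _  = proj₁ (errSum (g - n))

module _ {T : ℤ} {t : ℕ} {r : Fin t → ℤ} {c : ℤ → ℤ} (C : Coded T r c) (T>0 : 0ℤ < T) where
  open Coded C
  private
    g = T + T

  2wrapped : ∀ n → + 2 * wrapped beads g n ≡ Q beads (n - g) - H beads (n - g) - err g n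
  2wrapped n with g ℤ.≤? n
  ... | yes g≤n = trans (2A⁻ beads (n - g))
      (trans (cong (λ z → Q beads (n - g) - H beads (n - g) + + 2 * (c (n - g) * (1ℤ - z))) (θ-yes (nonneg g≤n)))
        (e₁ (Q beads (n - g)) (H beads (n - g)) (c (n - g))))
    where
    e₁ : ∀ q h c → q - h + + 2 * (c * (1ℤ - 1ℤ)) ≡ q - h - 0ℤ
    e₁ = solve-∀
  ... | no g≰n = trans (2A⁺-positive beads (g - n) (<-from (pos (ℤ.≰⇒> g≰n)) (e₁ g n)))
      (cong (λ z → Q beads z - H beads z - proj₁ (errSum (g - n))) (e₂ g n))
    where
    e₁ : ∀ g n → g - n - 1ℤ ≡ g - n - 0ℤ - 1ℤ
    e₁ = solve-∀
    e₂ : ∀ g n → - (g - n) ≡ n - g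
    e₂ = solve-∀

  2hookCoefficient : ∀ n → 0ℤ < n → + 2 * hookCoefficient beads g n ≡ + 2 * roots r n - err g n
  2hookCoefficient n n>0 = begin
    + 2 * hookCoefficient beads g n
      ≡⟨ e₁ (A⁺ beads (n + g)) (wrapped beads g n) (A⁺ beads n) (A⁻ beads n) ⟩
    + 2 * A⁺ beads (n + g) + + 2 * wrapped beads g n - + 2 * A⁺ beads n - + 2 * A⁻ beads n
      ≡⟨ cong₂ _-_ (cong₂ _-_ (cong₂ _+_ (2A⁺ beads (n + g)) (2wrapped n)) (2A⁺ beads n)) (2A⁻ beads n) ⟩
    (Q beads (n + g) + H beads (n + g) + + 2 * (c (n + g) * θ (n + g))) + (Q beads (n - g) - H beads (n - g) - err g n)
      - (Q beads n + H beads n + + 2 * (c n * θ n)) - (Q beads n - H beads n + + 2 * (c n * (1ℤ - θ n)))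
      ≡⟨ cong (λ z → (Q beads (n + g) + H beads (n + g) + + 2 * (c (n + g) * z)) + (Q beads (n - g) - H beads (n - g) - err g n)
             - (Q beads n + H beads n + + 2 * (c n * θ n)) - (Q beads n - H beads n + + 2 * (c n * (1ℤ - θ n)))) (θ-yes n+g≥0) ⟩
    (Q beads (n + g) + H beads (n + g) + + 2 * (c (n + g) * 1ℤ)) + (Q beads (n - g) - H beads (n - g) - err g n)
      - (Q beads n + H beads n + + 2 * (c n * θ n)) - (Q beads n - H beads n + + 2 * (c n * (1ℤ - θ n)))
      ≡⟨ e₂ (Q beads (n + g)) (H beads (n + g)) (c (n + g)) (Q beads (n - g)) (H beads (n - g)) (err g n) (Q beads n) (H beads n) (c n) (θ n) ⟩
    (Q beads (n + g) + Q beads (n - g) - + 2 * Q beads n) - (H beads (n - g) - H beads (n + g)) + + 2 * (c (n + g) - c n) - err g n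
      ≡⟨ cong (_- err g n) (second-difference C T>0 n>0) ⟩
    + 2 * roots r n - err g n ∎
    where
    open ≡-Reasoning
    n+g≥0 : 0ℤ ≤ n + g
    n+g≥0 = ℤ.<⇒≤ n>0 ⊕ (ℤ.<⇒≤ T>0 ⊕ ℤ.<⇒≤ T>0)
    e₁ : ∀ p w q s → + 2 * (p + w - q - s) ≡ + 2 * p + + 2 * w - + 2 * q - + 2 * s
    e₁ = solve-∀
    e₂ : ∀ q₊ h₊ c₊ q₋ h₋ e q h c t →
      (q₊ + h₊ + + 2 * (c₊ * 1ℤ)) + (q₋ - h₋ - e) - (q + h + + 2 * (c * t)) - (q - h + + 2 * (c * (1ℤ - t)))
      ≡ (q₊ + q₋ - + 2 * q) - (h₋ - h₊) + + 2 * (c₊ - c) - e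
    e₂ = solve-∀

-- Beads and holes of a partition.

nth-head : ∀ {x xs} → Linked ℕ._≥_ (x ∷ xs) → ∀ k → nth xs k ℕ.≤ x
nth-head [-]          k       = ℕ.z≤n
nth-head (x≥y ∷ _)    zero    = x≥y
nth-head (x≥y ∷ rest) (suc k) = ℕ.≤-trans (nth-head rest k) x≥y

nth≤head : ∀ {x xs} → Linked ℕ._≥_ (x ∷ xs) → ∀ k → nth (x ∷ xs) k ℕ.≤ x
nth≤head s zero    = ℕ.≤-refl
nth≤head s (suc k) = nth-head s k

linked-tail : ∀ {x xs} → Linked ℕ._≥_ (x ∷ xs) → Linked ℕ._≥_ xs
linked-tail [-]        = []
linked-tail (_ ∷ rest) = rest

-- In a weakly decreasing list the entries ≥ j form an initial segment. With `nth-filter⁻` this is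
-- the duality of rows and columns: j ≤ λᵢ if and only if i ≤ λ′ⱼ.
nth-filter⁺ : ∀ {xs} → Linked ℕ._≥_ xs → ∀ {j} k → 1 ℕ.≤ j → j ℕ.≤ nth xs k → k ℕ.< length (filter (j ℕ.≤?_) xs)
nth-filter⁺ {[]} _ k 1≤j j≤ = ⊥-elim (ℕ.<⇒≱ 1≤j j≤)
nth-filter⁺ {x ∷ xs} s {j} k 1≤j j≤ with j ℕ.≤? x
... | no j≰x = ⊥-elim (j≰x (ℕ.≤-trans j≤ (nth≤head s k)))
... | yes j≤x = subst (k ℕ.<_) (cong length (sym (List.filter-accept (j ℕ.≤?_) j≤x))) (step k j≤)
  where
  step : ∀ k → j ℕ.≤ nth (x ∷ xs) k → k ℕ.< suc (length (filter (j ℕ.≤?_) xs))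
  step zero    _  = ℕ.s≤s ℕ.z≤n
  step (suc k) j≤ = ℕ.s≤s (nth-filter⁺ (linked-tail s) k 1≤j j≤)

nth-filter⁻ : ∀ {xs} → Linked ℕ._≥_ xs → ∀ {j} k → k ℕ.< length (filter (j ℕ.≤?_) xs) → j ℕ.≤ nth xs k
nth-filter⁻ {x ∷ xs} s {j} k k< with j ℕ.≤? x
... | no j≰x = ⊥-elim (j≰x (ℕ.≤-trans (nth-filter⁻ (linked-tail s) k (subst (k ℕ.<_) (cong length (List.filter-reject (j ℕ.≤?_) j≰x)) k<)) (nth-head s k)))
... | yes j≤x = step k (subst (k ℕ.<_) (cong length (List.filter-accept (j ℕ.≤?_) j≤x)) k<)
  where
  step : ∀ k → k ℕ.< suc (length (filter (j ℕ.≤?_) xs)) → j ℕ.≤ nth (x ∷ xs) k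
  step zero    _          = j≤x
  step (suc k) (ℕ.s≤s k<) = nth-filter⁻ (linked-tail s) k k<

nth-beyond : ∀ xs k → length xs ℕ.≤ k → nth xs k ≡ 0
nth-beyond []       k       _         = refl
nth-beyond (x ∷ xs) (suc k) (ℕ.s≤s l) = nth-beyond xs k l

sum-nth : ∀ xs (f : ℕ → ℕ) (q : ℕ → ℤ) → (∀ k → q (f k) ≡ + nth xs k) → ∑ (applyUpTo f (length xs)) q ≡ + sum xs
sum-nth []       f q h = refl
sum-nth (x ∷ xs) f q h = trans (cong₂ _+_ (h 0) (sum-nth xs (f ∘ suc) q (h ∘ suc))) (sym (ℤ.pos-+ x (sum xs)))

module _ (p : Partition) where

  conj⁺ : ∀ {i j} → 1 ℕ.≤ i → 1 ℕ.≤ j → j ℕ.≤ part p i → i ℕ.≤ conj p j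
  conj⁺ {suc i} _ = nth-filter⁺ (sorted p) i

  conj⁻ : ∀ {i j} → 1 ℕ.≤ i → i ℕ.≤ conj p j → j ℕ.≤ part p i
  conj⁻ {suc i} _ = nth-filter⁻ (sorted p) i

  conj≤ℓ : ∀ j → conj p j ℕ.≤ ℓ p
  conj≤ℓ j = List.length-filter (j ℕ.≤?_) (parts p)

  part-beyond : ∀ {i} → ℓ p ℕ.< i → part p i ≡ 0
  part-beyond {suc i} (ℕ.s≤s l) = nth-beyond (parts p) i l

  part-antitone : ∀ {i k} → 1 ℕ.≤ i → i ℕ.≤ k → part p k ℕ.≤ part p i
  part-antitone {i} {k} 1≤i i≤k with part p k in eq
  ... | zero  = ℕ.z≤n
  ... | suc n = conj⁻ 1≤i (ℕ.≤-trans i≤k (conj⁺ (ℕ.≤-trans 1≤i i≤k) (ℕ.s≤s ℕ.z≤n) (ℕ.≤-reflexive (sym eq))))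

  conj-antitone : ∀ {j k} → 1 ℕ.≤ j → j ℕ.≤ k → conj p k ℕ.≤ conj p j
  conj-antitone {j} {k} 1≤j j≤k with conj p k in eq
  ... | zero  = ℕ.z≤n
  ... | suc n = conj⁺ (ℕ.s≤s ℕ.z≤n) 1≤j (ℕ.≤-trans j≤k (conj⁻ (ℕ.s≤s ℕ.z≤n) (ℕ.≤-reflexive (sym eq))))

  bead hole : ℕ → ℤ
  bead i = + part p i - + i
  hole j = + j - 1ℤ - + conj p j

  bead-decreasing : ∀ {i k} → 1 ℕ.≤ i → i ℕ.< k → bead k < bead i
  bead-decreasing {i} {k} 1≤i i<k =
    <-from (nonneg (+≤+ (part-antitone 1≤i (ℕ.<⇒≤ i<k))) ⊕ pos (+<+ i<k)) (e (+ part p i) (+ part p k) (+ i) (+ k))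
    where e : ∀ a b i k → (a - b) + (k - i - 1ℤ) ≡ (a - i) - (b - k) - 1ℤ
          e = solve-∀

  hole-increasing : ∀ {j k} → 1 ℕ.≤ j → j ℕ.< k → hole j < hole k
  hole-increasing {j} {k} 1≤j j<k =
    <-from (nonneg (+≤+ (conj-antitone 1≤j (ℕ.<⇒≤ j<k))) ⊕ pos (+<+ j<k)) (e (+ conj p j) (+ conj p k) (+ j) (+ k))
    where e : ∀ a b j k → (a - b) + (k - j - 1ℤ) ≡ (k - 1ℤ - b) - (j - 1ℤ - a) - 1ℤ
          e = solve-∀

  bead-injective : ∀ {i k} → 1 ℕ.≤ i → 1 ℕ.≤ k → bead i ≡ bead k → i ≡ k
  bead-injective {i} {k} 1≤i 1≤k eq with ℕ.<-cmp i k
  ... | tri< i<k _ _ = ⊥-elim (ℤ.<⇒≢ (bead-decreasing 1≤i i<k) (sym eq))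
  ... | tri≈ _ i≡k _ = i≡k
  ... | tri> _ _ k<i = ⊥-elim (ℤ.<⇒≢ (bead-decreasing 1≤k k<i) eq)

  hole-injective : ∀ {j k} → 1 ℕ.≤ j → 1 ℕ.≤ k → hole j ≡ hole k → j ≡ k
  hole-injective {j} {k} 1≤j 1≤k eq with ℕ.<-cmp j k
  ... | tri< j<k _ _ = ⊥-elim (ℤ.<⇒≢ (hole-increasing 1≤j j<k) eq)
  ... | tri≈ _ j≡k _ = j≡k
  ... | tri> _ _ k<j = ⊥-elim (ℤ.<⇒≢ (hole-increasing 1≤k k<j) (sym eq))

  hole<bead : ∀ {i j} → 1 ℕ.≤ i → 1 ℕ.≤ j → j ℕ.≤ part p i → hole j < bead i
  hole<bead {i} {j} 1≤i 1≤j j≤ =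
    -- The two certificates are the arm and the leg of the box.
    <-from (nonneg (+≤+ j≤) ⊕ nonneg (+≤+ (conj⁺ 1≤i 1≤j j≤))) (e (+ part p i) (+ conj p j) (+ i) (+ j))
    where e : ∀ a c i j → (a - j) + (c - i) ≡ (a - i) - (j - 1ℤ - c) - 1ℤ
          e = solve-∀

  bead<hole : ∀ {i j} → 1 ℕ.≤ i → 1 ℕ.≤ j → ¬ j ℕ.≤ part p i → bead i < hole j
  bead<hole {i} {j} 1≤i 1≤j j≰ =
    <-from (pos (+<+ (ℕ.≰⇒> j≰)) ⊕ pos (+<+ (ℕ.≰⇒> (λ i≤ → j≰ (conj⁻ 1≤i i≤))))) (e (+ part p i) (+ conj p j) (+ i) (+ j))
    where e : ∀ a c i j → (j - a - 1ℤ) + (i - c - 1ℤ) ≡ (j - 1ℤ - c) - (a - i) - 1ℤ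
          e = solve-∀

  IsBead : ℤ → Set
  IsBead z = ∃[ i ] 1 ℕ.≤ i × z ≡ bead i

  hole-not-bead : ∀ {j} → 1 ℕ.≤ j → ¬ IsBead (hole j)
  hole-not-bead {j} 1≤j (i , 1≤i , eq) with j ℕ.≤? part p i
  ... | yes j≤ = ℤ.<⇒≢ (hole<bead 1≤i 1≤j j≤) eq
  ... | no j≰  = ℤ.<⇒≢ (bead<hole 1≤i 1≤j j≰) (sym eq)

  bead-beyond : ∀ {i} → ℓ p ℕ.< i → bead i ≡ - + i
  bead-beyond {i} l = trans (cong (λ k → + k - + i) (part-beyond l)) (ℤ.+-identityˡ (- + i))

  low-bead : ∀ {z} → z < - + ℓ p → IsBead z
  low-bead {z} z< = ∣ z ∣ , ℕ.≤-trans (ℕ.s≤s ℕ.z≤n) ℓ< , trans eq (sym (bead-beyond ℓ<))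
    where
    e : ∀ l z → - l - z - 1ℤ ≡ - z - l - 1ℤ
    e = solve-∀
    -z : + ∣ z ∣ ≡ - z
    -z = trans (cong +_ (sym (ℤ.∣-i∣≡∣i∣ z))) (ℤ.0≤i⇒+∣i∣≡i
           (ℤ.≤-trans (+≤+ ℕ.z≤n) (ℤ.<⇒≤ (<-from {x = + ℓ p} {y = - z} (pos z<) (e (+ ℓ p) z)))))
    ℓ< : ℓ p ℕ.< ∣ z ∣
    ℓ< = ℤ.drop‿+<+ (subst (+ ℓ p <_) (sym -z) (<-from (pos z<) (e (+ ℓ p) z)))
    eq : z ≡ - + ∣ z ∣
    eq = trans (sym (ℤ.neg-involutive z)) (cong -_ (sym -z))

  -- Makes `IsBead` decidable by a finite search: past the length of p the bead at i is -i, so that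
  -- i is ∣ z ∣.
  index-bound : ∀ {z i} → 1 ℕ.≤ i → z ≡ bead i → i ℕ.≤ ℓ p ℕ.+ ∣ z ∣
  index-bound {z} {i} 1≤i eq with i ℕ.≤? ℓ p
  ... | yes i≤ = ℕ.≤-trans i≤ (ℕ.m≤m+n (ℓ p) ∣ z ∣)
  ... | no i≰  = ℕ.≤-trans (ℕ.≤-reflexive (sym ∣z∣)) (ℕ.m≤n+m ∣ z ∣ (ℓ p))
    where
    ∣z∣ : ∣ z ∣ ≡ i
    ∣z∣ = trans (cong ∣_∣ (trans eq (bead-beyond (ℕ.≰⇒> i≰)))) (ℤ.∣-i∣≡∣i∣ (+ i))

  abstract
    isBead? : ∀ z → Dec (IsBead z)
    isBead? z with any? (λ i → z ℤ.≟ bead i) [1⋯ ℓ p ℕ.+ ∣ z ∣ ]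
    ... | yes q = let i , i∈ , eq = find q in yes (i , proj₁ (∈-[1⋯]⁻ i∈) , eq)
    ... | no ¬q = no λ (i , 1≤i , eq) → ¬q (lose (∈-[1⋯]⁺ 1≤i (index-bound 1≤i eq)) eq)

  private
    -- The least i = k + 1 with bead i ≤ z, searched for downwards from n + 1.
    search : ∀ z n → bead (suc n) ≤ z → ∃[ k ] bead (suc k) ≤ z × (1 ℕ.≤ k → z < bead k)
    search z zero    h = zero , h , λ ()
    search z (suc n) h with bead (suc n) ℤ.≤? z
    ... | yes h′ = search z n h′
    ... | no ¬h  = suc n , h , λ _ → ℤ.≰⇒> ¬h

  abstract
    -- If z lies strictly between the beads k + 1 and k, then j = z + 1 + k satisfies λₖ₊₁ < j ≤ λₖ
    -- (only the first bound when k = 0). Column j thus has length k, and its hole is z.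
    not-bead-hole : ∀ {z} → ¬ IsBead z → ∃[ j ] 1 ℕ.≤ j × z ≡ hole j
    not-bead-hole {z} ¬z with search z (ℓ p ℕ.+ ∣ z ∣)
        (subst (_≤ z) (sym (bead-beyond (ℕ.s≤s (ℕ.m≤m+n (ℓ p) ∣ z ∣))))
          (ℤ.≤-trans (ℤ.neg-mono-≤ (+≤+ (ℕ.m≤n⇒m≤1+n (ℕ.m≤n+m ∣ z ∣ (ℓ p))))) (-∣i∣≤i z)))
    ... | k , bead≤z , z<bead = j , 1≤j , z≡
      where
      e₁ : ∀ a k z → (z - (a - (1ℤ + k)) - 1ℤ) + a ≡ z + 1ℤ + k - 0ℤ - 1ℤ
      e₁ = solve-∀
      e₂ : ∀ a k z → (a - k) - z - 1ℤ ≡ a - (z + 1ℤ + k)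
      e₂ = solve-∀
      e₃ : ∀ a k z → (z - (a - (1ℤ + k)) - 1ℤ) + (a - (z + 1ℤ + k)) ≡ -1ℤ
      e₃ = solve-∀
      e₄ : ∀ k z → z ≡ z + 1ℤ + k - 1ℤ - k
      e₄ = solve-∀
      bead<z : bead (suc k) < z
      bead<z = ℤ.≤∧≢⇒< bead≤z (λ eq → ¬z (suc k , ℕ.s≤s ℕ.z≤n , sym eq))
      z+k+1>0 : 0ℤ < z + 1ℤ + + k
      z+k+1>0 = <-from (pos bead<z ⊕ +≤+ ℕ.z≤n) (e₁ (+ part p (suc k)) (+ k) z)
      j : ℕ
      j = ∣ z + 1ℤ + + k ∣
      +j : + j ≡ z + 1ℤ + + k
      +j = ℤ.0≤i⇒+∣i∣≡i (ℤ.<⇒≤ z+k+1>0)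
      1≤j : 1 ℕ.≤ j
      1≤j = ℤ.drop‿+<+ (subst (0ℤ <_) (sym +j) z+k+1>0)
      k≤conj : k ℕ.≤ conj p j
      k≤conj with 1 ℕ.≤? k
      ... | no k<1  = subst (ℕ._≤ conj p j) (sym (ℕ.n<1⇒n≡0 (ℕ.≰⇒> k<1))) ℕ.z≤n
      ... | yes 1≤k = conj⁺ 1≤k 1≤j (ℤ.drop‿+≤+ (≤-from (pos (z<bead 1≤k))
                        (trans (e₂ (+ part p k) (+ k) z) (cong (_-_ (+ part p k)) (sym +j)))))
      conj≤k : conj p j ℕ.≤ k
      conj≤k = ℕ.≮⇒≥ λ k<conj → absurd
        (pos bead<z ⊕ nonneg (+≤+ (conj⁻ (ℕ.s≤s ℕ.z≤n) k<conj)))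
        (trans (cong (λ u → (z - (+ part p (suc k) - (1ℤ + + k)) - 1ℤ) + (+ part p (suc k) - u)) +j) (e₃ (+ part p (suc k)) (+ k) z))
      z≡ : z ≡ hole j
      z≡ = trans (e₄ (+ k) z) (cong₂ (λ u v → u - 1ℤ - + v) (sym +j) (ℕ.≤-antisym k≤conj conj≤k))

  hook-bead-hole : ∀ i j → hook p (i , j) ≡ bead i - hole j
  hook-bead-hole i j = e (+ part p i) (+ conj p j) (+ i) (+ j)
    where e : ∀ a c i j → a - j + c - i + 1ℤ ≡ (a - i) - (j - 1ℤ - c)
          e = solve-∀

  ∈-boxes⁺ : ∀ {i j} → 1 ℕ.≤ i → 1 ℕ.≤ j → j ℕ.≤ part p i → (i , j) ∈ boxes p
  ∈-boxes⁺ {i} {j} 1≤i 1≤j j≤ = ∈.∈-concatMap⁺ (λ i → map (i ,_) [1⋯ part p i ])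
    (lose (∈-[1⋯]⁺ 1≤i (ℕ.≤-trans (conj⁺ 1≤i 1≤j j≤) (conj≤ℓ j))) (∈.∈-map⁺ (i ,_) (∈-[1⋯]⁺ 1≤j j≤)))

  ∈-boxes⁻ : ∀ {i j} → (i , j) ∈ boxes p → 1 ℕ.≤ i × 1 ℕ.≤ j × j ℕ.≤ part p i
  ∈-boxes⁻ s∈ with find (∈.∈-concatMap⁻ (λ i → map (i ,_) [1⋯ part p i ]) {xs = [1⋯ ℓ p ]} s∈)
  ... | i , i∈ , s∈′ with ∈.∈-map⁻ (i ,_) s∈′
  ... | j , j∈ , refl = proj₁ (∈-[1⋯]⁻ i∈) , ∈-[1⋯]⁻ j∈

  ∑-boxes : (f : Box → ℤ) → ∑ (boxes p) f ≡ ∑[ i ← [1⋯ ℓ p ] ] ∑[ j ← [1⋯ part p i ] ] f (i , j)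
  ∑-boxes f = trans (∑-concatMap (λ i → map (i ,_) [1⋯ part p i ]) [1⋯ ℓ p ] f)
    (∑-ext [1⋯ ℓ p ] (λ i → ∑-map (i ,_) [1⋯ part p i ] f))

  abstract
    c : ℤ → ℤ
    c z = I (isBead? z)

    c-bead : ∀ {z} → IsBead z → c z ≡ 1ℤ
    c-bead {z} = I-yes (isBead? z)

    c-hole : ∀ {z} → ¬ IsBead z → c z ≡ 0ℤ
    c-hole {z} = I-no (isBead? z)

  ∑-beads-here : ∀ {z i} → 1 ℕ.≤ i → i ℕ.≤ ℓ p → z ≡ bead i → (W : ℕ → ℤ) → ∑[ k ← [1⋯ ℓ p ] ] (δ z (bead k) * W k) ≡ W i
  ∑-beads-here {z} {i} 1≤i i≤ refl W =
    trans (∑-single ([1⋯]-unique (ℓ p)) (λ k → δ (bead i) (bead k) * W k) (∈-[1⋯]⁺ 1≤i i≤)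
            (λ k k∈ k≢i → cong (_* W k) (δ-≢ (λ eq → k≢i (bead-injective (proj₁ (∈-[1⋯]⁻ k∈)) 1≤i (sym eq))))))
          (trans (cong (_* W i) (δ-≡ refl)) (ℤ.*-identityˡ (W i)))

  ∑-beads-none : ∀ {z} → (∀ k → 1 ℕ.≤ k → k ℕ.≤ ℓ p → ¬ z ≡ bead k) → (W : ℕ → ℤ) → ∑[ k ← [1⋯ ℓ p ] ] (δ z (bead k) * W k) ≡ 0ℤ
  ∑-beads-none h W = ∑-zero [1⋯ ℓ p ] λ k k∈ → let 1≤k , k≤ = ∈-[1⋯]⁻ k∈ in cong (_* W k) (δ-≢ (h k 1≤k k≤))

  -- A bead z with a hole at z - m determines one box of hook length m, whose bead and hole add up
  -- to z + z - m. The weight S is later `θ` or `1ℤ - θ`, which yields `A⁺` and `A⁻`.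
  hasSum-hooks : ∀ m → 0ℤ < m → (S : ℤ → ℤ) →
    HasSum (λ z → c z * (1ℤ - c (z - m)) * S (z + z - m))
           (∑[ s ← boxes p ] (δ (hook p s) m * S (bead (proj₁ s) + hole (proj₂ s))))
  hasSum-hooks m m>0 S = subst (HasSum _) (sym (∑-boxes (λ s → δ (hook p s) m * S (bead (proj₁ s) + hole (proj₂ s)))))
    (hasSum-ext (λ z → sym (pointwise z (isBead? z))) (hasSum-∑ [1⋯ ℓ p ] (λ i z → δ z (bead i) * W i) W (λ i → hasSum-δ (bead i) (W i))))
    where
    W : ℕ → ℤ
    W i = ∑[ j ← [1⋯ part p i ] ] (δ (hook p (i , j)) m * S (bead i + hole j))
    δ-hook : ∀ i j → δ (hook p (i , j)) m ≡ δ (hole j) (bead i - m)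
    δ-hook i j = trans (cong (λ h → δ h m) (hook-bead-hole i j)) (δ-flip _ _ (hole j) (bead i - m) (e (bead i) (hole j) m))
      where e : ∀ x y m → x - y - m ≡ x - m - y
            e = solve-∀
    row : ∀ i → 1 ℕ.≤ i → Dec (IsBead (bead i - m)) → W i ≡ (1ℤ - c (bead i - m)) * S (bead i + bead i - m)
    row i 1≤i (yes isB) = trans
      (∑-zero [1⋯ part p i ] λ j j∈ → cong (_* S (bead i + hole j)) (trans (δ-hook i j)
        (δ-≢ λ eq → hole-not-bead (proj₁ (∈-[1⋯]⁻ j∈)) (subst IsBead (sym eq) isB))))
      (sym (cong (λ k → (1ℤ - k) * S (bead i + bead i - m)) (c-bead isB)))
    row i 1≤i (no ¬B) = trans
        (∑-single ([1⋯]-unique (part p i)) (λ j → δ (hook p (i , j)) m * S (bead i + hole j)) (∈-[1⋯]⁺ 1≤j j≤)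
          (λ k k∈ k≢j → cong (_* S (bead i + hole k)) (trans (δ-hook i k)
            (δ-≢ λ eq′ → k≢j (hole-injective (proj₁ (∈-[1⋯]⁻ k∈)) 1≤j (trans eq′ eq))))))
        (cong₂ (λ u v → u * S v) (trans (trans (δ-hook i j) (δ-≡ (sym eq))) (sym (cong (_-_ 1ℤ) (c-hole ¬B))))
          (trans (cong (_+_ (bead i)) (sym eq)) (e (bead i) m)))
      where
      j : ℕ
      j = proj₁ (not-bead-hole ¬B)
      1≤j : 1 ℕ.≤ j
      1≤j = proj₁ (proj₂ (not-bead-hole ¬B))
      eq : bead i - m ≡ hole j
      eq = proj₂ (proj₂ (not-bead-hole ¬B))
      e : ∀ x m → x + (x - m) ≡ x + x - m
      e = solve-∀
      e′ : ∀ x m → (m - 0ℤ - 1ℤ) + ((x - m) - x - 1ℤ) + 1ℤ ≡ -1ℤ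
      e′ = solve-∀
      j≤ : j ℕ.≤ part p i
      j≤ = ℕ.≮⇒≥ λ part<j → absurd
        (pos m>0 ⊕ pos (subst (bead i <_) (sym eq) (bead<hole 1≤i 1≤j (ℕ.<⇒≱ part<j))) ⊕ +≤+ {0} {1} ℕ.z≤n) (e′ (bead i) m)
    pointwise : ∀ z → Dec (IsBead z) → c z * (1ℤ - c (z - m)) * S (z + z - m) ≡ ∑[ i ← [1⋯ ℓ p ] ] (δ z (bead i) * W i)
    pointwise z (no ¬B) = trans (cong (λ k → k * (1ℤ - c (z - m)) * S (z + z - m)) (c-hole ¬B))
        (sym (∑-beads-none (λ k 1≤k _ z≡ → ¬B (k , 1≤k , z≡)) W))
    pointwise z (yes (i , 1≤i , z≡)) = trans (cong (λ k → k * (1ℤ - c (z - m)) * S (z + z - m)) (c-bead (i , 1≤i , z≡)))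
        (trans (cong (_* S (z + z - m)) (ℤ.*-identityˡ (1ℤ - c (z - m)))) (at-bead (i ℕ.≤? ℓ p)))
      where
      e : ∀ i l m → (i - l - 1ℤ) + (m - 0ℤ - 1ℤ) + 1ℤ ≡ - l - (- i - m) - 1ℤ
      e = solve-∀
      at-bead : Dec (i ℕ.≤ ℓ p) → (1ℤ - c (z - m)) * S (z + z - m) ≡ ∑[ i ← [1⋯ ℓ p ] ] (δ z (bead i) * W i)
      at-bead (yes i≤) = trans (cong (λ x → (1ℤ - c (x - m)) * S (x + x - m)) z≡)
        (trans (sym (row i 1≤i (isBead? (bead i - m)))) (sym (∑-beads-here 1≤i i≤ z≡ W)))
      -- A bead past the length of p carries no boxes; every lower position, z - m included, is a
      -- bead again, so both sides vanish.
      at-bead (no i≰) = trans (cong (λ k → (1ℤ - k) * S (z + z - m)) (c-bead (low-bead z-m<)))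
        (sym (∑-beads-none (λ k 1≤k k≤ z≡′ → i≰ (subst (ℕ._≤ ℓ p) (bead-injective 1≤k 1≤i (trans (sym z≡′) z≡)) k≤)) W))
        where
        z-m< : z - m < - + ℓ p
        z-m< = subst (λ x → x - m < - + ℓ p) (sym (trans z≡ (bead-beyond (ℕ.≰⇒> i≰))))
          (<-from (pos (+<+ (ℕ.≰⇒> i≰)) ⊕ pos m>0 ⊕ +≤+ {0} {1} ℕ.z≤n) (e (+ i) (+ ℓ p) m))

  size-∑ : + size p ≡ ∑[ i ← [1⋯ ℓ p ] ] (+ part p i)
  size-∑ = sym (sum-nth (parts p) suc (λ i → + part p i) (λ _ → refl))

  -- c z - (1 - θ z) compares the beads of p with those of the empty partition.
  hasSum-excess : ∀ φ → HasSum (λ z → (c z - (1ℤ - θ z)) * φ z) (∑[ i ← [1⋯ ℓ p ] ] (φ (bead i) - φ (- + i)))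
  hasSum-excess φ = hasSum-ext (λ z → sym (eq z))
    (hasSum-∑ [1⋯ ℓ p ] _ _ (λ i → hasSum-- (hasSum-δ (bead i) (φ (bead i))) (hasSum-δ (- + i) (φ (- + i)))))
    where
    open ≡-Reasoning
    N = [1⋯ ℓ p ]
    one : ℕ → ℤ
    one _ = 1ℤ
    low-neg : ∀ {z k} → z < - + ℓ p → k ℕ.≤ ℓ p → ¬ z ≡ - + k
    low-neg z< k≤ refl = ℤ.<⇒≱ z< (ℤ.neg-mono-≤ (+≤+ k≤))
    low-beads : ∀ {z k} → z < - + ℓ p → 1 ℕ.≤ k → k ℕ.≤ ℓ p → ¬ z ≡ bead k
    low-beads {z} {k} z< 1≤k k≤ z≡ = absurd (pos z< ⊕ nonneg (+≤+ k≤) ⊕ +≤+ {0} {part p k} ℕ.z≤n)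
        (trans (cong (λ x → (- + ℓ p - x - 1ℤ) + (+ ℓ p - + k) + + part p k) z≡) (e (+ ℓ p) (+ k) (+ part p k)))
      where e : ∀ l k a → (- l - (a - k) - 1ℤ) + (l - k) + a ≡ -1ℤ
            e = solve-∀
    c≡ : ∀ z → - + ℓ p ≤ z → c z ≡ ∑[ i ← N ] (δ z (bead i) * 1ℤ)
    c≡ z z≥ with isBead? z
    ... | no ¬B = trans (c-hole ¬B) (sym (∑-beads-none (λ k 1≤k _ z≡ → ¬B (k , 1≤k , z≡)) one))
    ... | yes (i , 1≤i , z≡) with i ℕ.≤? ℓ p
    ... | yes i≤ = trans (c-bead (i , 1≤i , z≡)) (sym (∑-beads-here 1≤i i≤ z≡ one))
    ... | no i≰  = ⊥-elim (ℤ.<⇒≱ (ℤ.neg-mono-< (+<+ (ℕ.≰⇒> i≰))) (subst (- + ℓ p ≤_) (trans z≡ (bead-beyond (ℕ.≰⇒> i≰))) z≥))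
    neg≡ : ∀ z → - + ℓ p ≤ z → 1ℤ - θ z ≡ ∑[ i ← N ] (δ z (- + i) * 1ℤ)
    neg≡ z z≥ with 0ℤ ℤ.≤? z
    ... | yes z≥0 = trans (cong (_-_ 1ℤ) (θ-yes z≥0)) (sym (∑-zero N λ k k∈ → cong (_* 1ℤ) (δ-≢ λ z≡ →
            ℤ.<⇒≱ (ℤ.neg-mono-< (+<+ (proj₁ (∈-[1⋯]⁻ k∈)))) (subst (0ℤ ≤_) z≡ z≥0))))
    ... | no z≱0 = trans (cong (_-_ 1ℤ) (θ-no (subst (0ℤ ≤_) (e₁ z) (pos (ℤ.≰⇒> z≱0))))) (sym
            (trans (∑-single ([1⋯]-unique (ℓ p)) _ (∈-[1⋯]⁺ 1≤ ≤ℓ)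
                     (λ k _ k≢ → cong (_* 1ℤ) (δ-≢ λ z≡ → k≢ (ℤ.+-injective (ℤ.neg-injective (trans (sym z≡) z≡-))))))
                   (cong (_* 1ℤ) (δ-≡ z≡-))))
      where
      e₁ : ∀ z → 0ℤ - z - 1ℤ ≡ - z - 1ℤ
      e₁ = solve-∀
      e₂ : ∀ z → 0ℤ - z - 1ℤ ≡ - z - 0ℤ - 1ℤ
      e₂ = solve-∀
      e₃ : ∀ z l → z - - l ≡ l - - z
      e₃ = solve-∀
      -z>0 : 0ℤ < - z
      -z>0 = <-from (pos (ℤ.≰⇒> z≱0)) (e₂ z)
      +∣-z∣ : + ∣ - z ∣ ≡ - z
      +∣-z∣ = ℤ.0≤i⇒+∣i∣≡i (ℤ.<⇒≤ -z>0)
      z≡- : z ≡ - + ∣ - z ∣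
      z≡- = trans (sym (ℤ.neg-involutive z)) (cong -_ (sym +∣-z∣))
      1≤ : 1 ℕ.≤ ∣ - z ∣
      1≤ = ℤ.drop‿+<+ (subst (0ℤ <_) (sym +∣-z∣) -z>0)
      ≤ℓ : ∣ - z ∣ ℕ.≤ ℓ p
      ≤ℓ = ℤ.drop‿+≤+ (subst (_≤ + ℓ p) (sym +∣-z∣) (≤-from (nonneg z≥) (e₃ z (+ ℓ p))))
    excess : ∀ z → c z - (1ℤ - θ z) ≡ ∑[ i ← N ] (δ z (bead i) * 1ℤ) - ∑[ i ← N ] (δ z (- + i) * 1ℤ)
    excess z with z ℤ.<? - + ℓ p
    ... | no z≮  = cong₂ _-_ (c≡ z (ℤ.≮⇒≥ z≮)) (neg≡ z (ℤ.≮⇒≥ z≮))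
    ... | yes z< = trans (cong₂ (λ u v → u - (1ℤ - v)) (c-bead (low-bead z<)) (θ-no (subst (0ℤ ≤_) (e (+ ℓ p) z) (pos z< ⊕ +≤+ {0} {ℓ p} ℕ.z≤n))))
        (sym (cong₂ _-_ (∑-beads-none (λ k 1≤k k≤ → low-beads z< 1≤k k≤) one)
          (∑-zero N λ k k∈ → cong (_* 1ℤ) (δ-≢ (low-neg z< (proj₂ (∈-[1⋯]⁻ k∈)))))))
      where e : ∀ l z → (- l - z - 1ℤ) + l ≡ - z - 1ℤ
            e = solve-∀
    e₀ : ∀ k a b → k * (a * 1ℤ - b * 1ℤ) ≡ a * k - b * k
    e₀ = solve-∀
    eq : ∀ z → (c z - (1ℤ - θ z)) * φ z ≡ ∑[ i ← N ] (δ z (bead i) * φ (bead i) - δ z (- + i) * φ (- + i))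
    eq z = begin
      (c z - (1ℤ - θ z)) * φ z
        ≡⟨ cong (_* φ z) (trans (excess z) (sym (∑-- N (λ i → δ z (bead i) * 1ℤ) (λ i → δ z (- + i) * 1ℤ)))) ⟩
      ∑ N (λ i → δ z (bead i) * 1ℤ - δ z (- + i) * 1ℤ) * φ z
        ≡⟨ trans (ℤ.*-comm _ (φ z)) (sym (∑-*ˡ N (φ z) (λ i → δ z (bead i) * 1ℤ - δ z (- + i) * 1ℤ))) ⟩
      ∑ N (λ i → φ z * (δ z (bead i) * 1ℤ - δ z (- + i) * 1ℤ))
        ≡⟨ ∑-ext N (λ i → trans (e₀ (φ z) (δ z (bead i)) (δ z (- + i))) (cong₂ _-_ (δ-subst φ z (bead i)) (δ-subst φ z (- + i)))) ⟩
      ∑ N (λ i → δ z (bead i) * φ (bead i) - δ z (- + i) * φ (- + i)) ∎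

  -- A bead z above a hole z - g would be a box of hook length g.
  core-closed : ∀ {g} → 0 ℕ.< g → IsCore g p → ∀ z → IsBead z → IsBead (z - + g)
  core-closed {g} g>0 core z (i , 1≤i , z≡) = decidable-stable (isBead? (z - + g)) λ ¬B →
      let j , 1≤j , eq = not-bead-hole ¬B in no-box j 1≤j eq
    where
    e : ∀ z g → z - (z - g) ≡ g
    e = solve-∀
    e′ : ∀ z g → (z - g - z - 1ℤ) + (g - 0ℤ - 1ℤ) + 1ℤ ≡ -1ℤ
    e′ = solve-∀
    no-box : ∀ j → 1 ℕ.≤ j → z - + g ≡ hole j → ⊥
    no-box j 1≤j eq = core (i , j) (∈-boxes⁺ 1≤i 1≤j j≤) (ℕ.∣-reflexive (sym (cong ∣_∣ hook≡g)))
      where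
      hook≡g : hook p (i , j) ≡ + g
      hook≡g = trans (hook-bead-hole i j) (trans (cong₂ _-_ (sym z≡) (sym eq)) (e z (+ g)))
      j≤ : j ℕ.≤ part p i
      j≤ = ℕ.≮⇒≥ λ part<j → absurd
        (pos (subst₂ _<_ (sym z≡) (sym eq) (bead<hole 1≤i 1≤j (ℕ.<⇒≱ part<j))) ⊕ pos (+<+ g>0) ⊕ +≤+ {0} {1} ℕ.z≤n) (e′ z (+ g))

  -- Antisymmetry of doubled distinct partitions.

  module DoubledDistinct (dd : DD p) where
    ≤durfee : ∀ {i} → 1 ℕ.≤ i → i ℕ.≤ part p i → i ℕ.≤ durfee p
    ≤durfee {i} 1≤i i≤ = All.lookup (Extrema.xs≤max 0 (filter (λ s → s ℕ.≤? part p s) [1⋯ ℓ p ]))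
      (∈.∈-filter⁺ (λ s → s ℕ.≤? part p s) (∈-[1⋯]⁺ 1≤i (ℕ.≤-trans (conj⁺ 1≤i 1≤i i≤) (conj≤ℓ i))) i≤)

    -- This is the condition `DD` rewritten in positions; by `≤durfee` it is available for every row
    -- that meets the diagonal.
    mirror : ∀ {i} → 1 ℕ.≤ i → i ℕ.≤ part p i → hole i ≡ - bead i
    mirror {i} 1≤i i≤ = trans (e (+ conj p i) (+ i)) (cong (λ k → - (k - + i)) (cong +_ (sym (dd i 1≤i (≤durfee 1≤i i≤)))))
      where e : ∀ c i → i - 1ℤ - c ≡ - (1ℤ + c - i)
            e = solve-∀

    nonneg-bead : ∀ {i} → 0ℤ ≤ bead i → i ℕ.≤ part p i
    nonneg-bead h = ℤ.drop‿+≤+ (ℤ.0≤i-j⇒j≤i h)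

    no-bead-at-0 : ¬ IsBead 0ℤ
    no-bead-at-0 (i , 1≤i , eq) = hole-not-bead 1≤i (i , 1≤i , trans (mirror 1≤i (nonneg-bead (ℤ.≤-reflexive eq))) (trans (cong -_ (sym eq)) eq))

    bead⇒mirror-hole : ∀ {z} → 0ℤ < z → IsBead z → ¬ IsBead (- z)
    bead⇒mirror-hole z>0 (i , 1≤i , refl) B = hole-not-bead 1≤i (subst IsBead (sym (mirror 1≤i (nonneg-bead (ℤ.<⇒≤ z>0)))) B)

    -- A hole j at a negative position has j ≤ λ′ⱼ, hence j ≤ λⱼ, and `mirror` applies to row j.
    hole⇒mirror-bead : ∀ {z} → 0ℤ < z → ¬ IsBead (- z) → IsBead z
    hole⇒mirror-bead {z} z>0 ¬B with not-bead-hole ¬B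
    ... | j , 1≤j , eq = j , 1≤j , (begin
        z           ≡⟨ sym (ℤ.neg-involutive z) ⟩
        - - z       ≡⟨ cong -_ (trans eq (mirror 1≤j j≤)) ⟩
        - - bead j  ≡⟨ ℤ.neg-involutive (bead j) ⟩
        bead j      ∎)
      where
      open ≡-Reasoning
      e : ∀ j c → - (j - 1ℤ - c) - 0ℤ - 1ℤ ≡ c - j
      e = solve-∀
      j≤ : j ℕ.≤ part p j
      j≤ = conj⁻ 1≤j (ℤ.drop‿+≤+ (≤-from (pos z>0)
        (trans (cong (λ u → u - 0ℤ - 1ℤ) (trans (sym (ℤ.neg-involutive z)) (cong -_ eq))) (e (+ j) (+ conj p j)))))

    c-mirror : ∀ {z} → 0ℤ < z → c z + c (- z) ≡ 1ℤ
    c-mirror {z} z>0 with isBead? z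
    ... | yes B = cong₂ _+_ (c-bead B) (c-hole (bead⇒mirror-hole z>0 B))
    ... | no ¬B with isBead? (- z)
    ... | yes B′ = cong₂ _+_ (c-hole ¬B) (c-bead B′)
    ... | no ¬B′ = ⊥-elim (¬B (hole⇒mirror-bead z>0 ¬B′))

    c-symm : ∀ z → c z + c (- z) ≡ 1ℤ - δ z 0ℤ
    c-symm z with ℤ.<-cmp z 0ℤ
    ... | tri≈ _ refl _ = trans (cong₂ _+_ (c-hole no-bead-at-0) (c-hole no-bead-at-0)) (sym (cong (_-_ 1ℤ) (δ-≡ refl)))
    ... | tri> _ z≢0 z>0 = trans (c-mirror z>0) (sym (cong (_-_ 1ℤ) (δ-≢ z≢0)))
    ... | tri< z<0 z≢0 _ = trans (ℤ.+-comm (c z) (c (- z))) (trans (cong (_+_ (c (- z))) (cong c (sym (ℤ.neg-involutive z))))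
        (trans (c-mirror (ℤ.neg-mono-< z<0)) (sym (cong (_-_ 1ℤ) (δ-≢ z≢0)))))

    beads : Beads c
    beads = record
      { extent = ℓ p ℕ.+ part p 1
      ; below  = λ x x< → c-bead (low-bead (ℤ.<-≤-trans x< (ℤ.neg-mono-≤ (+≤+ (ℕ.m≤m+n (ℓ p) (part p 1))))))
      ; above  = λ x <x → c-hole λ (i , 1≤i , x≡) → absurd
          (pos (ℤ.≤-<-trans (+≤+ (ℕ.m≤n+m (part p 1) (ℓ p))) <x) ⊕ nonneg (+≤+ (part-antitone ℕ.≤-refl 1≤i)) ⊕ +≤+ {0} {i} ℕ.z≤n)
          (trans (cong (λ u → (u - + part p 1 - 1ℤ) + (+ part p 1 - + part p i) + + i) x≡) (e (+ part p 1) (+ part p i) (+ i)))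
      ; idem   = idem
      ; symm   = c-symm
      }
      where
      e : ∀ a b i → (b - i - a - 1ℤ) + (a - b) + i ≡ -1ℤ
      e = solve-∀
      idem : ∀ x → c x * c x ≡ c x
      idem x with isBead? x
      ... | yes B = trans (cong₂ _*_ (c-bead B) (c-bead B)) (sym (c-bead B))
      ... | no ¬B = trans (cong₂ _*_ (c-hole ¬B) (c-hole ¬B)) (sym (c-hole ¬B))

    module _ {i j} (1≤i : 1 ℕ.≤ i) (1≤j : 1 ℕ.≤ j) (j≤ : j ℕ.≤ part p i) where
      -- For i ≤ j row i meets the diagonal, so bead i = - hole i and monotonicity of the holes
      -- decides the sign. In `lower-box` row j meets the diagonal instead, and the beads are
      -- compared.
      upper-box : i ℕ.≤ j → 0ℤ ≤ bead i + hole j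
      upper-box i≤j = subst (0ℤ ≤_) (trans (cong (_-_ (hole j)) (mirror 1≤i (ℕ.≤-trans i≤j j≤))) (e (bead i) (hole j)))
          (nonneg (hole-mono (ℕ.m≤n⇒m<n∨m≡n i≤j)))
        where
        e : ∀ x y → y - - x ≡ x + y
        e = solve-∀
        hole-mono : i ℕ.< j ⊎ i ≡ j → hole i ≤ hole j
        hole-mono (inj₁ i<j)  = ℤ.<⇒≤ (hole-increasing 1≤i i<j)
        hole-mono (inj₂ refl) = ℤ.≤-refl

      lower-box : j ℕ.< i → 0ℤ ≤ - (bead i + hole j) - 1ℤ
      lower-box j<i = subst (0ℤ ≤_) (trans (e (bead i) (bead j)) (cong (λ y → - (bead i + y) - 1ℤ) (sym (mirror 1≤j (conj⁻ 1≤j (ℕ.≤-trans (ℕ.<⇒≤ j<i) (conj⁺ 1≤i 1≤j j≤)))))))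
          (pos (bead-decreasing 1≤j j<i))
        where e : ∀ x y → y - x - 1ℤ ≡ - (x + - y) - 1ℤ
              e = solve-∀

      θ-ε : θ (bead i + hole j) ≡ I (ε (i , j) ℤ.≟ 1ℤ) × 1ℤ - θ (bead i + hole j) ≡ I (ε (i , j) ℤ.≟ -1ℤ)
      θ-ε = by-side (j ℕ.<? i)
        where
        agree : ∀ {h e} → θ h ≡ I (e ℤ.≟ 1ℤ) → 1ℤ - I (e ℤ.≟ 1ℤ) ≡ I (e ℤ.≟ -1ℤ) → ε (i , j) ≡ e →
                θ h ≡ I (ε (i , j) ℤ.≟ 1ℤ) × 1ℤ - θ h ≡ I (ε (i , j) ℤ.≟ -1ℤ)
        agree p q refl = p , trans (cong (_-_ 1ℤ) p) q
        by-side : Dec (j ℕ.< i) → θ (bead i + hole j) ≡ I (ε (i , j) ℤ.≟ 1ℤ) × 1ℤ - θ (bead i + hole j) ≡ I (ε (i , j) ℤ.≟ -1ℤ)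
        by-side (yes j<i) = agree {e = -1ℤ} (θ-no (lower-box j<i)) refl (cong (if_then -1ℤ else 1ℤ) (dec-true (j ℕ.<? i) j<i))
        by-side (no j≮i)  = agree {e = 1ℤ} (θ-yes (upper-box (ℕ.≮⇒≥ j≮i))) refl (cong (if_then -1ℤ else 1ℤ) (dec-false (j ℕ.<? i) j≮i))

    hooks⁺ hooks⁻ : ℤ → ℤ
    hooks⁺ m = ∑[ s ← boxes p ] (δ (hook p s) m * I (ε s ℤ.≟ 1ℤ))
    hooks⁻ m = ∑[ s ← boxes p ] (δ (hook p s) m * I (ε s ℤ.≟ -1ℤ))

    hook-positive : ∀ s → s ∈ boxes p → 0ℤ < hook p s
    hook-positive (i , j) s∈ = let 1≤i , 1≤j , j≤ = ∈-boxes⁻ s∈ in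
      subst (0ℤ <_) (sym (hook-bead-hole i j)) (<-from (pos (hole<bead 1≤i 1≤j j≤)) (e (bead i) (hole j)))
      where e : ∀ x y → x - y - 1ℤ ≡ x - y - 0ℤ - 1ℤ
            e = solve-∀

    hooks⁺≡A⁺ : ∀ m → 0ℤ < m → hooks⁺ m ≡ A⁺ beads m
    hooks⁺≡A⁺ m m>0 = trans (∑-cong (boxes p) λ (i , j) s∈ → let 1≤i , 1≤j , j≤ = ∈-boxes⁻ s∈ in
        cong (_*_ (δ (hook p (i , j)) m)) (sym (proj₁ (θ-ε 1≤i 1≤j j≤))))
      (unique (hasSum-hooks m m>0 θ) (proj₂ (plusSum beads m)))

    hooks⁻≡A⁻ : ∀ m → 0ℤ < m → hooks⁻ m ≡ A⁻ beads m
    hooks⁻≡A⁻ m m>0 = trans (∑-cong (boxes p) λ (i , j) s∈ → let 1≤i , 1≤j , j≤ = ∈-boxes⁻ s∈ in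
        cong (_*_ (δ (hook p (i , j)) m)) (sym (proj₂ (θ-ε 1≤i 1≤j j≤))))
      (unique (hasSum-hooks m m>0 (λ z → 1ℤ - θ z)) (proj₂ (minusSum beads m)))

    hooks-nonpositive : ∀ {m} → m ≤ 0ℤ → hooks⁺ m ≡ 0ℤ × hooks⁻ m ≡ 0ℤ
    hooks-nonpositive {m} m≤0 =
      ∑-zero (boxes p) (λ s s∈ → cong (_* I (ε s ℤ.≟ 1ℤ)) (δ-≢ (hook≢ s s∈))) ,
      ∑-zero (boxes p) (λ s s∈ → cong (_* I (ε s ℤ.≟ -1ℤ)) (δ-≢ (hook≢ s s∈)))
      where
      hook≢ : ∀ s → s ∈ boxes p → ¬ hook p s ≡ m
      hook≢ s s∈ refl = ℤ.<⇒≱ (hook-positive s s∈) m≤0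

-- Sums over initial indices and thresholds of decreasing sequences.

∑ᶠ-suc : ∀ {n} (f : Fin (suc n) → ℤ) → ∑ᶠ f ≡ f Fin.zero + ∑ᶠ (f ∘ Fin.suc)
∑ᶠ-suc {n} f = cong (_+_ (f Fin.zero))
  (trans (cong (λ xs → ∑ xs f) (sym (List.map-tabulate id Fin.suc))) (∑-map Fin.suc (allFin n) f))

∑ᶠ-inject≤ : ∀ {m n} (m≤n : m ℕ.≤ n) (f : Fin n → ℤ) → (∀ a → m ℕ.≤ toℕ a → f a ≡ 0ℤ) →
             ∑ᶠ f ≡ ∑ᶠ (λ i → f (inject≤ i m≤n))
∑ᶠ-inject≤ {zero}  {n}     m≤n       f h = ∑-zero (allFin n) (λ a _ → h a ℕ.z≤n)
∑ᶠ-inject≤ {suc m} {suc n} (ℕ.s≤s l) f h = trans (∑ᶠ-suc f)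
  (trans (cong (_+_ (f Fin.zero)) (∑ᶠ-inject≤ l (f ∘ Fin.suc) (λ a m≤a → h (Fin.suc a) (ℕ.s≤s m≤a))))
         (sym (∑ᶠ-suc (λ i → f (inject≤ i (ℕ.s≤s l))))))

∑ᶠ-1 : ∀ n → ∑ᶠ {n} (λ _ → 1ℤ) ≡ + n
∑ᶠ-1 zero    = refl
∑ᶠ-1 (suc n) = trans (∑ᶠ-suc {n} (λ _ → 1ℤ)) (cong (_+_ 1ℤ) (∑ᶠ-1 n))

∑ᶠ-initial : ∀ {n k} → k ℕ.≤ n → ∑ᶠ {n} (λ a → I (toℕ a ℕ.<? k)) ≡ + k
∑ᶠ-initial {n} {k} k≤n = trans
  (∑ᶠ-inject≤ k≤n (λ a → I (toℕ a ℕ.<? k)) (λ a k≤a → I-no (toℕ a ℕ.<? k) (ℕ.≤⇒≯ k≤a)))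
  (trans (∑-ext (allFin k) λ i → I-yes (toℕ (inject≤ i k≤n) ℕ.<? k)
            (subst (ℕ._< k) (sym (Fin.toℕ-inject≤ i k≤n)) (Fin.toℕ<n i)))
         (∑ᶠ-1 k))

∑-mono : ∀ {A : Set} (xs : List A) (f g : A → ℤ) → (∀ x → f x ≤ g x) → ∑ xs f ≤ ∑ xs g
∑-mono xs f g h = ℤ.0≤i-j⇒j≤i (subst (0ℤ ≤_) (∑-- xs g f) (∑-nonneg xs (λ x → nonneg (h x))))

θ-nonneg : ∀ z → 0ℤ ≤ θ z
θ-nonneg z with 0ℤ ℤ.≤? z
... | yes p = subst (0ℤ ≤_) (sym (θ-yes p)) (+≤+ ℕ.z≤n)
... | no p = subst (0ℤ ≤_) (sym (θ-no (subst (0ℤ ≤_) (e z) (pos (ℤ.≰⇒> p))))) (+≤+ ℕ.z≤n)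
  where e : ∀ z → 0ℤ - z - 1ℤ ≡ - z - 1ℤ
        e = solve-∀

θ-≤1 : ∀ z → θ z ≤ 1ℤ
θ-≤1 z with 0ℤ ℤ.≤? z
... | yes p = ℤ.≤-reflexive (θ-yes p)
... | no p = subst (_≤ 1ℤ) (sym (θ-no (subst (0ℤ ≤_) (e z) (pos (ℤ.≰⇒> p))))) (+≤+ ℕ.z≤n)
  where e : ∀ z → 0ℤ - z - 1ℤ ≡ - z - 1ℤ
        e = solve-∀

θ-suc : ∀ z → θ z ≡ δ z 0ℤ + θ (z - 1ℤ)
θ-suc z with ℤ.<-cmp z 0ℤ
... | tri< z<0 z≢0 _ = trans (θ-no (subst (0ℤ ≤_) (e₁ z) (pos z<0)))
    (sym (cong₂ _+_ (δ-≢ z≢0) (θ-no (subst (0ℤ ≤_) (e₂ z) (pos z<0 ⊕ +≤+ {0} {1} ℕ.z≤n)))))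
  where e₁ : ∀ z → 0ℤ - z - 1ℤ ≡ - z - 1ℤ
        e₁ = solve-∀
        e₂ : ∀ z → 0ℤ - z - 1ℤ + 1ℤ ≡ - (z - 1ℤ) - 1ℤ
        e₂ = solve-∀
... | tri≈ _ refl _ = trans (θ-yes ℤ.≤-refl) (sym (cong₂ _+_ (δ-≡ refl) (θ-no ℤ.≤-refl)))
... | tri> _ z≢0 z>0 = trans (θ-yes (ℤ.<⇒≤ z>0))
    (sym (cong₂ _+_ (δ-≢ z≢0) (θ-yes (subst (0ℤ ≤_) (e z) (pos z>0)))))
  where e : ∀ z → z - 0ℤ - 1ℤ ≡ z - 1ℤ
        e = solve-∀

θ-neg-1 : ∀ z → θ (- z - 1ℤ) ≡ 1ℤ - θ z
θ-neg-1 z = begin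
  θ (- z - 1ℤ)                                    ≡⟨ e₁ (δ (- z) 0ℤ) (θ (- z - 1ℤ)) ⟩
  (δ (- z) 0ℤ + θ (- z - 1ℤ)) - δ (- z) 0ℤ        ≡⟨ cong₂ _-_ (sym (θ-suc (- z))) (δ-flip (- z) 0ℤ z 0ℤ (e₂ z)) ⟩
  θ (- z) - δ z 0ℤ                                ≡⟨ cong (_- δ z 0ℤ) (θ-neg z) ⟩
  1ℤ + δ z 0ℤ - θ z - δ z 0ℤ                      ≡⟨ e₃ (δ z 0ℤ) (θ z) ⟩
  1ℤ - θ z                                        ∎
  where
  open ≡-Reasoning
  e₁ : ∀ d t → t ≡ (d + t) - d
  e₁ = solve-∀
  e₂ : ∀ z → - z - 0ℤ ≡ 0ℤ - z
  e₂ = solve-∀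
  e₃ : ∀ d t → 1ℤ + d - t - d ≡ 1ℤ - t
  e₃ = solve-∀

module _ {n m : ℕ} (s : Fin n → ℤ) (s-decreasing : ∀ a b → a Fin.< b → s b < s a) (T : ℤ)
         (m≤n : m ℕ.≤ n) (count : ∑ᶠ (λ a → θ (s a - T - 1ℤ)) ≡ + m) where

  private
    s-antitone : ∀ a b → toℕ a ℕ.≤ toℕ b → s b ≤ s a
    s-antitone a b a≤b with toℕ a ℕ.<? toℕ b
    ... | yes a<b = ℤ.<⇒≤ (s-decreasing a b a<b)
    ... | no a≮b  = ℤ.≤-reflexive (cong s (Fin.toℕ-injective (ℕ.≤-antisym (ℕ.≮⇒≥ a≮b) a≤b)))

  -- If s a ≤ T, only indices before a can exceed T, and the count m would be at most a.
  -- `late-bounded` is the opposite estimate.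
  early-exceed : ∀ a → toℕ a ℕ.< m → T < s a
  early-exceed a a<m with T ℤ.<? s a
  ... | yes T<s = T<s
  ... | no T≮s  = ⊥-elim (ℕ.<⇒≱ a<m (ℤ.drop‿+≤+ (subst₂ _≤_ count (∑ᶠ-initial (ℕ.<⇒≤ (Fin.toℕ<n a)))
        (∑-mono (allFin n) _ _ bound))))
    where
    e : ∀ s s′ t → (s - s′) + (t - s) ≡ - (s′ - t - 1ℤ) - 1ℤ
    e = solve-∀
    bound : ∀ b → θ (s b - T - 1ℤ) ≤ I (toℕ b ℕ.<? toℕ a)
    bound b with toℕ b ℕ.<? toℕ a
    ... | yes _  = θ-≤1 _
    ... | no b≮a = ℤ.≤-reflexive (θ-no (subst (0ℤ ≤_) (e (s a) (s b) T)
        (nonneg (s-antitone a b (ℕ.≮⇒≥ b≮a)) ⊕ nonneg (ℤ.≮⇒≥ T≮s))))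

  late-bounded : ∀ a → m ℕ.≤ toℕ a → s a ≤ T
  late-bounded a m≤a with s a ℤ.≤? T
  ... | yes s≤T = s≤T
  ... | no s≰T  = ⊥-elim (ℕ.<⇒≱ (ℕ.s≤s m≤a) (ℤ.drop‿+≤+ (subst₂ _≤_ (∑ᶠ-initial {k = suc (toℕ a)} (Fin.toℕ<n a)) count
        (∑-mono (allFin n) _ _ bound))))
    where
    e : ∀ s s′ t → (s′ - s) + (s - t - 1ℤ) ≡ s′ - t - 1ℤ
    e = solve-∀
    bound : ∀ b → I (toℕ b ℕ.<? suc (toℕ a)) ≤ θ (s b - T - 1ℤ)
    bound b with toℕ b ℕ.<? suc (toℕ a)
    ... | no _    = θ-nonneg _
    ... | yes b≤a = ℤ.≤-reflexive (sym (θ-yes (subst (0ℤ ≤_) (e (s a) (s b) T)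
        (nonneg (s-antitone b a (ℕ.≤-pred b≤a)) ⊕ pos (ℤ.≰⇒> s≰T)))))

-- Runners of the abacus and the V-coding.

module _ {g : ℕ} (g>0 : 0 ℕ.< g) where
  private
    instance
      g≢0 : ℕ.NonZero g
      g≢0 = ℕ.>-nonZero g>0

  multiple≥ : ∀ k → 0ℤ < k → + g ≤ k * + g
  multiple≥ k k>0 = subst (_≤ k * + g) (ℤ.*-identityˡ (+ g)) (ℤ.*-monoʳ-≤-nonNeg (+ g) (ℤ.i<j⇒suc[i]≤j k>0))

  residue : ∀ x → ∃[ a ] + g ℤ.∣ (x - + toℕ {g} a)
  residue x = fromℕ< (n%ℕd<d x g) , ∣⇒∣ᵤ (divides (x /ℕ g)
    (trans (cong₂ (λ u v → u - + v) (a≡a%ℕn+[a/ℕn]*n x g) (Fin.toℕ-fromℕ< (n%ℕd<d x g))) (e (+ (x %ℕ g)) ((x /ℕ g) * + g))))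
    where e : ∀ a b → a + b - a ≡ b
          e = solve-∀

  residue-unique : ∀ {x} {a b : Fin g} → + g ℤ.∣ (x - + toℕ a) → + g ℤ.∣ (x - + toℕ b) → a ≡ b
  residue-unique {x} {a} {b} p q with ∣ᵤ⇒∣ {+ g} {x - + toℕ a} p | ∣ᵤ⇒∣ {+ g} {x - + toℕ b} q
  ... | divides k eq | divides l eq′ with ℤ.<-cmp (l - k) 0ℤ
  ... | tri≈ _ l≡k _ = Fin.toℕ-injective (ℤ.+-injective (x-y≡0⇒x≡y (+ toℕ a) (+ toℕ b) {z = (l - k) * + g} (cong (_* + g) l≡k)
        (trans (e₁ l k (+ g)) (trans (cong₂ _-_ (sym eq′) (sym eq)) (e₂ x (+ toℕ a) (+ toℕ b))))))
    where
    e₁ : ∀ l k g → (l - k) * g ≡ l * g - k * g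
    e₁ = solve-∀
    e₂ : ∀ x a b → (x - b) - (x - a) ≡ a - b
    e₂ = solve-∀
  ... | tri> _ _ l>k = ⊥-elim (absurd (nonneg (multiple≥ (l - k) l>k) ⊕ pos (+<+ (Fin.toℕ<n a)) ⊕ +≤+ {0} {toℕ b} ℕ.z≤n)
        (trans (cong (λ u → u - + g + (+ g - + toℕ a - 1ℤ) + + toℕ b) (trans (e₁ l k (+ g)) (cong₂ _-_ (sym eq′) (sym eq)))) (e₂ x (+ toℕ a) (+ toℕ b) (+ g))))
    where
    e₁ : ∀ l k g → (l - k) * g ≡ l * g - k * g
    e₁ = solve-∀
    e₂ : ∀ x a b g → (x - b) - (x - a) - g + (g - a - 1ℤ) + b ≡ -1ℤ
    e₂ = solve-∀
  ... | tri< l<k _ _ = ⊥-elim (absurd (nonneg (multiple≥ (- (l - k)) (ℤ.neg-mono-< l<k)) ⊕ pos (+<+ (Fin.toℕ<n b)) ⊕ +≤+ {0} {toℕ a} ℕ.z≤n)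
        (trans (cong (λ u → u - + g + (+ g - + toℕ b - 1ℤ) + + toℕ a) (trans (e₁ l k (+ g)) (cong₂ _-_ (sym eq) (sym eq′)))) (e₂ x (+ toℕ a) (+ toℕ b) (+ g))))
    where
    e₁ : ∀ l k g → (- (l - k)) * g ≡ k * g - l * g
    e₁ = solve-∀
    e₂ : ∀ x a b g → (x - a) - (x - b) - g + (g - b - 1ℤ) + a ≡ -1ℤ
    e₂ = solve-∀

  module _ {p : Partition} (core : IsCore g p) where
    descend : ∀ {z} → IsBead p z → ∀ n → IsBead p (z - + n * + g)
    descend {z} B zero    = subst (IsBead p) (e z (+ g)) B
      where e : ∀ z g → z ≡ z - 0ℤ * g
            e = solve-∀
    descend {z} B (suc n) = subst (IsBead p) (e z (+ n) (+ g)) (core-closed p g>0 core _ (descend B n))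
      where e : ∀ z n g → z - n * g - g ≡ z - (1ℤ + n) * g
            e = solve-∀

    -- On runner a the beads of a core are m, m - g, m - 2g and so on. Since x - m = (k - l) g,
    -- comparing k - l with 1 places x before, at or after the first gap g + m.
    first-gap : ∀ {x a m} → + g ℤ.∣ (x - + toℕ {g} a) → IsMaximum (Residual g p a) m →
                c p (x - + g) - c p x ≡ δ x (+ g + m)
    first-gap {x} {a} {m} x≡a ((j , 1≤j , m≡ , m≡a) , ≤m) with ∣ᵤ⇒∣ {+ g} {x - + toℕ a} x≡a | ∣ᵤ⇒∣ {+ g} {m - + toℕ a} m≡a
    ... | divides k eq | divides l eq′ with ℤ.<-cmp (k - l) 1ℤ
    ... | tri≈ _ k-l≡1 _ = trans (cong₂ _-_ (c-bead p (j , 1≤j , trans x-g≡m m≡)) (c-hole p x∉)) (sym (δ-≡ x≡))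
      where
      e₁ : ∀ x m a → (x - a) - (m - a) + m ≡ x
      e₁ = solve-∀
      e₂ : ∀ k l g m → k * g - l * g + m ≡ (k - l) * g + m
      e₂ = solve-∀
      e₃ : ∀ g m → g + m - g ≡ m
      e₃ = solve-∀
      e₄ : ∀ g m → (m - (g + m)) + (g - 0ℤ - 1ℤ) ≡ -1ℤ
      e₄ = solve-∀
      x≡ : x ≡ + g + m
      x≡ = trans (sym (e₁ x m (+ toℕ a))) (trans (cong₂ (λ u v → u - v + m) eq eq′) (trans (e₂ k l (+ g) m)
             (trans (cong (λ u → u * + g + m) k-l≡1) (cong (_+ m) (ℤ.*-identityˡ (+ g))))))
      x-g≡m : x - + g ≡ m
      x-g≡m = trans (cong (_- + g) x≡) (e₃ (+ g) m)
      x∉ : ¬ IsBead p x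
      x∉ (i , 1≤i , x≡′) = absurd (nonneg (subst (_≤ m) x≡ (≤m x (i , 1≤i , x≡′ , x≡a))) ⊕ pos (+<+ g>0)) (e₄ (+ g) m)
    ... | tri< k-l<1 _ _ = trans (cong₂ _-_ (c-bead p x-g∈) (c-bead p x∈)) (sym (δ-≢ x≢))
      where
      n : ℕ
      n = ∣ l - k ∣
      e₀ : ∀ k l → 1ℤ - (k - l) - 1ℤ ≡ l - k
      e₀ = solve-∀
      e₁ : ∀ x m a → m - ((m - a) - (x - a)) ≡ x
      e₁ = solve-∀
      e₂ : ∀ k l g → l * g - k * g ≡ (l - k) * g
      e₂ = solve-∀
      e₄ : ∀ g m → (m - (g + m)) + (g - 0ℤ - 1ℤ) ≡ -1ℤ
      e₄ = solve-∀
      +n : + n ≡ l - k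
      +n = ℤ.0≤i⇒+∣i∣≡i (subst (0ℤ ≤_) (e₀ k l) (pos k-l<1))
      x∈ : IsBead p x
      x∈ = subst (IsBead p) (trans (cong (_-_ m) (trans (cong (_* + g) +n) (trans (sym (e₂ k l (+ g))) (cong₂ _-_ (sym eq′) (sym eq))))) (e₁ x m (+ toℕ a)))
             (descend (j , 1≤j , m≡) n)
      x-g∈ : IsBead p (x - + g)
      x-g∈ = core-closed p g>0 core x x∈
      x≢ : ¬ x ≡ + g + m
      x≢ refl = let i , 1≤i , x≡′ = x∈ in absurd (nonneg (≤m x (i , 1≤i , x≡′ , x≡a)) ⊕ pos (+<+ g>0)) (e₄ (+ g) m)
    ... | tri> _ _ k-l>1 = trans (cong₂ _-_ (c-hole p (beyond (pos x-g>m) refl x-g≡a)) (c-hole p (beyond (pos x-g>m ⊕ +≤+ {0} {g} ℕ.z≤n) (e₆ x m (+ g)) x≡a))) (sym (δ-≢ x≢))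
      where
      e₁ : ∀ k l → k - l - 1ℤ - 1ℤ ≡ k - l - 1ℤ - 0ℤ - 1ℤ
      e₁ = solve-∀
      e₂ : ∀ g k l → (k - l - 1ℤ) * g ≡ k * g - l * g - g
      e₂ = solve-∀
      e₃ : ∀ x m a g → ((x - a) - (m - a) - g - g) + (g - 0ℤ - 1ℤ) ≡ x - g - m - 1ℤ
      e₃ = solve-∀
      e₄ : ∀ x a g → x - a - g ≡ x - g - a
      e₄ = solve-∀
      e₅ : ∀ k g → k * g - g ≡ (k - 1ℤ) * g
      e₅ = solve-∀
      e₆ : ∀ x m g → x - g - m - 1ℤ + g ≡ x - m - 1ℤ
      e₆ = solve-∀
      e₇ : ∀ g m → g + m - g - m - 1ℤ ≡ -1ℤ
      e₇ = solve-∀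
      x-g>m : m < x - + g
      x-g>m = <-from (nonneg (multiple≥ (k - l - 1ℤ) (<-from (pos k-l>1) (e₁ k l))) ⊕ pos (+<+ g>0))
        (trans (cong (λ u → u - + g + (+ g - 0ℤ - 1ℤ)) (trans (e₂ (+ g) k l) (cong₂ (λ u v → u - v - + g) (sym eq) (sym eq′))))
               (e₃ x m (+ toℕ a) (+ g)))
      x-g≡a : + g ℤ.∣ (x - + g - + toℕ a)
      x-g≡a = ∣⇒∣ᵤ (divides (k - 1ℤ) (trans (sym (e₄ x (+ toℕ a) (+ g))) (trans (cong (_- + g) eq) (e₅ k (+ g)))))
      beyond : ∀ {y z} → 0ℤ ≤ z → z ≡ y - m - 1ℤ → + g ℤ.∣ (y - + toℕ a) → ¬ IsBead p y
      beyond {y} 0≤z eq y≡a (i , 1≤i , y≡) = ℤ.<⇒≱ (<-from 0≤z eq) (≤m y (i , 1≤i , y≡ , y≡a))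
      x≢ : ¬ x ≡ + g + m
      x≢ refl = absurd (pos x-g>m) (e₇ (+ g) m)

    -- Only the runner of x contributes to the sum. Listing the runners through σ changes nothing in
    -- the sum and makes its terms decreasing.
    first-gaps : ∀ {t v} (V : IsVCoding g t p v) → let open IsVCoding V in
                 ∀ x → c p (x - + g) - c p x ≡ ∑ᶠ (λ a → δ x (β (σ ⟨$⟩ʳ a)))
    first-gaps V x = trans (trans (first-gap x≡a max) (cong (δ x) (sym β≡)))
        (sym (trans (∑-single (Unique.allFin⁺ g) _ (∈.∈-allFin (σ ⟨$⟩ˡ a₀)) other) (cong (λ a → δ x (β a)) (inverseʳ σ))))
      where
      open IsVCoding V
      a₀ : Fin g
      a₀ = proj₁ (residue x)
      x≡a : + g ℤ.∣ (x - + toℕ a₀)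
      x≡a = proj₂ (residue x)
      max : IsMaximum (Residual g p a₀) (proj₁ (β-max a₀))
      max = proj₁ (proj₂ (β-max a₀))
      β≡ : β a₀ ≡ + g + proj₁ (β-max a₀)
      β≡ = proj₂ (proj₂ (β-max a₀))
      e : ∀ m g a → g + m - a ≡ (m - a) + g
      e = solve-∀
      e′ : ∀ k g → k * g + g ≡ (k + 1ℤ) * g
      e′ = solve-∀
      β-residue : ∀ a → + g ℤ.∣ (β a - + toℕ a)
      β-residue a with β-max a
      ... | m , ((_ , _ , _ , m≡a) , _) , eq with ∣ᵤ⇒∣ {+ g} {m - + toℕ a} m≡a
      ... | divides k eq′ = ∣⇒∣ᵤ (divides (k + 1ℤ) (trans (cong (_- + toℕ a) eq) (trans (e m (+ g) (+ toℕ a)) (trans (cong (_+ + g) eq′) (e′ k (+ g))))))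
      other : ∀ a → a ∈ allFin g → ¬ a ≡ σ ⟨$⟩ˡ a₀ → δ x (β (σ ⟨$⟩ʳ a)) ≡ 0ℤ
      other a _ a≢ = δ-≢ λ x≡ → a≢ (trans (sym (inverseˡ σ)) (cong (σ ⟨$⟩ˡ_)
        (residue-unique {x} (subst (λ y → + g ℤ.∣ (y - + toℕ (σ ⟨$⟩ʳ a))) (sym x≡) (β-residue (σ ⟨$⟩ʳ a))) x≡a)))

-- The empty partition

ρ : ∀ t → Fin t → ℤ
ρ t i = + t - + toℕ i

c₀ : ℤ → ℤ
c₀ x = 1ℤ - θ x

∑δ-interval : ∀ t x → ∑ᶠ {t} (λ i → δ x (+ toℕ i)) ≡ θ x - θ (x - + t)
∑δ-interval zero    x = sym (trans (cong (λ z → θ x - θ z) (ℤ.+-identityʳ x)) (ℤ.+-inverseʳ (θ x)))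
∑δ-interval (suc t) x = begin
  ∑ᶠ {suc t} (λ i → δ x (+ toℕ i))
    ≡⟨ ∑ᶠ-suc {t} (λ i → δ x (+ toℕ i)) ⟩
  δ x 0ℤ + ∑ᶠ {t} (λ i → δ x (1ℤ + + toℕ i))
    ≡⟨ cong (_+_ (δ x 0ℤ)) (∑-ext (allFin t) λ i → δ-shift x (1ℤ + + toℕ i) (x - 1ℤ) (+ toℕ i) (e₁ x (+ toℕ i))) ⟩
  δ x 0ℤ + ∑ᶠ {t} (λ i → δ (x - 1ℤ) (+ toℕ i))
    ≡⟨ cong (_+_ (δ x 0ℤ)) (∑δ-interval t (x - 1ℤ)) ⟩
  δ x 0ℤ + (θ (x - 1ℤ) - θ (x - 1ℤ - + t))
    ≡⟨ sym (ℤ.+-assoc (δ x 0ℤ) (θ (x - 1ℤ)) _) ⟩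
  δ x 0ℤ + θ (x - 1ℤ) - θ (x - 1ℤ - + t)
    ≡⟨ cong₂ (λ u v → u - θ v) (sym (θ-suc x)) (e₂ x (+ t)) ⟩
  θ x - θ (x - (1ℤ + + t)) ∎
  where
  open ≡-Reasoning
  e₁ : ∀ x i → x - (1ℤ + i) ≡ x - 1ℤ - i
  e₁ = solve-∀
  e₂ : ∀ x t → x - 1ℤ - t ≡ x - (1ℤ + t)
  e₂ = solve-∀

-- `index` runs upwards and `ρ` downwards through 1, ..., t; each sum is the indicator of this
-- interval.
∑-index : ∀ t n → ∑ᶠ {t} (λ i → δ (index i) n) ≡ ∑ᶠ (λ i → δ (ρ t i) n)
∑-index t n = begin
  ∑ᶠ {t} (λ i → δ (index i) n)
    ≡⟨ ∑-ext (allFin t) (λ i → δ-flip (index i) n (n - 1ℤ) (+ toℕ i) (e₁ n (+ toℕ i))) ⟩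
  ∑ᶠ {t} (λ i → δ (n - 1ℤ) (+ toℕ i))
    ≡⟨ ∑δ-interval t (n - 1ℤ) ⟩
  θ (n - 1ℤ) - θ (n - 1ℤ - + t)
    ≡⟨ e₂ (θ (n - 1ℤ)) (θ (n - 1ℤ - + t)) ⟩
  (1ℤ - θ (n - 1ℤ - + t)) - (1ℤ - θ (n - 1ℤ))
    ≡⟨ cong₂ _-_ (sym (θ-neg-1 (n - 1ℤ - + t))) (sym (θ-neg-1 (n - 1ℤ))) ⟩
  θ (- (n - 1ℤ - + t) - 1ℤ) - θ (- (n - 1ℤ) - 1ℤ)
    ≡⟨ cong₂ (λ u w → θ u - θ w) (e₃ n (+ t)) (e₄ n (+ t)) ⟩
  θ (+ t - n) - θ (+ t - n - + t)
    ≡⟨ sym (∑δ-interval t (+ t - n)) ⟩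
  ∑ᶠ {t} (λ i → δ (+ t - n) (+ toℕ i))
    ≡⟨ ∑-ext (allFin t) (λ i → δ-shift (+ t - n) (+ toℕ i) (ρ t i) n (e₅ n (+ t) (+ toℕ i))) ⟩
  ∑ᶠ (λ i → δ (ρ t i) n) ∎
  where
  open ≡-Reasoning
  e₁ : ∀ n i → 1ℤ + i - n ≡ i - (n - 1ℤ)
  e₁ = solve-∀
  e₂ : ∀ a b → a - b ≡ (1ℤ - b) - (1ℤ - a)
  e₂ = solve-∀
  e₃ : ∀ n t → - (n - 1ℤ - t) - 1ℤ ≡ t - n
  e₃ = solve-∀
  e₄ : ∀ n t → - (n - 1ℤ) - 1ℤ ≡ t - n - t
  e₄ = solve-∀
  e₅ : ∀ n t i → t - n - i ≡ t - i - n
  e₅ = solve-∀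

beads₀ : Beads c₀
beads₀ = record
  { extent = 0
  ; below  = λ x x<0 → cong (_-_ 1ℤ) (θ-no (subst (0ℤ ≤_) (e₁ x) (pos x<0)))
  ; above  = λ x x>0 → cong (_-_ 1ℤ) (θ-yes (ℤ.<⇒≤ x>0))
  ; idem   = idem
  ; symm   = λ x → trans (cong (λ z → 1ℤ - θ x + (1ℤ - z)) (θ-neg x)) (e₂ (θ x) (δ x 0ℤ))
  }
  where
  e₁ : ∀ x → 0ℤ - x - 1ℤ ≡ - x - 1ℤ
  e₁ = solve-∀
  e₂ : ∀ t d → 1ℤ - t + (1ℤ - (1ℤ + d - t)) ≡ 1ℤ - d
  e₂ = solve-∀
  idem : ∀ x → c₀ x * c₀ x ≡ c₀ x
  idem x with 0ℤ ℤ.≤? x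
  ... | yes x≥0 = trans (cong (λ z → (1ℤ - z) * (1ℤ - z)) (θ-yes x≥0)) (sym (cong (_-_ 1ℤ) (θ-yes x≥0)))
  ... | no x≱0  = let θ≡0 = θ-no (subst (0ℤ ≤_) (e₁ x) (pos (ℤ.≰⇒> x≱0))) in
      trans (cong (λ z → (1ℤ - z) * (1ℤ - z)) θ≡0) (sym (cong (_-_ 1ℤ) θ≡0))

-- With r = ρ the gaps 0, T - rᵢ, T and T + rᵢ tile the interval from 0 to g - 1, which is the
-- difference of the half-lines below g and below 0.
coded₀ : ∀ t → Coded (+ suc t) (ρ t) c₀
coded₀ t = record
  { beads        = beads₀
  ; firstGaps    = firstGaps
  ; r-positive   = λ i → <-from (pos (+<+ (Fin.toℕ<n i))) (e₁ (+ t) (+ toℕ i))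
  ; r-decreasing = λ i j i<j → <-from (pos (+<+ i<j)) (e₂ (+ t) (+ toℕ i) (+ toℕ j))
  }
  where
  open ≡-Reasoning
  T = + suc t
  e₁ : ∀ t i → t - i - 1ℤ ≡ t - i - 0ℤ - 1ℤ
  e₁ = solve-∀
  e₂ : ∀ t i j → j - i - 1ℤ ≡ (t - i) - (t - j) - 1ℤ
  e₂ = solve-∀
  e₃ : ∀ x t i → x - ((1ℤ + t) + (t - i)) ≡ i - (t + t + 1ℤ - x)
  e₃ = solve-∀
  e₄ : ∀ x t i → x - ((1ℤ + t) - (t - i)) ≡ x - 1ℤ - i
  e₄ = solve-∀
  e₅ : ∀ x t → t + t + 1ℤ - x ≡ - (x - ((1ℤ + t) + (1ℤ + t))) - 1ℤ
  e₅ = solve-∀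
  e₆ : ∀ x t → t + t + 1ℤ - x - t ≡ - (x - (1ℤ + t))
  e₆ = solve-∀
  e₇ : ∀ x t → x - 1ℤ - t ≡ x - (1ℤ + t)
  e₇ = solve-∀
  e₈ : ∀ x T → x - T - 0ℤ ≡ x - T
  e₈ = solve-∀
  ring : ∀ d₀ d₁ a b c → d₀ + d₁ + ((1ℤ - a - (1ℤ + d₁ - b)) + (c - b)) ≡ (d₀ + c) - a
  ring = solve-∀
  upper : ∀ {x} → ∑ᶠ {t} (λ i → δ x (T + ρ t i)) ≡ 1ℤ - θ (x - (T + T)) - (1ℤ + δ x T - θ (x - T))
  upper {x} = begin
    ∑ᶠ {t} (λ i → δ x (T + ρ t i))
      ≡⟨ ∑-ext (allFin t) (λ i → δ-flip x (T + ρ t i) (+ t + + t + 1ℤ - x) (+ toℕ i) (e₃ x (+ t) (+ toℕ i))) ⟩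
    ∑ᶠ {t} (λ i → δ (+ t + + t + 1ℤ - x) (+ toℕ i))
      ≡⟨ ∑δ-interval t (+ t + + t + 1ℤ - x) ⟩
    θ (+ t + + t + 1ℤ - x) - θ (+ t + + t + 1ℤ - x - + t)
      ≡⟨ cong₂ (λ u v → θ u - θ v) (e₅ x (+ t)) (e₆ x (+ t)) ⟩
    θ (- (x - (T + T)) - 1ℤ) - θ (- (x - T))
      ≡⟨ cong₂ _-_ (θ-neg-1 (x - (T + T))) (trans (θ-neg (x - T)) (cong (λ d → 1ℤ + d - θ (x - T)) (δ-shift (x - T) 0ℤ x T (e₈ x T)))) ⟩
    1ℤ - θ (x - (T + T)) - (1ℤ + δ x T - θ (x - T)) ∎
  lower : ∀ {x} → ∑ᶠ {t} (λ i → δ x (T - ρ t i)) ≡ θ (x - 1ℤ) - θ (x - T)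
  lower {x} = begin
    ∑ᶠ {t} (λ i → δ x (T - ρ t i))
      ≡⟨ ∑-ext (allFin t) (λ i → δ-shift x (T - ρ t i) (x - 1ℤ) (+ toℕ i) (e₄ x (+ t) (+ toℕ i))) ⟩
    ∑ᶠ {t} (λ i → δ (x - 1ℤ) (+ toℕ i))
      ≡⟨ ∑δ-interval t (x - 1ℤ) ⟩
    θ (x - 1ℤ) - θ (x - 1ℤ - + t)
      ≡⟨ cong (λ v → θ (x - 1ℤ) - θ v) (e₇ x (+ t)) ⟩
    θ (x - 1ℤ) - θ (x - T) ∎
  firstGaps : ∀ x → c₀ (x - (T + T)) - c₀ x ≡ gaps T (ρ t) x
  firstGaps x = sym (begin
    δ x 0ℤ + δ x T + ∑ᶠ (λ i → δ x (T + ρ t i) + δ x (T - ρ t i))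
      ≡⟨ cong (_+_ (δ x 0ℤ + δ x T)) (trans (∑-+ (allFin t) (λ i → δ x (T + ρ t i)) (λ i → δ x (T - ρ t i))) (cong₂ _+_ upper lower)) ⟩
    δ x 0ℤ + δ x T + ((1ℤ - θ (x - (T + T)) - (1ℤ + δ x T - θ (x - T))) + (θ (x - 1ℤ) - θ (x - T)))
      ≡⟨ ring (δ x 0ℤ) (δ x T) (θ (x - (T + T))) (θ (x - T)) (θ (x - 1ℤ)) ⟩
    (δ x 0ℤ + θ (x - 1ℤ)) - θ (x - (T + T))
      ≡⟨ cong (_- θ (x - (T + T))) (sym (θ-suc x)) ⟩
    θ x - θ (x - (T + T))
      ≡⟨ e₉ (θ x) (θ (x - (T + T))) ⟩
    c₀ (x - (T + T)) - c₀ x ∎)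
    where
    e₉ : ∀ a b → a - b ≡ (1ℤ - b) - (1ℤ - a)
    e₉ = solve-∀

hookTerm₀ : ∀ {m} → 0ℤ ≤ m → ∀ x → hookTerm beads₀ m x ≡ 0ℤ
hookTerm₀ {m} m≥0 x with 0ℤ ℤ.≤? x
... | yes x≥0 = cong (λ z → (1ℤ - z) * (1ℤ - c₀ (x - m))) (θ-yes x≥0)
... | no x≱0  = trans (cong (λ z → c₀ x * (1ℤ - (1ℤ - z))) (θ-no (subst (0ℤ ≤_) (e x m) (pos (ℤ.≰⇒> x≱0) ⊕ m≥0)))) (ℤ.*-zeroʳ (c₀ x))
  where e : ∀ x m → (0ℤ - x - 1ℤ) + m ≡ - (x - m) - 1ℤ
        e = solve-∀

A⁺₀ : ∀ {m} → 0ℤ ≤ m → A⁺ beads₀ m ≡ 0ℤ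
A⁺₀ {m} m≥0 = unique (proj₂ (plusSum beads₀ m))
  (hasSum-ext (λ x → sym (cong (_* θ (x + x - m)) (hookTerm₀ m≥0 x))) hasSum-0)

A⁻₀ : ∀ {m} → 0ℤ ≤ m → A⁻ beads₀ m ≡ 0ℤ
A⁻₀ {m} m≥0 = unique (proj₂ (minusSum beads₀ m))
  (hasSum-ext (λ x → sym (cong (_* (1ℤ - θ (x + x - m))) (hookTerm₀ m≥0 x))) hasSum-0)

hookCoefficient₀ : ∀ {g n} → 0ℤ ≤ g → 0ℤ ≤ n → hookCoefficient beads₀ g n ≡ 0ℤ
hookCoefficient₀ {g} {n} g≥0 n≥0 = cong₂ _-_ (cong₂ _-_ (cong₂ _+_ (A⁺₀ (n≥0 ⊕ g≥0)) wrapped₀) (A⁺₀ n≥0)) (A⁻₀ n≥0)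
  where
  wrapped₀ : wrapped beads₀ g n ≡ 0ℤ
  wrapped₀ with g ℤ.≤? n
  ... | yes g≤n = A⁻₀ (nonneg g≤n)
  ... | no g≰n  = A⁺₀ (nonneg (ℤ.<⇒≤ (ℤ.≰⇒> g≰n)))

-- The correction err is the same for every partition, so the empty one determines it.
hookCoefficient≡roots : ∀ {t} {r : Fin t → ℤ} {c} (C : Coded (+ suc t) r c) → ∀ n → 0ℤ < n →
  hookCoefficient (Coded.beads C) (+ suc t + + suc t) n ≡ roots r n - roots (ρ t) n
hookCoefficient≡roots {t} {r} C n n>0 = ℤ.*-cancelˡ-≡ (+ 2) _ _ (begin
  + 2 * hookCoefficient (Coded.beads C) g n
    ≡⟨ 2hookCoefficient C T>0 n n>0 ⟩
  + 2 * roots r n - err g n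
    ≡⟨ cong (_-_ (+ 2 * roots r n)) err≡ ⟩
  + 2 * roots r n - + 2 * roots (ρ t) n
    ≡⟨ e₁ (roots r n) (roots (ρ t) n) ⟩
  + 2 * (roots r n - roots (ρ t) n) ∎)
  where
  open ≡-Reasoning
  g = + suc t + + suc t
  T>0 : 0ℤ < + suc t
  T>0 = +<+ (ℕ.s≤s ℕ.z≤n)
  e₁ : ∀ a b → + 2 * a - + 2 * b ≡ + 2 * (a - b)
  e₁ = solve-∀
  e₂ : ∀ a b → b ≡ a - (a - b)
  e₂ = solve-∀
  err≡ : err g n ≡ + 2 * roots (ρ t) n
  err≡ = begin
    err g n
      ≡⟨ e₂ (+ 2 * roots (ρ t) n) (err g n) ⟩
    + 2 * roots (ρ t) n - (+ 2 * roots (ρ t) n - err g n)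
      ≡⟨ cong (_-_ (+ 2 * roots (ρ t) n)) (sym (2hookCoefficient (coded₀ t) T>0 n n>0)) ⟩
    + 2 * roots (ρ t) n - + 2 * hookCoefficient beads₀ g n
      ≡⟨ cong (λ z → + 2 * roots (ρ t) n - + 2 * z) (hookCoefficient₀ {g} (+≤+ ℕ.z≤n) (ℤ.<⇒≤ n>0)) ⟩
    + 2 * roots (ρ t) n - + 2 * 0ℤ
      ≡⟨ ℤ.+-identityʳ (+ 2 * roots (ρ t) n) ⟩
    + 2 * roots (ρ t) n ∎

-- The coding of a doubled distinct core

2+2t≡T+T : ∀ t → + (2 ℕ.+ 2 ℕ.* t) ≡ + suc t + + suc t
2+2t≡T+T t = cong +_ (e t)
  where e : ∀ t → 2 ℕ.+ 2 ℕ.* t ≡ suc t ℕ.+ suc t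
        e = ℕ.solve-∀

module _ {t : ℕ} {p : Partition} (dd-core : DD₍ 2 ℕ.+ 2 ℕ.* t ₎ p) {v : Fin t → ℤ} (V : IsVCoding (2 ℕ.+ 2 ℕ.* t) t p v) where
  open IsVCoding V
  open DoubledDistinct p (proj₁ dd-core) using (c-symm; beads; bead⇒mirror-hole; hole⇒mirror-bead)

  private
    g = 2 ℕ.+ 2 ℕ.* t
    G T : ℤ
    G = + g
    T = + suc t
    G≡T+T : G ≡ T + T
    G≡T+T = 2+2t≡T+T t
    T₊ : 0ℤ ≤ T - 1ℤ
    T₊ = +≤+ ℕ.z≤n
    1₊ : 0ℤ ≤ 1ℤ
    1₊ = +≤+ ℕ.z≤n
    g>0 : 0 ℕ.< g
    g>0 = ℕ.s≤s ℕ.z≤n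
    C : ℤ → ℤ
    C = c p
    b : ℤ → ℤ
    b x = C (x - G) - C x
    s : Fin g → ℤ
    s a = β (σ ⟨$⟩ʳ a)

    b≡∑ : ∀ x → b x ≡ ∑ᶠ (λ a → δ x (s a))
    b≡∑ = first-gaps g>0 (proj₂ dd-core) V

    hasSum-b : ∀ φ → HasSum (λ x → b x * φ x) (∑ᶠ (φ ∘ s))
    hasSum-b φ = hasSum-ext (λ x → sym (eq x)) (hasSum-∑ (allFin g) (λ a x → δ x (s a) * φ (s a)) (φ ∘ s) (λ a → hasSum-δ (s a) (φ (s a))))
      where
      eq : ∀ x → b x * φ x ≡ ∑ᶠ (λ a → δ x (s a) * φ (s a))
      eq x = trans (cong (_* φ x) (b≡∑ x)) (trans (ℤ.*-comm (∑ᶠ (λ a → δ x (s a))) (φ x)) (trans (sym (∑-*ˡ (allFin g) (φ x) (λ a → δ x (s a))))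
        (∑-ext (allFin g) (λ a → trans (ℤ.*-comm (φ x) (δ x (s a))) (δ-subst φ x (s a))))))

    -- Antisymmetry of c makes the first gaps symmetric about T = G/2, except that 0 is a first gap
    -- and its mirror image G is not.
    b-mirror : ∀ x → b (G - x) ≡ b x - δ x 0ℤ + δ x G
    b-mirror x = begin
      C (G - x - G) - C (G - x)
        ≡⟨ cong₂ (λ u w → C u - C w) (e₁ G x) (e₂ G x) ⟩
      C (- x) - C (- (x - G))
        ≡⟨ e₃ (C x) (C (- x)) (C (x - G)) (C (- (x - G))) ⟩
      (C x + C (- x)) - (C (x - G) + C (- (x - G))) + (C (x - G) - C x)
        ≡⟨ cong₂ (λ u w → u - w + (C (x - G) - C x)) (c-symm x) (trans (c-symm (x - G)) (cong (_-_ 1ℤ) (δ-shift (x - G) 0ℤ x G (e₅ G x)))) ⟩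
      (1ℤ - δ x 0ℤ) - (1ℤ - δ x G) + (C (x - G) - C x)
        ≡⟨ e₄ (δ x 0ℤ) (δ x G) (C (x - G) - C x) ⟩
      b x - δ x 0ℤ + δ x G ∎
      where
      open ≡-Reasoning
      e₁ : ∀ g x → g - x - g ≡ - x
      e₁ = solve-∀
      e₂ : ∀ g x → g - x ≡ - (x - g)
      e₂ = solve-∀
      e₃ : ∀ a a′ b b′ → a′ - b′ ≡ (a + a′) - (b + b′) + (b - a)
      e₃ = solve-∀
      e₄ : ∀ d d′ k → (1ℤ - d) - (1ℤ - d′) + k ≡ k - d + d′
      e₄ = solve-∀
      e₅ : ∀ g x → x - g - 0ℤ ≡ x - g
      e₅ = solve-∀

    -- A bead at T would push a bead down to T - G = -T, which antisymmetry forbids.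
    b-center : b T ≡ 1ℤ
    b-center = cong₂ _-_ (trans (cong C T-G≡) (c-bead p -T∈)) (c-hole p T∉)
      where
      e : ∀ T → T - (T + T) ≡ - T
      e = solve-∀
      T-G≡ : T - G ≡ - T
      T-G≡ = trans (cong (_-_ T) G≡T+T) (e T)
      T>0 : 0ℤ < T
      T>0 = +<+ (ℕ.s≤s ℕ.z≤n)
      T∉ : ¬ IsBead p T
      T∉ T∈ = bead⇒mirror-hole T>0 T∈ (subst (IsBead p) T-G≡ (core-closed p g>0 (proj₂ dd-core) T T∈))
      -T∈ : IsBead p (- T)
      -T∈ = decidable-stable (isBead? p (- T)) (λ -T∉ → T∉ (hole⇒mirror-bead T>0 -T∉))

    N⁺ N⁻ : ℤ
    N⁺ = ∑ᶠ (λ a → θ (s a - T - 1ℤ))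
    N⁻ = ∑ᶠ (λ a → θ (T - s a - 1ℤ))

    -- Reflection exchanges the first gaps below and above T. The exceptions 0 and G of `b-mirror`
    -- enter with weights 0 and 1, hence the unsimplified form.
    N⁻≡ : N⁻ ≡ N⁺ - 0ℤ + 1ℤ
    N⁻≡ = unique
      (hasSum-reflect (hasSum-b (λ x → θ (T - x - 1ℤ))) G)
      (hasSum-ext (λ x → sym (eq x)) (hasSum-+ (hasSum-- (hasSum-b (λ x → θ (x - T - 1ℤ))) (hasSum-δ 0ℤ 0ℤ)) (hasSum-δ G 1ℤ)))
      where
      open ≡-Reasoning
      e₁ : ∀ T x → T - (T + T - x) - 1ℤ ≡ x - T - 1ℤ
      e₁ = solve-∀
      e₂ : ∀ a d d′ k → (a - d + d′) * k ≡ a * k - d * k + d′ * k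
      e₂ = solve-∀
      e₄ : ∀ T → T - 1ℤ ≡ T + T - T - 1ℤ
      e₄ = solve-∀
      e₅ : ∀ T → (T - 1ℤ) + 1ℤ ≡ - (0ℤ - T - 1ℤ) - 1ℤ
      e₅ = solve-∀
      θ₀ : θ (0ℤ - T - 1ℤ) ≡ 0ℤ
      θ₀ = θ-no (subst (0ℤ ≤_) (e₅ T) (T₊ ⊕ 1₊))
      θ₁ : θ (G - T - 1ℤ) ≡ 1ℤ
      θ₁ = θ-yes (subst (0ℤ ≤_) (trans (e₄ T) (cong (λ z → z - T - 1ℤ) (sym G≡T+T))) T₊)
      φ : ℤ → ℤ
      φ x = θ (x - T - 1ℤ)
      eq : ∀ x → b (G - x) * θ (T - (G - x) - 1ℤ) ≡ b x * φ x - δ x 0ℤ * 0ℤ + δ x G * 1ℤ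
      eq x = begin
        b (G - x) * θ (T - (G - x) - 1ℤ)
          ≡⟨ cong₂ _*_ (b-mirror x) (cong θ (trans (cong (λ z → T - (z - x) - 1ℤ) G≡T+T) (e₁ T x))) ⟩
        (b x - δ x 0ℤ + δ x G) * φ x
          ≡⟨ e₂ (b x) (δ x 0ℤ) (δ x G) (φ x) ⟩
        b x * φ x - δ x 0ℤ * φ x + δ x G * φ x
          ≡⟨ cong₂ (λ u w → b x * φ x - u + w) (trans (δ-subst φ x 0ℤ) (cong (_*_ (δ x 0ℤ)) θ₀)) (trans (δ-subst φ x G) (cong (_*_ (δ x G)) θ₁)) ⟩
        b x * φ x - δ x 0ℤ * 0ℤ + δ x G * 1ℤ ∎

    trichotomy : ∀ x → θ (x - T - 1ℤ) + θ (T - x - 1ℤ) + δ T x ≡ 1ℤ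
    trichotomy x = begin
      θ (x - T - 1ℤ) + θ (T - x - 1ℤ) + δ T x
        ≡⟨ cong₂ (λ u w → θ (x - T - 1ℤ) + u + w) (trans (cong θ (e₁ T x)) (θ-neg-1 (x - T))) (δ-flip T x (x - T) 0ℤ (e₂ T x)) ⟩
      θ (x - T - 1ℤ) + (1ℤ - θ (x - T)) + δ (x - T) 0ℤ
        ≡⟨ cong (λ u → θ (x - T - 1ℤ) + (1ℤ - u) + δ (x - T) 0ℤ) (θ-suc (x - T)) ⟩
      θ (x - T - 1ℤ) + (1ℤ - (δ (x - T) 0ℤ + θ (x - T - 1ℤ))) + δ (x - T) 0ℤ
        ≡⟨ e₃ (θ (x - T - 1ℤ)) (δ (x - T) 0ℤ) ⟩
      1ℤ ∎
      where
      open ≡-Reasoning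
      e₁ : ∀ T x → T - x - 1ℤ ≡ - (x - T) - 1ℤ
      e₁ = solve-∀
      e₂ : ∀ T x → T - x ≡ 0ℤ - (x - T)
      e₂ = solve-∀
      e₃ : ∀ u d → u + (1ℤ - (d + u)) + d ≡ 1ℤ
      e₃ = solve-∀

    -- Of the 2t + 2 first gaps one is T, and one more lies below T than above it. Exactly t lie
    -- above, so the coding lists precisely these.
    N⁺≡t : N⁺ ≡ + t
    N⁺≡t = ℤ.*-cancelˡ-≡ (+ 2) _ _ (begin
      + 2 * N⁺                             ≡⟨ e₁ N⁺ ⟩
      N⁺ + (N⁺ - 0ℤ + 1ℤ) + 1ℤ - + 2       ≡⟨ cong₂ (λ u w → N⁺ + u + w - + 2) (sym N⁻≡) (sym (trans (sym (b≡∑ T)) b-center)) ⟩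
      N⁺ + N⁻ + ∑ᶠ (λ a → δ T (s a)) - + 2 ≡⟨ cong (_- + 2) total ⟩
      G - + 2                              ≡⟨ cong (_- + 2) G≡T+T ⟩
      T + T - + 2                          ≡⟨ e₂ (+ t) ⟩
      + 2 * + t                            ∎)
      where
      open ≡-Reasoning
      e₁ : ∀ n → + 2 * n ≡ n + (n - 0ℤ + 1ℤ) + 1ℤ - + 2
      e₁ = solve-∀
      e₂ : ∀ t → (1ℤ + t) + (1ℤ + t) - + 2 ≡ + 2 * t
      e₂ = solve-∀
      total : N⁺ + N⁻ + ∑ᶠ (λ a → δ T (s a)) ≡ G
      total = trans (cong (_+ ∑ᶠ (λ a → δ T (s a))) (sym (∑-+ (allFin g) (λ a → θ (s a - T - 1ℤ)) (λ a → θ (T - s a - 1ℤ)))))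
        (trans (sym (∑-+ (allFin g) (λ a → θ (s a - T - 1ℤ) + θ (T - s a - 1ℤ)) (λ a → δ T (s a))))
          (trans (∑-ext (allFin g) (λ a → trichotomy (s a))) (∑ᶠ-1 g)))

    s-early : ∀ a → toℕ a ℕ.< t → T < s a
    s-early = early-exceed s decreasing T t≤g N⁺≡t
    s-late : ∀ a → t ℕ.≤ toℕ a → s a ≤ T
    s-late = late-bounded s decreasing T t≤g N⁺≡t

    r : Fin t → ℤ
    r i = v i - + t - 1ℤ
    T+r : ∀ i → T + r i ≡ v i
    T+r i = e (+ t) (v i)
      where e : ∀ t v → (1ℤ + t) + (v - t - 1ℤ) ≡ v
            e = solve-∀

    v>T : ∀ i → T < v i
    v>T i = subst (T <_) (sym (coding i)) (s-early (inject≤ i t≤g) (subst (ℕ._< t) (sym (Fin.toℕ-inject≤ i t≤g)) (Fin.toℕ<n i)))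

    b-high : ∀ x → T < x → b x ≡ ∑ᶠ (λ i → δ x (T + r i))
    b-high x T<x = trans (b≡∑ x) (trans
      (∑ᶠ-inject≤ t≤g (λ a → δ x (s a)) (λ a t≤a → δ-≢ λ x≡ → ℤ.<⇒≱ T<x (subst (_≤ T) (sym x≡) (s-late a t≤a))))
      (∑-ext (allFin t) (λ i → cong (δ x) (trans (sym (coding i)) (sym (T+r i))))))

  r>0 : ∀ i → 0ℤ < r i
  r>0 i = <-from (pos (v>T i)) (e (+ t) (v i))
    where e : ∀ t v → v - (1ℤ + t) - 1ℤ ≡ v - t - 1ℤ - 0ℤ - 1ℤ
          e = solve-∀

  private
    b≡gaps : ∀ x → b x ≡ gaps T r x
    b≡gaps x with ℤ.<-cmp x T
    ... | tri> _ _ x>T = trans (b-high x x>T) (sym (trans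
          (cong₂ _+_ (cong₂ _+_ (δ-pos (pos x>T ⊕ T₊ ⊕ 1₊) (e₁ T x)) (δ-pos (pos x>T) refl))
            (∑-ext (allFin t) {g = λ i → δ x (T + r i)} (λ i → trans (cong (_+_ (δ x (T + r i))) (δ-pos (pos x>T ⊕ pos (r>0 i) ⊕ 1₊) (e₂ T x (r i)))) (ℤ.+-identityʳ _))))
          (ℤ.+-identityˡ (∑ᶠ (λ i → δ x (T + r i))))))
      where
      e₁ : ∀ T x → (x - T - 1ℤ) + (T - 1ℤ) + 1ℤ ≡ x - 0ℤ - 1ℤ
      e₁ = solve-∀
      e₂ : ∀ T x r → (x - T - 1ℤ) + (r - 0ℤ - 1ℤ) + 1ℤ ≡ x - (T - r) - 1ℤ
      e₂ = solve-∀
    ... | tri≈ _ refl _ = trans b-center (sym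
          (cong₂ _+_ (cong₂ _+_ (δ-pos T₊ (e₀ T)) (δ-≡ refl))
            (∑-zero (allFin t) (λ i _ → cong₂ _+_ (δ-neg (pos (r>0 i)) (e₁ T (r i))) (δ-pos (pos (r>0 i)) (e₂ T (r i)))))))
      where
      e₀ : ∀ T → T - 1ℤ ≡ T - 0ℤ - 1ℤ
      e₀ = solve-∀
      e₁ : ∀ T r → r - 0ℤ - 1ℤ ≡ T + r - T - 1ℤ
      e₁ = solve-∀
      e₂ : ∀ T r → r - 0ℤ - 1ℤ ≡ T - (T - r) - 1ℤ
      e₂ = solve-∀
    -- Below T everything is read off from above T through `b-mirror`; the reflection of T + rᵢ is T
    -- - rᵢ, and the correction at 0 supplies the gap 0.
    ... | tri< x<T _ _ = begin
        b x
          ≡⟨ e₃ (b x) (δ x 0ℤ) (δ x G) ⟩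
        (b x - δ x 0ℤ + δ x G) + δ x 0ℤ - δ x G
          ≡⟨ cong₂ (λ u w → u + δ x 0ℤ - w) (sym (b-mirror x)) (δ-neg (pos x<T ⊕ T₊ ⊕ 1₊) (trans (e₄ T x) (cong (λ z → z - x - 1ℤ) (sym G≡T+T)))) ⟩
        b (G - x) + δ x 0ℤ - 0ℤ
          ≡⟨ cong (λ u → u + δ x 0ℤ - 0ℤ) (trans (b-high (G - x) G-x>T) (∑-ext (allFin t) λ i → δ-flip (G - x) (T + r i) x (T - r i) (trans (cong (λ z → z - x - (T + r i)) G≡T+T) (e₅ T x (r i))))) ⟩
        ∑ᶠ (λ i → δ x (T - r i)) + δ x 0ℤ - 0ℤ
          ≡⟨ e₆ (∑ᶠ (λ i → δ x (T - r i))) (δ x 0ℤ) ⟩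
        δ x 0ℤ + 0ℤ + ∑ᶠ (λ i → δ x (T - r i))
          ≡⟨ cong₂ (λ u w → δ x 0ℤ + u + w) (sym (δ-neg (pos x<T) refl))
               (∑-ext (allFin t) λ i → trans (sym (ℤ.+-identityˡ (δ x (T - r i)))) (cong (_+ δ x (T - r i)) (sym (δ-neg (pos x<T ⊕ pos (r>0 i) ⊕ 1₊) (e₇ T x (r i)))))) ⟩
        gaps T r x ∎
      where
      open ≡-Reasoning
      e₃ : ∀ b d d′ → b ≡ (b - d + d′) + d - d′
      e₃ = solve-∀
      e₄ : ∀ T x → (T - x - 1ℤ) + (T - 1ℤ) + 1ℤ ≡ T + T - x - 1ℤ
      e₄ = solve-∀
      e₅ : ∀ T x r → T + T - x - (T + r) ≡ T - r - x
      e₅ = solve-∀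
      e₆ : ∀ u d → u + d - 0ℤ ≡ d + 0ℤ + u
      e₆ = solve-∀
      e₇ : ∀ T x r → (T - x - 1ℤ) + (r - 0ℤ - 1ℤ) + 1ℤ ≡ T + r - x - 1ℤ
      e₇ = solve-∀
      e₈ : ∀ T x → T - x - 1ℤ ≡ T + T - x - T - 1ℤ
      e₈ = solve-∀
      G-x>T : T < G - x
      G-x>T = <-from (pos x<T) (trans (e₈ T x) (cong (λ z → z - x - T - 1ℤ) (sym G≡T+T)))

  coded : Coded (+ suc t) (λ i → v i - + t - 1ℤ) (c p)
  coded = record
    { beads        = beads
    ; firstGaps    = λ x → trans (cong (λ z → C (x - z) - C x) (sym G≡T+T)) (b≡gaps x)
    ; r-positive   = r>0
    ; r-decreasing = λ i j i<j → <-from (pos (v-decreasing i j i<j)) (e (+ t) (v i) (v j))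
    }
    where
    e : ∀ t v w → v - w - 1ℤ ≡ (v - t - 1ℤ) - (w - t - 1ℤ) - 1ℤ
    e = solve-∀
    v-decreasing : ∀ i j → i Fin.< j → v j < v i
    v-decreasing i j i<j = subst₂ _<_ (sym (coding j)) (sym (coding i)) (decreasing (inject≤ i t≤g) (inject≤ j t≤g)
      (subst₂ ℕ._<_ (sym (Fin.toℕ-inject≤ i t≤g)) (sym (Fin.toℕ-inject≤ j t≤g)) i<j))

-- The size

module _ {t : ℕ} {r : Fin t → ℤ} {p : Partition} (C : Coded (+ suc t) r (c p)) where
  private
    T : ℤ
    T = + suc t
    F = allFin t
    N = [1⋯ ℓ p ]
    sq : ℤ → ℤ
    sq x = x * x

    ∑-gap-squares : ∀ (q : Fin t → ℤ) → 0ℤ * 0ℤ + T * T + ∑ᶠ (λ i → (T + q i) * (T + q i) + (T - q i) * (T - q i))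
                  ≡ T * T + ∑ᶠ {t} (λ _ → + 2 * (T * T)) + + 2 * ∑ᶠ (λ i → q i * q i)
    ∑-gap-squares q = trans (cong₂ _+_ (ℤ.+-identityˡ (T * T)) (trans (∑-ext F (λ i → e (T) (q i))) (trans (∑-+ F (λ _ → + 2 * (T * T)) (λ i → + 2 * (q i * q i)))
        (cong (_+_ (∑ᶠ {t} (λ _ → + 2 * (T * T)))) (∑-*ˡ F (+ 2) (λ i → q i * q i))))))
      (sym (ℤ.+-assoc (T * T) (∑ᶠ {t} (λ _ → + 2 * (T * T))) (+ 2 * ∑ᶠ (λ i → q i * q i))))
      where e : ∀ T q → (T + q) * (T + q) + (T - q) * (T - q) ≡ + 2 * (T * T) + + 2 * (q * q)
            e = solve-∀

  -- The difference of the first-gap indicators of p and of the empty partition, weighted by x², is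
  -- summed twice. Over beads, the squares before and after a shift by g leave 2g λᵢ for each row;
  -- over gaps, (T + rᵢ)² + (T - rᵢ)² leaves 2 rᵢ² beside a constant that cancels.
  size-squares : (T + T) * + size p ≡ ∑ᶠ (λ i → r i * r i) - ∑ᶠ (λ i → ρ t i * ρ t i)
  size-squares = ℤ.*-cancelˡ-≡ (+ 2) _ _ (begin
    + 2 * ((T + T) * + size p)
      ≡⟨ cong (λ z → + 2 * ((T + T) * z)) (size-∑ p) ⟩
    + 2 * ((T + T) * ∑ N (λ i → + part p i))
      ≡⟨ sym (ℤ.*-assoc (+ 2) (T + T) _) ⟩
    + 2 * (T + T) * ∑ N (λ i → + part p i)
      ≡⟨ sym (∑-*ˡ N (+ 2 * (T + T)) (λ i → + part p i)) ⟩
    ∑ N (λ i → + 2 * (T + T) * + part p i)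
      ≡⟨ trans (∑-ext N (λ i → e₁ (T + T) (+ part p i) (+ i))) (∑-- N (λ i → shifted (bead p i) - shifted (- + i)) (λ i → sq (bead p i) - sq (- + i))) ⟩
    ∑ N (λ i → shifted (bead p i) - shifted (- + i)) - ∑ N (λ i → sq (bead p i) - sq (- + i))
      ≡⟨ unique excess gapped ⟩
    (0ℤ * 0ℤ + T * T + ∑ᶠ (λ i → (T + r i) * (T + r i) + (T - r i) * (T - r i)))
      - (0ℤ * 0ℤ + T * T + ∑ᶠ (λ i → (T + ρ t i) * (T + ρ t i) + (T - ρ t i) * (T - ρ t i)))
      ≡⟨ cong₂ _-_ (∑-gap-squares r) (∑-gap-squares (ρ t)) ⟩
    (K + + 2 * ∑ᶠ (λ i → r i * r i)) - (K + + 2 * ∑ᶠ (λ i → ρ t i * ρ t i))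
      ≡⟨ e₂ K (∑ᶠ (λ i → r i * r i)) (∑ᶠ (λ i → ρ t i * ρ t i)) ⟩
    + 2 * (∑ᶠ (λ i → r i * r i) - ∑ᶠ (λ i → ρ t i * ρ t i)) ∎)
    where
    open ≡-Reasoning
    K : ℤ
    K = T * T + ∑ᶠ {t} (λ _ → + 2 * (T * T))
    shifted : ℤ → ℤ
    shifted x = (x + (T + T)) * (x + (T + T))
    e₁ : ∀ g a i → + 2 * g * a ≡ ((a - i + g) * (a - i + g) - (- i + g) * (- i + g)) - ((a - i) * (a - i) - (- i) * (- i))
    e₁ = solve-∀
    e₂ : ∀ k a b → (k + + 2 * a) - (k + + 2 * b) ≡ + 2 * (a - b)
    e₂ = solve-∀
    e₃ : ∀ g x → - g + x + g ≡ x
    e₃ = solve-∀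
    e₄ : ∀ g x → - g + x ≡ x - g
    e₄ = solve-∀
    e₅ : ∀ a a₀ b b₀ s → (a - a₀) * s - (b - b₀) * s ≡ (a - b) * s - (a₀ - b₀) * s
    e₅ = solve-∀
    excess-at : ℤ → ℤ
    excess-at x = c p x - (1ℤ - θ x)
    pointwise : ∀ x → excess-at (- (T + T) + x) * shifted (- (T + T) + x) - excess-at x * sq x ≡ gaps T r x * sq x - gaps T (ρ t) x * sq x
    pointwise x = begin
      excess-at (- (T + T) + x) * shifted (- (T + T) + x) - excess-at x * sq x
        ≡⟨ cong₂ (λ u w → excess-at u * sq w - excess-at x * sq x) (e₄ (T + T) x) (e₃ (T + T) x) ⟩
      (c p (x - (T + T)) - c₀ (x - (T + T))) * sq x - (c p x - c₀ x) * sq x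
        ≡⟨ e₅ (c p (x - (T + T))) (c₀ (x - (T + T))) (c p x) (c₀ x) (sq x) ⟩
      (c p (x - (T + T)) - c p x) * sq x - (c₀ (x - (T + T)) - c₀ x) * sq x
        ≡⟨ cong₂ (λ u w → u * sq x - w * sq x) (Coded.firstGaps C x) (Coded.firstGaps (coded₀ t) x) ⟩
      gaps T r x * sq x - gaps T (ρ t) x * sq x ∎
    excess : HasSum (λ x → gaps T r x * sq x - gaps T (ρ t) x * sq x)
                    (∑ N (λ i → shifted (bead p i) - shifted (- + i)) - ∑ N (λ i → sq (bead p i) - sq (- + i)))
    excess = hasSum-ext pointwise (hasSum-- (hasSum-shift (hasSum-excess p shifted) (- (T + T))) (hasSum-excess p sq))
    gapped : HasSum (λ x → gaps T r x * sq x - gaps T (ρ t) x * sq x)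
      ((0ℤ * 0ℤ + T * T + ∑ᶠ (λ i → (T + r i) * (T + r i) + (T - r i) * (T - r i)))
        - (0ℤ * 0ℤ + T * T + ∑ᶠ (λ i → (T + ρ t i) * (T + ρ t i) + (T - ρ t i) * (T - ρ t i))))
    gapped = hasSum-- (hasSum-gaps T r sq) (hasSum-gaps T (ρ t) sq)

∑ρ² : ∀ t → + 6 * ∑ᶠ (λ i → ρ t i * ρ t i) ≡ + t * (+ t + 1ℤ) * (+ 2 * + t + 1ℤ)
∑ρ² zero    = refl
∑ρ² (suc t) = begin
  + 6 * ∑ᶠ (λ i → ρ (suc t) i * ρ (suc t) i)
    ≡⟨ cong (_*_ (+ 6)) (trans (∑ᶠ-suc {t} (λ i → ρ (suc t) i * ρ (suc t) i)) (cong (_+_ (ρ (suc t) Fin.zero * ρ (suc t) Fin.zero)) (∑-ext (allFin t) {g = λ i → ρ t i * ρ t i} (λ i → cong (λ z → z * z) (e₁ (+ t) (+ toℕ i)))))) ⟩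
  + 6 * ((1ℤ + + t - 0ℤ) * (1ℤ + + t - 0ℤ) + ∑ᶠ (λ i → ρ t i * ρ t i))
    ≡⟨ ℤ.*-distribˡ-+ (+ 6) ((1ℤ + + t - 0ℤ) * (1ℤ + + t - 0ℤ)) (∑ᶠ (λ i → ρ t i * ρ t i)) ⟩
  + 6 * ((1ℤ + + t - 0ℤ) * (1ℤ + + t - 0ℤ)) + + 6 * ∑ᶠ (λ i → ρ t i * ρ t i)
    ≡⟨ cong (_+_ (+ 6 * ((1ℤ + + t - 0ℤ) * (1ℤ + + t - 0ℤ)))) (∑ρ² t) ⟩
  + 6 * ((1ℤ + + t - 0ℤ) * (1ℤ + + t - 0ℤ)) + + t * (+ t + 1ℤ) * (+ 2 * + t + 1ℤ)
    ≡⟨ e₂ (+ t) ⟩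
  (1ℤ + + t) * (1ℤ + + t + 1ℤ) * (+ 2 * (1ℤ + + t) + 1ℤ) ∎
  where
  open ≡-Reasoning
  e₁ : ∀ t i → (1ℤ + t) - (1ℤ + i) ≡ t - i
  e₁ = solve-∀
  e₂ : ∀ t → + 6 * ((1ℤ + t - 0ℤ) * (1ℤ + t - 0ℤ)) + t * (t + 1ℤ) * (+ 2 * t + 1ℤ) ≡ (1ℤ + t) * (1ℤ + t + 1ℤ) * (+ 2 * (1ℤ + t) + 1ℤ)
  e₂ = solve-∀

-- Multiplicities and products

multiplicity : List ℤ → ℤ → ℤ
multiplicity xs n = ∑ xs (λ x → δ x n)

δ-nonneg : ∀ x y → 0ℤ ≤ δ x y
δ-nonneg x y with x ℤ.≟ y
... | yes x≡y = subst (0ℤ ≤_) (sym (δ-≡ x≡y)) (+≤+ ℕ.z≤n)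
... | no x≢y  = ℤ.≤-reflexive (sym (δ-≢ x≢y))

multiplicity⇒∈ : ∀ x xs ys → (∀ n → multiplicity (x ∷ xs) n ≡ multiplicity ys n) → x ∈ ys
multiplicity⇒∈ x xs ys h with x ∈? ys
... | yes x∈ = x∈
... | no x∉  = ⊥-elim (absurd (∑-nonneg xs {λ y → δ y x} (λ y → δ-nonneg y x)) (begin
    multiplicity xs x                      ≡⟨ e (multiplicity xs x) ⟩
    1ℤ + multiplicity xs x - 1ℤ            ≡⟨ cong (λ d → d + multiplicity xs x - 1ℤ) (sym (δ-≡ {x} refl)) ⟩
    multiplicity (x ∷ xs) x - 1ℤ           ≡⟨ cong (_- 1ℤ) (h x) ⟩
    multiplicity ys x - 1ℤ                 ≡⟨ cong (_- 1ℤ) (∑-zero ys (λ y y∈ → δ-≢ (λ y≡x → x∉ (subst (_∈ ys) y≡x y∈)))) ⟩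
    -1ℤ                                    ∎))
  where
  open ≡-Reasoning
  e : ∀ m → m ≡ 1ℤ + m - 1ℤ
  e = solve-∀

multiplicity⇒↭ : ∀ xs ys → (∀ n → multiplicity xs n ≡ multiplicity ys n) → xs ↭ ys
multiplicity⇒↭ []       []       h = ↭-refl
multiplicity⇒↭ []       (y ∷ ys) h with () ← multiplicity⇒∈ y ys [] (sym ∘ h)
multiplicity⇒↭ (x ∷ xs) ys       h with ∈.∈-∃++ (multiplicity⇒∈ x xs ys h)
... | as , bs , refl = ↭-trans (↭-prep x (multiplicity⇒↭ xs (as ++ bs) rest)) (↭-sym (shift x as bs))
  where
  open ≡-Reasoning
  e₁ : ∀ d m → m ≡ (d + m) - d
  e₁ = solve-∀
  e₂ : ∀ d a b → a + (d + b) - d ≡ a + b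
  e₂ = solve-∀
  rest : ∀ n → multiplicity xs n ≡ multiplicity (as ++ bs) n
  rest n = begin
    multiplicity xs n
      ≡⟨ e₁ (δ x n) (multiplicity xs n) ⟩
    multiplicity (x ∷ xs) n - δ x n
      ≡⟨ cong (_- δ x n) (trans (h n) (∑-++ as (x ∷ bs) (λ y → δ y n))) ⟩
    multiplicity as n + (δ x n + multiplicity bs n) - δ x n
      ≡⟨ e₂ (δ x n) (multiplicity as n) (multiplicity bs n) ⟩
    multiplicity as n + multiplicity bs n
      ≡⟨ sym (∑-++ as bs (λ y → δ y n)) ⟩
    multiplicity (as ++ bs) n ∎

-- A list of pairs (a , b) stands for the formal product of the quotients τ a ÷ τ b, and divisor for its
-- order at n.
divisor : List (ℤ × ℤ) → ℤ → ℤ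
divisor l n = ∑ l (λ (a , b) → δ a n - δ b n)

divisor-split : ∀ l n → divisor l n ≡ multiplicity (map proj₁ l) n - multiplicity (map proj₂ l) n
divisor-split l n = trans (∑-- l (λ q → δ (proj₁ q) n) (λ q → δ (proj₂ q) n))
  (sym (cong₂ _-_ (∑-map proj₁ l (λ x → δ x n)) (∑-map proj₂ l (λ x → δ x n))))

module Products {c ℓ₁ ℓ₂ : Level} (F : HeytingField c ℓ₁ ℓ₂) where
  open FieldNotation F renaming (_*_ to _·_)
  private
    R : CommutativeRing c ℓ₁
    R = HeytingCommutativeRing.commutativeRing (HeytingField.heytingCommutativeRing F)
    module R = CommutativeRing R
    open CommutativeSemigroupProperties R.*-commutativeSemigroup using (interchange)
    open SetoidReasoning R.setoid

  module _ {a} {A : Set a} where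
    ∏-cong : (xs : List A) {f g : A → Carrier} → (∀ x → f x ≈ g x) → ∏ xs f ≈ ∏ xs g
    ∏-cong []       h = R.refl
    ∏-cong (x ∷ xs) h = R.*-cong (h x) (∏-cong xs h)

    ∏-· : (xs : List A) (f g : A → Carrier) → ∏ xs (λ x → f x · g x) ≈ ∏ xs f · ∏ xs g
    ∏-· []       f g = R.sym (R.*-identityˡ 1#)
    ∏-· (x ∷ xs) f g = R.trans (R.*-cong R.refl (∏-· xs f g)) (interchange (f x) (g x) (∏ xs f) (∏ xs g))

    ∏-++ : (xs ys : List A) (f : A → Carrier) → ∏ (xs ++ ys) f ≈ ∏ xs f · ∏ ys f
    ∏-++ []       ys f = R.sym (R.*-identityˡ (∏ ys f))
    ∏-++ (x ∷ xs) ys f = R.trans (R.*-cong R.refl (∏-++ xs ys f)) (R.sym (R.*-assoc (f x) (∏ xs f) (∏ ys f)))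

    ∏-map : ∀ {b} {B : Set b} (h : B → A) (xs : List B) (f : A → Carrier) → ∏ (map h xs) f ≈ ∏ xs (f ∘ h)
    ∏-map h []       f = R.refl
    ∏-map h (x ∷ xs) f = R.*-cong R.refl (∏-map h xs f)

    ∏-concatMap : ∀ {b} {B : Set b} (h : B → List A) (xs : List B) (f : A → Carrier) →
                  ∏ (concatMap h xs) f ≈ ∏ xs (λ x → ∏ (h x) f)
    ∏-concatMap h []       f = R.refl
    ∏-concatMap h (x ∷ xs) f = R.trans (∏-++ (h x) (concatMap h xs) f) (R.*-cong R.refl (∏-concatMap h xs f))

    ∏-replicate : ∀ n (x : A) (f : A → Carrier) → ∏ (replicate n x) f ≈ f x ^ n
    ∏-replicate zero    x f = R.refl
    ∏-replicate (suc n) x f = R.*-cong R.refl (∏-replicate n x f)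

    ∏-↭ : {xs ys : List A} (f : A → Carrier) → xs ↭ ys → ∏ xs f ≈ ∏ ys f
    ∏-↭ f ↭-refl         = R.refl
    ∏-↭ f (↭-prep x p)   = R.*-cong R.refl (∏-↭ f p)
    ∏-↭ {x ∷ y ∷ xs} {_ ∷ _ ∷ ys} f (↭-swap x y p) = begin
      f x · (f y · ∏ xs f)  ≈⟨ R.sym (R.*-assoc (f x) (f y) (∏ xs f)) ⟩
      f x · f y · ∏ xs f    ≈⟨ R.*-cong (R.*-comm (f x) (f y)) (∏-↭ f p) ⟩
      f y · f x · ∏ ys f    ≈⟨ R.*-assoc (f y) (f x) (∏ ys f) ⟩
      f y · (f x · ∏ ys f)  ∎
    ∏-↭ f (↭-trans p q)  = R.trans (∏-↭ f p) (∏-↭ f q)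

  module _ (τ : ℤ → Fˣ) where
    quotient : ℤ × ℤ → Carrier
    quotient (a , b) = τ a ÷ τ b

    private
      value inverse : ℤ → Carrier
      value n   = proj₁ (τ n)
      inverse n = proj₁ (proj₂ (τ n))

      cancel : ∀ xs → ∏ xs value · ∏ xs inverse ≈ 1#
      cancel xs = R.trans (R.sym (∏-· xs value inverse)) (trivial xs)
        where
        trivial : ∀ xs → ∏ xs (λ n → value n · inverse n) ≈ 1#
        trivial []       = R.refl
        trivial (x ∷ xs) = R.trans (R.*-cong (proj₂ (proj₂ (proj₂ (τ x)))) (trivial xs)) (R.*-identityˡ 1#)

      split : ∀ l → ∏ l quotient ≈ ∏ (map proj₁ l) value · ∏ (map proj₂ l) inverse
      split l = R.trans (∏-· l (value ∘ proj₁) (inverse ∘ proj₂))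
        (R.sym (R.*-cong (∏-map proj₁ l value) (∏-map proj₂ l inverse)))

    -- Cross-multiplication avoids negative multiplicities: numerators of one side with denominators
    -- of the other form two lists of equal multiplicities, hence permutations of each other. The
    -- denominators are then cancelled as units.
    divisor⇒∏ : ∀ l l′ → (∀ n → divisor l n ≡ divisor l′ n) → ∏ l quotient ≈ ∏ l′ quotient
    divisor⇒∏ l l′ h = begin
      ∏ l quotient                            ≈⟨ split l ⟩
      N · D⁻¹                                 ≈⟨ R.sym (R.*-identityʳ (N · D⁻¹)) ⟩
      N · D⁻¹ · 1#                            ≈⟨ R.*-cong R.refl (R.sym (cancel (map proj₂ l′))) ⟩
      N · D⁻¹ · (D′ · D′⁻¹)                   ≈⟨ R.*-cong (R.*-comm N D⁻¹) R.refl ⟩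
      D⁻¹ · N · (D′ · D′⁻¹)                   ≈⟨ R.*-assoc D⁻¹ N (D′ · D′⁻¹) ⟩
      D⁻¹ · (N · (D′ · D′⁻¹))                 ≈⟨ R.*-cong R.refl (R.sym (R.*-assoc N D′ D′⁻¹)) ⟩
      D⁻¹ · (N · D′ · D′⁻¹)                   ≈⟨ R.*-cong R.refl (R.*-cong cross R.refl) ⟩
      D⁻¹ · (N′ · D · D′⁻¹)                   ≈⟨ R.*-cong R.refl (R.*-cong (R.*-comm N′ D) R.refl) ⟩
      D⁻¹ · (D · N′ · D′⁻¹)                   ≈⟨ R.*-cong R.refl (R.*-assoc D N′ D′⁻¹) ⟩
      D⁻¹ · (D · (N′ · D′⁻¹))                 ≈⟨ R.sym (R.*-assoc D⁻¹ D (N′ · D′⁻¹)) ⟩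
      D⁻¹ · D · (N′ · D′⁻¹)                   ≈⟨ R.*-cong (R.trans (R.*-comm D⁻¹ D) (cancel (map proj₂ l))) R.refl ⟩
      1# · (N′ · D′⁻¹)                        ≈⟨ R.*-identityˡ (N′ · D′⁻¹) ⟩
      N′ · D′⁻¹                               ≈⟨ R.sym (split l′) ⟩
      ∏ l′ quotient                           ∎
      where
      N = ∏ (map proj₁ l) value
      N′ = ∏ (map proj₁ l′) value
      D = ∏ (map proj₂ l) value
      D′ = ∏ (map proj₂ l′) value
      D⁻¹ = ∏ (map proj₂ l) inverse
      D′⁻¹ = ∏ (map proj₂ l′) inverse
      e : ∀ a b a′ b′ → a - b ≡ a′ - b′ → a + b′ ≡ a′ + b
      e a b a′ b′ eq = trans (e₁ a b b′) (trans (cong (λ z → z + b + b′) eq) (e₂ a′ b b′))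
        where
        e₁ : ∀ a b b′ → a + b′ ≡ a - b + b + b′
        e₁ = solve-∀
        e₂ : ∀ a′ b b′ → a′ - b′ + b + b′ ≡ a′ + b
        e₂ = solve-∀
      mult : ∀ n → multiplicity (map proj₁ l ++ map proj₂ l′) n ≡ multiplicity (map proj₁ l′ ++ map proj₂ l) n
      mult n = trans (∑-++ (map proj₁ l) (map proj₂ l′) (λ x → δ x n))
        (trans (e (multiplicity (map proj₁ l) n) (multiplicity (map proj₂ l) n) (multiplicity (map proj₁ l′) n) (multiplicity (map proj₂ l′) n)
                 (trans (sym (divisor-split l n)) (trans (h n) (divisor-split l′ n))))
          (sym (∑-++ (map proj₁ l′) (map proj₂ l) (λ x → δ x n))))
      cross : N · D′ ≈ N′ · D
      cross = R.trans (R.sym (∏-++ (map proj₁ l) (map proj₂ l′) value))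
        (R.trans (∏-↭ value (multiplicity⇒↭ (map proj₁ l ++ map proj₂ l′) (map proj₁ l′ ++ map proj₂ l) mult))
          (∏-++ (map proj₁ l′) (map proj₂ l) value))

-- The divisors of both sides

roots-nonpositive : ∀ {T t} {r : Fin t → ℤ} {c} → Coded T r c → ∀ {n} → n ≤ 0ℤ → roots r n ≡ 0ℤ
roots-nonpositive {t = t} {r} C {n} n≤0 = cong₂ _+_
  (∑-zero (allFin t) (λ i _ → δ-pos (n₋ ⊕ r₊ i) (e₁ n (r i))))
  (trans (∑-upper-cong {g = λ _ _ → 0ℤ} λ i j i<j → cong₂ _+_
      (δ-pos (n₋ ⊕ pos (r-decreasing i j i<j)) (e₂ n (r i) (r j)))
      (δ-pos (n₋ ⊕ r₊ i ⊕ r₊ j ⊕ +≤+ {0} {1} ℕ.z≤n) (e₃ n (r i) (r j))))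
    (∑-zero (allFin t) (λ i _ → ∑-zero (filter (i Fin.<?_) (allFin t)) (λ _ _ → refl))))
  where
  open Coded C
  n₋ = nonneg n≤0
  r₊ : ∀ i → 0ℤ ≤ r i - 0ℤ - 1ℤ
  r₊ i = pos (r-positive i)
  e₁ : ∀ n r → (0ℤ - n) + (r - 0ℤ - 1ℤ) ≡ r - n - 1ℤ
  e₁ = solve-∀
  e₂ : ∀ n r s → (0ℤ - n) + (r - s - 1ℤ) ≡ r - s - n - 1ℤ
  e₂ = solve-∀
  e₃ : ∀ n r s → (0ℤ - n) + (r - 0ℤ - 1ℤ) + (s - 0ℤ - 1ℤ) + 1ℤ ≡ r + s - n - 1ℤ
  e₃ = solve-∀

-- Serves the boundary case n = g of `wrapped`, where the argument n - g is 0 and no box is counted: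
-- no position is both bead and hole.
A⁻-zero : ∀ {c} (C : Beads c) → A⁻ C 0ℤ ≡ 0ℤ
A⁻-zero {c} C = unique (proj₂ (minusSum C 0ℤ)) (hasSum-ext (λ x → sym (eq x)) hasSum-0)
  where
  e : ∀ a b → a * (1ℤ - b) ≡ a - a * b
  e = solve-∀
  eq : ∀ x → minusTerm C 0ℤ x ≡ 0ℤ
  eq x = cong (_* (1ℤ - θ (x + x - 0ℤ))) (trans (cong (λ z → c x * (1ℤ - c z)) (ℤ.+-identityʳ x))
    (trans (e (c x) (c x)) (trans (cong (_-_ (c x)) (Beads.idem C x)) (ℤ.+-inverseʳ (c x)))))

ε-cases : ∀ s → ε s ≡ 1ℤ ⊎ ε s ≡ -1ℤ
ε-cases (i , j) with does (j ℕ.<? i)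
... | false = inj₁ refl
... | true  = inj₂ refl

α-∑ : ∀ p k i → + α k p i ≡ ∑[ s ← boxes p ] (δ (hook p s) (+ k - + i) * I (ε s ℤ.≟ 1ℤ))
α-∑ p k i = trans (length-filter (λ s → (hook p s ℤ.≟ + k - + i) ×-dec (ε s ℤ.≟ 1ℤ)) (boxes p)) (∑-ext (boxes p) (λ s → indicator (hook p s) (+ k - + i) (ε s ℤ.≟ 1ℤ)))
  where
  indicator : ∀ x y {P : Set} (d : Dec P) → I ((x ℤ.≟ y) ×-dec d) ≡ δ x y * I d
  indicator x y (yes q) = trans (cases (x ℤ.≟ y)) (sym (ℤ.*-identityʳ (δ x y)))
    where
    cases : (e : Dec (x ≡ y)) → I (e ×-dec yes q) ≡ δ x y
    cases (yes x≡y) = sym (δ-≡ x≡y)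
    cases (no x≢y)  = sym (δ-≢ x≢y)
  indicator x y (no ¬q) = trans (I-no ((x ℤ.≟ y) ×-dec no ¬q) (λ r → ¬q (proj₂ r))) (sym (ℤ.*-zeroʳ (δ x y)))

module _ {t : ℕ} {p : Partition} (dd-core : DD₍ 2 ℕ.+ 2 ℕ.* t ₎ p) {v : Fin t → ℤ}
         (V : IsVCoding (2 ℕ.+ 2 ℕ.* t) t p v) where
  open DoubledDistinct p (proj₁ dd-core)
  private
    C = coded dd-core V
    r : Fin t → ℤ
    r i = v i - + t - 1ℤ
    g = 2 ℕ.+ 2 ℕ.* t
    G : ℤ
    G = + g
    G≡T+T : G ≡ + suc t + + suc t
    G≡T+T = 2+2t≡T+T t
    G₊ : 0ℤ ≤ G - 0ℤ - 1ℤ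
    G₊ = +≤+ ℕ.z≤n

  divisor-boxes : ∀ n → divisor (map (λ s → hook p s - ε s * G , hook p s) (boxes p)) n
                ≡ hooks⁺ (n + G) + hooks⁻ (n - G) - hooks⁺ n - hooks⁻ n
  divisor-boxes n = begin
    divisor (map (λ s → hook p s - ε s * G , hook p s) (boxes p)) n
      ≡⟨ ∑-map (λ s → hook p s - ε s * G , hook p s) (boxes p) (λ (a , b) → δ a n - δ b n) ⟩
    ∑ (boxes p) (λ s → δ (hook p s - ε s * G) n - δ (hook p s) n)
      ≡⟨ ∑-ext (boxes p) (λ s → term (hook p s) (ε s) (ε-cases s)) ⟩
    ∑ (boxes p) (λ s → pl (n + G) s + mi (n - G) s - pl n s - mi n s)
      ≡⟨ ∑-- (boxes p) (λ s → pl (n + G) s + mi (n - G) s - pl n s) (mi n) ⟩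
    ∑ (boxes p) (λ s → pl (n + G) s + mi (n - G) s - pl n s) - hooks⁻ n
      ≡⟨ cong (_- hooks⁻ n) (trans (∑-- (boxes p) (λ s → pl (n + G) s + mi (n - G) s) (pl n))
           (cong (_- hooks⁺ n) (∑-+ (boxes p) (pl (n + G)) (mi (n - G))))) ⟩
    hooks⁺ (n + G) + hooks⁻ (n - G) - hooks⁺ n - hooks⁻ n ∎
    where
    open ≡-Reasoning
    pl mi : ℤ → Box → ℤ
    pl m s = δ (hook p s) m * I (ε s ℤ.≟ 1ℤ)
    mi m s = δ (hook p s) m * I (ε s ℤ.≟ -1ℤ)
    e₁ : ∀ h g n → h - 1ℤ * g - n ≡ h - (n + g)
    e₁ = solve-∀
    e₂ : ∀ h g n → h - -1ℤ * g - n ≡ h - (n - g)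
    e₂ = solve-∀
    e₃ : ∀ a b d → a - d ≡ a * 1ℤ + b * 0ℤ - d * 1ℤ - d * 0ℤ
    e₃ = solve-∀
    e₄ : ∀ a b d → b - d ≡ a * 0ℤ + b * 1ℤ - d * 0ℤ - d * 1ℤ
    e₄ = solve-∀
    term : ∀ h ε → ε ≡ 1ℤ ⊎ ε ≡ -1ℤ → δ (h - ε * G) n - δ h n
         ≡ δ h (n + G) * I (ε ℤ.≟ 1ℤ) + δ h (n - G) * I (ε ℤ.≟ -1ℤ) - δ h n * I (ε ℤ.≟ 1ℤ) - δ h n * I (ε ℤ.≟ -1ℤ)
    term h _ (inj₁ refl) = trans (cong (_- δ h n) (δ-shift (h - 1ℤ * G) n h (n + G) (e₁ h G n))) (e₃ (δ h (n + G)) (δ h (n - G)) (δ h n))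
    term h _ (inj₂ refl) = trans (cong (_- δ h n) (δ-shift (h - -1ℤ * G) n h (n - G) (e₂ h G n))) (e₄ (δ h (n + G)) (δ h (n - G)) (δ h n))

  private
    N = [1⋯ g ℕ.∸ 1 ]
    ∑α⁻ ∑α⁺ : ℤ → ℤ
    ∑α⁻ n = ∑ N (λ i → hooks⁺ (G - + i) * δ (- + i) n)
    ∑α⁺ n = ∑ N (λ i → hooks⁺ (G - + i) * δ (+ i) n)

    pick : ∀ (f : ℕ → ℤ) {k} → 1 ℕ.≤ k → k ℕ.≤ g ℕ.∸ 1 → (∀ i → ¬ i ≡ k → f i ≡ 0ℤ) → ∑ N f ≡ f k
    pick f 1≤k k≤ other = ∑-single ([1⋯]-unique (g ℕ.∸ 1)) f (∈-[1⋯]⁺ 1≤k k≤) (λ i _ → other i)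

    hooks⁺-g : hooks⁺ G ≡ 0ℤ
    hooks⁺-g = ∑-zero (boxes p) (λ s s∈ → cong (_* I (ε s ℤ.≟ 1ℤ)) (δ-≢ λ hook≡ →
      proj₂ dd-core s s∈ (ℕ.∣-reflexive (sym (cong ∣_∣ hook≡)))))

    ∑α⁻-positive : ∀ {n} → 0ℤ < n → ∑α⁻ n ≡ 0ℤ
    ∑α⁻-positive {n} n>0 = ∑-zero N (λ i _ → trans (cong (_*_ (hooks⁺ (G - + i))) (δ-neg (pos n>0 ⊕ +≤+ {0} {i} ℕ.z≤n) (e n (+ i)))) (ℤ.*-zeroʳ (hooks⁺ (G - + i))))
      where e : ∀ n i → (n - 0ℤ - 1ℤ) + i ≡ n - - i - 1ℤ
            e = solve-∀

    ∑α⁺-nonpositive : ∀ {n} → n ≤ 0ℤ → ∑α⁺ n ≡ 0ℤ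
    ∑α⁺-nonpositive {n} n≤0 = ∑-zero N (λ i i∈ → trans (cong (_*_ (hooks⁺ (G - + i))) (δ-pos (nonneg n≤0 ⊕ pos (+<+ (proj₁ (∈-[1⋯]⁻ i∈)))) (e n (+ i)))) (ℤ.*-zeroʳ (hooks⁺ (G - + i))))
      where e : ∀ n i → (0ℤ - n) + (i - 0ℤ - 1ℤ) ≡ i - n - 1ℤ
            e = solve-∀

    -- The range 1, ..., g - 1 of i covers all k: at k = 0 a core has no hook of length g, and from
    -- k = g on the argument is not positive.
    ∑α⁻-nonpositive : ∀ k → ∑α⁻ (- + k) ≡ hooks⁺ (- + k + G)
    ∑α⁻-nonpositive k with 1 ℕ.≤? k | k ℕ.≤? g ℕ.∸ 1
    ... | yes 1≤k | yes k≤ = trans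
        (pick (λ i → hooks⁺ (G - + i) * δ (- + i) (- + k)) 1≤k k≤ (λ i i≢k → trans (cong (_*_ (hooks⁺ (G - + i))) (δ-≢ (λ eq → i≢k (ℤ.+-injective (ℤ.neg-injective eq))))) (ℤ.*-zeroʳ (hooks⁺ (G - + i)))))
        (trans (cong (_*_ (hooks⁺ (G - + k))) (δ-≡ refl)) (trans (ℤ.*-identityʳ (hooks⁺ (G - + k))) (cong hooks⁺ (ℤ.+-comm G (- + k)))))
    ... | no k<1 | _ = trans (∑-zero N (λ i i∈ → trans (cong (_*_ (hooks⁺ (G - + i))) (δ-≢ (λ eq → k<1 (subst (1 ℕ.≤_) (ℤ.+-injective (ℤ.neg-injective eq)) (proj₁ (∈-[1⋯]⁻ i∈)))))) (ℤ.*-zeroʳ (hooks⁺ (G - + i)))))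
        (sym (trans (cong (λ j → hooks⁺ (- + j + G)) (ℕ.n<1⇒n≡0 (ℕ.≰⇒> k<1))) hooks⁺-g))
    ... | yes _ | no k≰ = trans (∑-zero N (λ i i∈ → trans (cong (_*_ (hooks⁺ (G - + i))) (δ-≢ (λ eq → k≰ (subst (ℕ._≤ g ℕ.∸ 1) (ℤ.+-injective (ℤ.neg-injective eq)) (proj₂ (∈-[1⋯]⁻ i∈)))))) (ℤ.*-zeroʳ (hooks⁺ (G - + i)))))
        (sym (proj₁ (hooks-nonpositive (≤-from (nonneg (+≤+ (ℕ.≰⇒> k≰))) (e (+ k) G)))))
      where e : ∀ k g → k - g ≡ 0ℤ - (- k + g)
            e = solve-∀

    ∑α⁺-at : ∀ k → 1 ℕ.≤ k → k ℕ.≤ g ℕ.∸ 1 → ∑α⁺ (+ k) ≡ hooks⁺ (G - + k)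
    ∑α⁺-at k 1≤k k≤ = trans
        (pick (λ i → hooks⁺ (G - + i) * δ (+ i) (+ k)) 1≤k k≤ (λ i i≢k → trans (cong (_*_ (hooks⁺ (G - + i))) (δ-≢ (λ eq → i≢k (ℤ.+-injective eq)))) (ℤ.*-zeroʳ (hooks⁺ (G - + i)))))
        (trans (cong (_*_ (hooks⁺ (G - + k))) (δ-≡ refl)) (ℤ.*-identityʳ (hooks⁺ (G - + k))))

    ∑α⁺-beyond : ∀ {n} → G ≤ n → ∑α⁺ n ≡ 0ℤ
    ∑α⁺-beyond {n} G≤n = ∑-zero N (λ i i∈ → trans (cong (_*_ (hooks⁺ (G - + i))) (δ-neg (nonneg G≤n ⊕ pos (+<+ (ℕ.s≤s (proj₂ (∈-[1⋯]⁻ i∈))))) (e n (+ i) G))) (ℤ.*-zeroʳ (hooks⁺ (G - + i))))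
      where e : ∀ n i g → (n - g) + (g - i - 1ℤ) ≡ n - i - 1ℤ
            e = solve-∀

    coefficient : ∀ {n} → 0ℤ < n → hookCoefficient beads G n ≡ roots r n - roots (ρ t) n
    coefficient {n} n>0 = trans (cong (λ z → hookCoefficient beads z n) G≡T+T)
      (hookCoefficient≡roots C n n>0)

    -- At most one summand is nonzero: `hooks⁻` vanishes for n ≤ g, and the α-product has no
    -- denominator τ(n) with n ≥ g.
    wrapped≡ : ∀ {n} → 0ℤ < n → wrapped beads G n ≡ hooks⁻ (n - G) + ∑α⁺ n
    wrapped≡ {n} n>0 with G ℤ.≤? n
    ... | yes G≤n = trans (at (ℤ.<-cmp G n)) (sym (trans (cong (_+_ (hooks⁻ (n - G))) (∑α⁺-beyond G≤n)) (ℤ.+-identityʳ (hooks⁻ (n - G)))))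
      where
      e : ∀ n g → n - g - 1ℤ ≡ n - g - 0ℤ - 1ℤ
      e = solve-∀
      at : Tri (G < n) (G ≡ n) (n < G) → A⁻ beads (n - G) ≡ hooks⁻ (n - G)
      at (tri< G<n _ _) = sym (hooks⁻≡A⁻ (n - G) (<-from (pos G<n) (e n G)))
      at (tri≈ _ refl _) = trans (cong (A⁻ beads) (ℤ.+-inverseʳ G)) (trans (A⁻-zero beads) (sym (proj₂ (hooks-nonpositive (ℤ.≤-reflexive (ℤ.+-inverseʳ G))))))
      at (tri> _ _ n<G) = ⊥-elim (ℤ.<⇒≱ n<G G≤n)
    ... | no G≰n = trans (sym (hooks⁺≡A⁺ (G - n) (<-from (pos n<G) (e G n))))
        (trans (sym (at (+∣n∣ n>0)))
        (sym (trans (cong (_+ ∑α⁺ n) (proj₂ (hooks-nonpositive (ℤ.i≤j⇒i-j≤0 (ℤ.<⇒≤ n<G))))) (ℤ.+-identityˡ (∑α⁺ n)))))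
      where
      n<G : n < G
      n<G = ℤ.≰⇒> G≰n
      e : ∀ g n → g - n - 1ℤ ≡ g - n - 0ℤ - 1ℤ
      e = solve-∀
      +∣n∣ : 0ℤ < n → ∃[ k ] n ≡ + k
      +∣n∣ n>0 = ∣ n ∣ , sym (ℤ.0≤i⇒+∣i∣≡i (ℤ.<⇒≤ n>0))
      at : ∃[ k ] n ≡ + k → ∑α⁺ n ≡ hooks⁺ (G - n)
      at (k , refl) = ∑α⁺-at k (ℤ.drop‿+<+ n>0) (ℕ.≤-pred (ℤ.drop‿+<+ n<G))

  -- For n ≤ 0 only the factors τ(h - g) with h < g and ε = 1 occur on the left, and they are the
  -- numerators τ(-i) of the α-product. For n > 0 the bead count decides.
  divisor-identity : ∀ n → hooks⁺ (n + G) + hooks⁻ (n - G) - hooks⁺ n - hooks⁻ n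
                   ≡ ∑α⁻ n - ∑α⁺ n + (roots r n - roots (ρ t) n)
  divisor-identity n with n ℤ.≤? 0ℤ
  ... | yes n≤0 = trans
      (cong₂ _-_ (cong₂ _-_ (cong (_+_ (hooks⁺ (n + G))) (proj₂ (hooks-nonpositive n-G≤0))) (proj₁ (hooks-nonpositive n≤0))) (proj₂ (hooks-nonpositive n≤0)))
      (trans (e (hooks⁺ (n + G))) (sym (cong₂ _+_ (cong₂ _-_ (trans (cong ∑α⁻ n≡) (trans (∑α⁻-nonpositive ∣ - n ∣) (cong (λ z → hooks⁺ (z + G)) (sym n≡)))) (∑α⁺-nonpositive n≤0))
        (cong₂ _-_ (roots-nonpositive C n≤0) (roots-nonpositive (coded₀ t) n≤0)))))
    where
    e : ∀ h → h + 0ℤ - 0ℤ - 0ℤ ≡ h - 0ℤ + (0ℤ - 0ℤ)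
    e = solve-∀
    e′ : ∀ n g → (0ℤ - n) + (g - 0ℤ - 1ℤ) + 1ℤ ≡ 0ℤ - (n - g)
    e′ = solve-∀
    e″ : ∀ n → 0ℤ - n ≡ - n
    e″ = solve-∀
    n-G≤0 : n - G ≤ 0ℤ
    n-G≤0 = ≤-from (nonneg n≤0 ⊕ G₊ ⊕ +≤+ {0} {1} ℕ.z≤n) (e′ n G)
    n≡ : n ≡ - + ∣ - n ∣
    n≡ = trans (sym (ℤ.neg-involutive n)) (cong -_ (sym (ℤ.0≤i⇒+∣i∣≡i (subst (0ℤ ≤_) (e″ n) (nonneg n≤0)))))
  ... | no n≰0 = begin
      hooks⁺ (n + G) + hooks⁻ (n - G) - hooks⁺ n - hooks⁻ n
        ≡⟨ cong₂ _-_ (cong₂ _-_ (cong (_+ hooks⁻ (n - G)) (hooks⁺≡A⁺ (n + G) (<-from (pos n>0 ⊕ G₊ ⊕ +≤+ {0} {1} ℕ.z≤n) (e₁ n G)))) (hooks⁺≡A⁺ n n>0)) (hooks⁻≡A⁻ n n>0) ⟩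
      A⁺ beads (n + G) + hooks⁻ (n - G) - A⁺ beads n - A⁻ beads n
        ≡⟨ e₂ (A⁺ beads (n + G)) (hooks⁻ (n - G)) (A⁺ beads n) (A⁻ beads n) (∑α⁺ n) ⟩
      0ℤ - ∑α⁺ n + (A⁺ beads (n + G) + (hooks⁻ (n - G) + ∑α⁺ n) - A⁺ beads n - A⁻ beads n)
        ≡⟨ cong₂ (λ u w → u - ∑α⁺ n + (A⁺ beads (n + G) + w - A⁺ beads n - A⁻ beads n)) (sym (∑α⁻-positive n>0)) (sym (wrapped≡ n>0)) ⟩
      ∑α⁻ n - ∑α⁺ n + hookCoefficient beads G n
        ≡⟨ cong (_+_ (∑α⁻ n - ∑α⁺ n)) (coefficient n>0) ⟩
      ∑α⁻ n - ∑α⁺ n + (roots r n - roots (ρ t) n) ∎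
    where
    open ≡-Reasoning
    n>0 : 0ℤ < n
    n>0 = ℤ.≰⇒> n≰0
    e₁ : ∀ n g → (n - 0ℤ - 1ℤ) + (g - 0ℤ - 1ℤ) + 1ℤ ≡ n + g - 0ℤ - 1ℤ
    e₁ = solve-∀
    e₂ : ∀ a h a₀ b s → a + h - a₀ - b ≡ 0ℤ - s + (a + (h + s) - a₀ - b)
    e₂ = solve-∀

  αPairs rootPairs : List (ℤ × ℤ)
  αPairs = concatMap (λ i → replicate (α g p i) (- + i , + i)) N
  rootPairs = map (λ i → r i , index i) (allFin t)

  pairPairs : List (ℤ × ℤ)
  pairPairs = concatMap (λ i → concatMap (λ j → (r i - r j , index j - index i) ∷ (r i + r j , G - index i - index j) ∷ [])
                                         (filter (i Fin.<?_) (allFin t))) (allFin t)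

  divisor-α : ∀ n → divisor αPairs n ≡ ∑α⁻ n - ∑α⁺ n
  divisor-α n = trans (∑-concatMap (λ i → replicate (α g p i) (- + i , + i)) N (λ (a , b) → δ a n - δ b n))
    (trans (∑-ext N (λ i → trans (∑-replicate (α g p i) (- + i , + i) (λ (a , b) → δ a n - δ b n))
        (trans (cong (_* (δ (- + i) n - δ (+ i) n)) (α-∑ p g i)) (e (hooks⁺ (G - + i)) (δ (- + i) n) (δ (+ i) n)))))
      (∑-- N (λ i → hooks⁺ (G - + i) * δ (- + i) n) (λ i → hooks⁺ (G - + i) * δ (+ i) n)))
    where e : ∀ h a b → h * (a - b) ≡ h * a - h * b
          e = solve-∀

  divisor-roots : ∀ n → divisor rootPairs n ≡ ∑ᶠ (λ i → δ (r i) n) - ∑ᶠ (λ i → δ (ρ t i) n)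
  divisor-roots n = trans (∑-map (λ i → r i , index i) (allFin t) (λ (a , b) → δ a n - δ b n))
    (trans (∑-- (allFin t) (λ i → δ (r i) n) (λ i → δ (index i) n)) (cong (_-_ (∑ᶠ (λ i → δ (r i) n))) (∑-index t n)))

  -- In 1-based numbering ρᵢ = t + 1 - i, so the denominators j - i and g - i - j are ρᵢ - ρⱼ and ρᵢ
  -- + ρⱼ: the numerators of the empty partition.
  divisor-pairs : ∀ n → divisor pairPairs n
                ≡ ∑-upper (λ i j → δ (r i - r j) n + δ (r i + r j) n) - ∑-upper (λ i j → δ (ρ t i - ρ t j) n + δ (ρ t i + ρ t j) n)
  divisor-pairs n = trans (∑-concatMap _ (allFin t) d) (trans (∑-ext (allFin t) row) (∑-- (allFin t) (λ i → ∑ (later i) (P r i)) (λ i → ∑ (later i) (P (ρ t) i))))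
    where
    d : ℤ × ℤ → ℤ
    d (a , b) = δ a n - δ b n
    later : Fin t → List (Fin t)
    later i = filter (i Fin.<?_) (allFin t)
    P : (Fin t → ℤ) → Fin t → Fin t → ℤ
    P q i j = δ (q i - q j) n + δ (q i + q j) n
    e₀ : ∀ a b a′ b′ → (a - a′) + ((b - b′) + 0ℤ) ≡ (a + b) - (a′ + b′)
    e₀ = solve-∀
    e₁ : ∀ n t i j → (1ℤ + j) - (1ℤ + i) - n ≡ (t - i) - (t - j) - n
    e₁ = solve-∀
    e₂ : ∀ n t i j → ((1ℤ + t) + (1ℤ + t)) - (1ℤ + i) - (1ℤ + j) - n ≡ (t - i) + (t - j) - n
    e₂ = solve-∀
    cell : ∀ i j → ∑ ((r i - r j , index j - index i) ∷ (r i + r j , G - index i - index j) ∷ []) d ≡ P r i j - P (ρ t) i j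
    cell i j = trans (e₀ (δ (r i - r j) n) (δ (r i + r j) n) (δ (index j - index i) n) (δ (G - index i - index j) n))
      (cong (_-_ (P r i j)) (cong₂ _+_ (δ-shift (index j - index i) n (ρ t i - ρ t j) n (e₁ n (+ t) (+ toℕ i) (+ toℕ j)))
        (δ-shift (G - index i - index j) n (ρ t i + ρ t j) n (trans (cong (λ z → z - index i - index j - n) G≡T+T) (e₂ n (+ t) (+ toℕ i) (+ toℕ j))))))
    row : ∀ i → ∑ (concatMap (λ j → (r i - r j , index j - index i) ∷ (r i + r j , G - index i - index j) ∷ []) (later i)) d
        ≡ ∑ (later i) (P r i) - ∑ (later i) (P (ρ t) i)
    row i = trans (∑-concatMap (λ j → (r i - r j , index j - index i) ∷ (r i + r j , G - index i - index j) ∷ []) (later i) d)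
      (trans (∑-ext (later i) (cell i)) (∑-- (later i) (P r i) (P (ρ t) i)))

  divisors-agree : ∀ n → divisor (map (λ s → hook p s - ε s * G , hook p s) (boxes p)) n ≡ divisor ((αPairs ++ rootPairs) ++ pairPairs) n
  divisors-agree n = begin
    divisor (map (λ s → hook p s - ε s * G , hook p s) (boxes p)) n
      ≡⟨ trans (divisor-boxes n) (divisor-identity n) ⟩
    ∑α⁻ n - ∑α⁺ n + (roots r n - roots (ρ t) n)
      ≡⟨ e (∑α⁻ n - ∑α⁺ n) (∑ᶠ (λ i → δ (r i) n)) (∑-upper (λ i j → δ (r i - r j) n + δ (r i + r j) n)) (∑ᶠ (λ i → δ (ρ t i) n)) (∑-upper (λ i j → δ (ρ t i - ρ t j) n + δ (ρ t i + ρ t j) n)) ⟩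
    (∑α⁻ n - ∑α⁺ n) + (∑ᶠ (λ i → δ (r i) n) - ∑ᶠ (λ i → δ (ρ t i) n))
      + (∑-upper (λ i j → δ (r i - r j) n + δ (r i + r j) n) - ∑-upper (λ i j → δ (ρ t i - ρ t j) n + δ (ρ t i + ρ t j) n))
      ≡⟨ sym (cong₂ _+_ (cong₂ _+_ (divisor-α n) (divisor-roots n)) (divisor-pairs n)) ⟩
    divisor αPairs n + divisor rootPairs n + divisor pairPairs n
      ≡⟨ sym (trans (∑-++ (αPairs ++ rootPairs) pairPairs d) (cong (_+ divisor pairPairs n) (∑-++ αPairs rootPairs d))) ⟩
    divisor ((αPairs ++ rootPairs) ++ pairPairs) n ∎
    where
    open ≡-Reasoning
    d : ℤ × ℤ → ℤ
    d (a , b) = δ a n - δ b n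
    e : ∀ a s u s′ u′ → a + ((s + u) - (s′ + u′)) ≡ a + (s - s′) + (u - u′)
    e = solve-∀

  product-formula : ∀ {c ℓ₁ ℓ₂} (F : HeytingField c ℓ₁ ℓ₂) → let open FieldNotation F renaming (_*_ to _·_) in (τ : ℤ → Fˣ) →
    (∏[ s ← boxes p ] (τ (hook p s - ε s * G) ÷ τ (hook p s)))
    ≈ (∏[ i ← N ] ((τ (- + i) ÷ τ (+ i)) ^ α g p i))
      · (∏[ i ← allFin t ] (τ (r i) ÷ τ (index i)))
      · (∏[ i ← allFin t ] (∏[ j ← filter (i Fin.<?_) (allFin t) ]
          ((τ (r i - r j) ÷ τ (index j - index i)) · (τ (r i + r j) ÷ τ (G - index i - index j)))))
  product-formula F τ = begin
    ∏ (boxes p) (λ s → τ (hook p s - ε s * G) ÷ τ (hook p s))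
      ≈⟨ R.sym (∏-map (λ s → hook p s - ε s * G , hook p s) (boxes p) q) ⟩
    ∏ (map (λ s → hook p s - ε s * G , hook p s) (boxes p)) q
      ≈⟨ divisor⇒∏ τ (map (λ s → hook p s - ε s * G , hook p s) (boxes p)) ((αPairs ++ rootPairs) ++ pairPairs) divisors-agree ⟩
    ∏ ((αPairs ++ rootPairs) ++ pairPairs) q
      ≈⟨ R.trans (∏-++ (αPairs ++ rootPairs) pairPairs q) (R.*-cong (∏-++ αPairs rootPairs q) R.refl) ⟩
    ∏ αPairs q · ∏ rootPairs q · ∏ pairPairs q
      ≈⟨ R.*-cong (R.*-cong
           (R.trans (∏-concatMap (λ i → replicate (α g p i) (- + i , + i)) N q) (∏-cong N (λ i → ∏-replicate (α g p i) (- + i , + i) q)))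
           (∏-map (λ i → r i , index i) (allFin t) q))
           (R.trans (∏-concatMap (λ i → concatMap (cell i) (later i)) (allFin t) q)
             (∏-cong (allFin t) λ i → R.trans (∏-concatMap (cell i) (later i) q)
               (∏-cong (later i) λ j → R.*-cong R.refl (R.*-identityʳ (q (r i + r j , G - index i - index j)))))) ⟩
    _ ∎
    where
    open FieldNotation F renaming (_*_ to _·_)
    open Products F
    module R = CommutativeRing (HeytingCommutativeRing.commutativeRing (HeytingField.heytingCommutativeRing F))
    open SetoidReasoning R.setoid
    q : ℤ × ℤ → Carrier
    q = quotient τ
    later : Fin t → List (Fin t)
    later i = filter (i Fin.<?_) (allFin t)
    cell : Fin t → Fin t → List (ℤ × ℤ)
    cell i j = (r i - r j , index j - index i) ∷ (r i + r j , G - index i - index j) ∷ []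

-- The hypothesis is the conclusion multiplied by 24d; the 24 combines the 12 with the half in d/2 -
-- 1. Unnormalised rationals reduce the equation to this cross-multiplied form.
size-formula : ∀ m (a s : ℤ) → let d = + suc m in + 24 * d * a ≡ + 24 * s - d * (d - + 2) * (d - 1ℤ) →
  a / 1 ≡ (1ℤ / suc m) ℚ.* (s / 1) ℚ.- ((d / 2 ℚ.- 1ℚ) ℚ.* (d / 1 ℚ.- 1ℚ)) ℚ.* (1ℤ / 12)
size-formula m a s h = ℚ.toℚᵘ-injective (begin
  ℚ.toℚᵘ (a / 1)
    ≈⟨ ℚ.toℚᵘ-fromℚᵘ (ℚᵘ.mkℚᵘ a 0) ⟩
  ℚᵘ.mkℚᵘ a 0
    ≈⟨ ℚᵘ.*≡* cleared ⟩
  P ℚᵘ.+ ℚᵘ.- (A₁ ℚᵘ.* A₂ ℚᵘ.* ℚᵘ.mkℚᵘ 1ℤ 11)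
    ≈⟨ ℚᵘ.≃-sym (sub-homo ((1ℤ / suc m) ℚ.* (s / 1)) (((d / 2 ℚ.- 1ℚ) ℚ.* (d / 1 ℚ.- 1ℚ)) ℚ.* (1ℤ / 12))
         (ℚᵘ.≃-trans (ℚ.toℚᵘ-homo-* (1ℤ / suc m) (s / 1)) (ℚᵘ.*-cong (ℚ.toℚᵘ-fromℚᵘ (ℚᵘ.mkℚᵘ 1ℤ m)) (ℚ.toℚᵘ-fromℚᵘ (ℚᵘ.mkℚᵘ s 0))))
         (ℚᵘ.≃-trans (ℚ.toℚᵘ-homo-* ((d / 2 ℚ.- 1ℚ) ℚ.* (d / 1 ℚ.- 1ℚ)) (1ℤ / 12))
           (ℚᵘ.*-cong (ℚᵘ.≃-trans (ℚ.toℚᵘ-homo-* (d / 2 ℚ.- 1ℚ) (d / 1 ℚ.- 1ℚ))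
               (ℚᵘ.*-cong (sub-homo (d / 2) 1ℚ (ℚ.toℚᵘ-fromℚᵘ (ℚᵘ.mkℚᵘ d 1)) (ℚᵘ.≃-refl {ℚᵘ.1ℚᵘ})) (sub-homo (d / 1) 1ℚ (ℚ.toℚᵘ-fromℚᵘ (ℚᵘ.mkℚᵘ d 0)) (ℚᵘ.≃-refl {ℚᵘ.1ℚᵘ}))))
             (ℚ.toℚᵘ-fromℚᵘ (ℚᵘ.mkℚᵘ 1ℤ 11))))) ⟩
  ℚ.toℚᵘ ((1ℤ / suc m) ℚ.* (s / 1) ℚ.- ((d / 2 ℚ.- 1ℚ) ℚ.* (d / 1 ℚ.- 1ℚ)) ℚ.* (1ℤ / 12)) ∎)
  where
  open ℚᵘ.≃-Reasoning
  d = + suc m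
  P = ℚᵘ.mkℚᵘ 1ℤ m ℚᵘ.* ℚᵘ.mkℚᵘ s 0
  A₁ = ℚᵘ.mkℚᵘ d 1 ℚᵘ.+ ℚᵘ.- ℚᵘ.1ℚᵘ
  A₂ = ℚᵘ.mkℚᵘ d 0 ℚᵘ.+ ℚᵘ.- ℚᵘ.1ℚᵘ
  sub-homo : ∀ x y {u w} → ℚ.toℚᵘ x ℚᵘ.≃ u → ℚ.toℚᵘ y ℚᵘ.≃ w → ℚ.toℚᵘ (x ℚ.- y) ℚᵘ.≃ u ℚᵘ.+ ℚᵘ.- w
  sub-homo x y p q = ℚᵘ.≃-trans (ℚ.toℚᵘ-homo-+ x (ℚ.- y)) (ℚᵘ.+-cong p (ℚᵘ.≃-trans (ℚ.toℚᵘ-homo‿- y) (ℚᵘ.-‿cong q)))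
  e₁ : ∀ a d → a * (d * 1ℤ * + 24) ≡ + 24 * d * a
  e₁ = solve-∀
  e₂ : ∀ s d → + 24 * s - d * (d - + 2) * (d - 1ℤ) ≡ (1ℤ * s * + 24 + - ((d * 1ℤ + -1ℤ * + 2) * (d * 1ℤ + -1ℤ * 1ℤ) * 1ℤ) * (d * 1ℤ)) * 1ℤ
  e₂ = solve-∀
  cleared : a * + (suc m ℕ.* 1 ℕ.* 24) ≡ (1ℤ * s * + 24 + - ((d * 1ℤ + -1ℤ * + 2) * (d * 1ℤ + -1ℤ * 1ℤ) * 1ℤ) * + (suc m ℕ.* 1)) * 1ℤ
  cleared = trans (cong (_*_ a) (trans (ℤ.pos-* (suc m ℕ.* 1) 24) (cong (_* + 24) (ℤ.pos-* (suc m) 1)))) (trans (e₁ a d) (trans h (trans (e₂ s d)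
    (cong (λ z → (1ℤ * s * + 24 + - ((d * 1ℤ + -1ℤ * + 2) * (d * 1ℤ + -1ℤ * 1ℤ) * 1ℤ) * z) * 1ℤ) (sym (ℤ.pos-* (suc m) 1))))))

theorem3p2 :
    (c ℓ₁ ℓ₂ : Level) (t : ℕ) → 1 ℕ.≤ t →
    let g : ℕ
        g = 2 ℕ.+ 2 ℕ.* t
    in
    (ω : Partition) → DD₍ g ₎ ω →
    (v : Fin t → ℤ) → IsVCoding g t ω v →
    let r : Fin t → ℤ
        r i = v i - + t - 1ℤ
    in
    (+ size ω / 1
      ≡ (1ℤ / g) ℚ.* ((∑[ i ← allFin t ] (r i ℤ.* r i)) / 1)
        ℚ.- ((+ g / 2 ℚ.- 1ℚ) ℚ.* (+ g / 1 ℚ.- 1ℚ)) ℚ.* (1ℤ / 12))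
    ×
    ((F : HeytingField c ℓ₁ ℓ₂) →
      let open FieldNotation F renaming (_*_ to _·_) in
      (τ : ℤ → Fˣ) →
      (∏[ s ← boxes ω ] (τ (hook ω s - ε s ℤ.* + g) ÷ τ (hook ω s)))
      ≈ (∏[ i ← [1⋯ g ∸ 1 ] ] ((τ (- (+ i)) ÷ τ (+ i)) ^ α g ω i))
        · (∏[ i ← allFin t ] (τ (r i) ÷ τ (index i)))
        · (∏[ i ← allFin t ] (∏[ j ← filter (i <?_) (allFin t) ]
            ((τ (r i - r j) ÷ τ (index j - index i))
              · (τ (r i + r j) ÷ τ (+ g - index i - index j))))))
theorem3p2 c ℓ₁ ℓ₂ t 1≤t ω dd-core v V =
  size-formula (suc (2 ℕ.* t)) (+ size ω) S cleared , product-formula dd-core V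
  where
  open ≡-Reasoning
  g : ℕ
  g = 2 ℕ.+ 2 ℕ.* t
  S Sρ : ℤ
  S = ∑ᶠ (λ i → (v i - + t - 1ℤ) * (v i - + t - 1ℤ))
  Sρ = ∑ᶠ (λ i → ρ t i * ρ t i)
  e₁ : ∀ t a → + 24 * ((1ℤ + t) + (1ℤ + t)) * a ≡ + 24 * (((1ℤ + t) + (1ℤ + t)) * a)
  e₁ = solve-∀
  e₂ : ∀ s q → + 24 * (s - q) ≡ + 24 * s - + 4 * (+ 6 * q)
  e₂ = solve-∀
  -- Origin of the constant term: for g = 2t + 2, g (g - 2) (g - 1) is 4 t (t + 1) (2t + 1), that is
  -- 24 times 1² + ... + t².
  e₃ : ∀ t s → + 24 * s - + 4 * (t * (t + 1ℤ) * (+ 2 * t + 1ℤ))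
     ≡ + 24 * s - ((1ℤ + t) + (1ℤ + t)) * ((1ℤ + t) + (1ℤ + t) - + 2) * ((1ℤ + t) + (1ℤ + t) - 1ℤ)
  e₃ = solve-∀
  g≡ : + g ≡ + suc t + + suc t
  g≡ = 2+2t≡T+T t
  cleared : + 24 * + g * + size ω ≡ + 24 * S - + g * (+ g - + 2) * (+ g - 1ℤ)
  cleared = begin
    + 24 * + g * + size ω
      ≡⟨ cong (λ z → + 24 * z * + size ω) g≡ ⟩
    + 24 * (+ suc t + + suc t) * + size ω
      ≡⟨ e₁ (+ t) (+ size ω) ⟩
    + 24 * ((+ suc t + + suc t) * + size ω)
      ≡⟨ cong (_*_ (+ 24)) (size-squares (coded dd-core V)) ⟩
    + 24 * (S - Sρ)
      ≡⟨ e₂ S Sρ ⟩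
    + 24 * S - + 4 * (+ 6 * Sρ)
      ≡⟨ cong (λ z → + 24 * S - + 4 * z) (∑ρ² t) ⟩
    + 24 * S - + 4 * (+ t * (+ t + 1ℤ) * (+ 2 * + t + 1ℤ))
      ≡⟨ e₃ (+ t) S ⟩
    + 24 * S - (+ suc t + + suc t) * (+ suc t + + suc t - + 2) * (+ suc t + + suc t - 1ℤ)
      ≡⟨ cong (λ z → + 24 * S - z * (z - + 2) * (z - 1ℤ)) (sym g≡) ⟩
    + 24 * S - + g * (+ g - + 2) * (+ g - 1ℤ) ∎
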